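{- Let $G_1$ and $G_2$ be (finite) graphs. There exists an internally 4-connected near-regular matroid $M$ that has both the cycle matroid $M(G_1)$ and the dual $M(G_2)^*$ of the cycle matroid of $G_2$ as minors.
   Context: A matroid is near-regular if it is representable over every field, except possibly $\mathrm{GF}(2)$. For a matroid $M$ with rank function $r$, a partition $(A,B)$ of its ground set is $k$-separating if $r(A)+r(B)-r(M)<k$, and it is a $k$-separation if moreover $\min\{|A|,|B|\}\ge k$. A matroid is 3-connected if it has no 1- or 2-separation. A matroid is internally 4-connected if it is 3-connected and $\min\{|X|,|Y|\}=3$ for every 3-separation $(X,Y)$. -}

module Defs where

open import Level using (Level; _⊔_; Setω)
open import Data.Nat using (ℕ; zero; suc; _+_; _∸_; _≤_; _<_; _⊓_)
open import Data.Fin using (Fin; zero; suc; _≟_)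
open import Data.Fin.Properties using (any?)
open import Data.Fin.Subset using (Subset; _∈_; _∉_; _⊆_; _∪_; _∩_; ∁; ⊤; ∣_∣)
open import Data.Fin.Subset.Properties using (_∈?_)
open import Data.Vec using (tabulate)
open import Data.Product using (Σ; ∃; ∃-syntax; _×_; _,_; proj₁; proj₂)
open import Data.Sum using (_⊎_)
open import Relation.Nullary using (¬_; does)
open import Relation.Nullary.Decidable using (_×-dec_)
open import Relation.Binary.PropositionalEquality using (_≡_)
open import Function.Definitions using (Injective)
open import Algebra.Bundles using (CommutativeRing)

record Matroid : Set where
  field
    n     : ℕ
    r     : Subset n → ℕ
    r-bound  : ∀ X → r X ≤ ∣ X ∣
    r-mono   : ∀ X Y → X ⊆ Y → r X ≤ r Y
    r-submod : ∀ X Y → r (X ∪ Y) + r (X ∩ Y) ≤ r X + r Y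
open Matroid public

dualRank : ∀ {n} → (Subset n → ℕ) → Subset n → ℕ
dualRank r X = ∣ X ∣ + r (∁ X) ∸ r ⊤

img : ∀ {m n} → (Fin m → Fin n) → Subset m → Subset n
img f X = tabulate (λ j → does (any? (λ i → (i ∈? X) ×-dec (f i ≟ j))))

-- A matroid with rank function rN on Fin m is (isomorphic to) a minor of M:
-- there is a set C (contracted) and an injection f of Fin m into E(M) - C
-- (the complement of C ∪ f(Fin m) is deleted) such that f is an isomorphism
-- from N onto M / C \ D, i.e. rN(X) = r_M(f X ∪ C) - r_M(C).
IsMinorOf : ∀ {m} → (Subset m → ℕ) → Matroid → Set
IsMinorOf {m} rN M =
  Σ (Subset (n M)) λ C → Σ (Fin m → Fin (n M)) λ f →
    Injective _≡_ _≡_ f × (∀ i → f i ∉ C) ×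
    (∀ X → rN X + r M C ≡ r M (img f X ∪ C))

KSeparating : ℕ → (M : Matroid) → Subset (n M) → Set
KSeparating k M A = r M A + r M (∁ A) < r M ⊤ + k

KSeparation : ℕ → (M : Matroid) → Subset (n M) → Set
KSeparation k M A = KSeparating k M A × k ≤ ∣ A ∣ × k ≤ ∣ ∁ A ∣

ThreeConnected : Matroid → Set
ThreeConnected M = ∀ A → ¬ KSeparation 1 M A × ¬ KSeparation 2 M A

InternallyFourConnected : Matroid → Set
InternallyFourConnected M =
  ThreeConnected M × (∀ A → KSeparation 3 M A → ∣ A ∣ ⊓ ∣ ∁ A ∣ ≡ 3)

record Field (c ℓ : Level) : Set (Level.suc (c ⊔ ℓ)) where
  field
    commutativeRing : CommutativeRing c ℓ
  open CommutativeRing commutativeRing public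
  field
    0≉1     : ¬ (0# ≈ 1#)
    inverse : ∀ x → ¬ (x ≈ 0#) → ∃[ y ] (x * y ≈ 1#)

module _ {c ℓ} (F : Field c ℓ) where
  open Field F using (Carrier; _≈_; _*_; 0#; 1#) renaming (_+_ to _+F_)

  ∑ : ∀ {n} → (Fin n → Carrier) → Carrier
  ∑ {zero}  g = 0#
  ∑ {suc n} g = g zero +F ∑ (λ j → g (suc j))

  LinIndep : ∀ {d n} → (Fin d → Fin n → Carrier) → Subset n → Set (c ⊔ ℓ)
  LinIndep {d} {n} A Y =
    ∀ (coef : Fin n → Carrier) → (∀ j → j ∉ Y → coef j ≈ 0#) →
    (∀ i → ∑ (λ j → coef j * A i j) ≈ 0#) → ∀ j → coef j ≈ 0#

  Representable : Matroid → Set (c ⊔ ℓ)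
  Representable M =
    Σ ℕ λ d → Σ (Fin d → Fin (n M) → Carrier) λ A → ∀ X →
      (Σ (Subset (n M)) λ Y → Y ⊆ X × LinIndep A Y × ∣ Y ∣ ≡ r M X) ×
      (∀ Y → Y ⊆ X → LinIndep A Y → ∣ Y ∣ ≤ r M X)

  NotGF2 : Set (c ⊔ ℓ)
  NotGF2 = ∃[ x ] (¬ (x ≈ 0#) × ¬ (x ≈ 1#))

NearRegular : Matroid → Setω
NearRegular M = ∀ {c ℓ} (F : Field c ℓ) → NotGF2 F → Representable F M

record Graph : Set where
  field
    V    : ℕ
    E    : ℕ
    ends : Fin E → Fin V × Fin V
open Graph public

data Conn (G : Graph) (X : Subset (E G)) : Fin (V G) → Fin (V G) → Set where
  here : ∀ {u} → Conn G X u u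
  fwd  : ∀ {u i} → i ∈ X → Conn G X u (proj₁ (ends G i)) → Conn G X u (proj₂ (ends G i))
  bwd  : ∀ {u i} → i ∈ X → Conn G X u (proj₂ (ends G i)) → Conn G X u (proj₁ (ends G i))

-- the spanning subgraph (V, X) has exactly k components:
-- witnessed by a set R of k vertices containing exactly one vertex per component
NumComponents : (G : Graph) → Subset (E G) → ℕ → Set
NumComponents G X k =
  Σ (Subset (V G)) λ R →
    (∀ v → ∃[ u ] (u ∈ R × Conn G X v u)) ×
    (∀ u w → u ∈ R → w ∈ R → Conn G X u w → u ≡ w) ×
    ∣ R ∣ ≡ k

IsCycleMatroidRank : (G : Graph) → (Subset (E G) → ℕ) → Set
IsCycleMatroidRank G rN = ∀ X → Σ ℕ λ k → NumComponents G X k × rN X + k ≡ V G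

record _∧ω_ (A : Set) (B : Setω) : Setω where
  constructor _,_
  field
    fst : A
    snd : B

record ∃ω {A : Set} (P : A → Setω) : Setω where
  constructor _,_
  field
    witness : A
    proof   : P witness

{-# OPTIONS --safe #-}
-- Couple two graphs G₁, G₂ with four terminals each through the Laplacian L of a star whose
-- edges have weights α, 1 − α, −1. The matroid M on E(G₁) ∪ E(G₂) has row space
--   { (dφ, y) : φ a potential on G₁, y a flow on G₂ with divergence L φ },
-- and, L being symmetric, the orthogonal space is { (x, −dψ) : x has divergence L ψ }.
-- Deleting E(G₂) leaves M(G₁), contracting E(G₁) leaves M(G₂)*, and for A ⊆ E(G₁), B ⊆ E(G₂)
--   r(A ∪ B) = r(A) + r*(B) + τ,
-- where τ is the rank of L merged along the partitions of the terminals induced by A and by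
-- the complement of B. All minors of the merged matrices are 0 or ± αⁱ (1 − α)ʲ, so this does
-- not depend on the field: for every set X and element e ∉ X a row vector vanishing on X but
-- not at e, or a relation expressing e through X, exists over all admissible fields at once.
-- For complete graphs, any set of edges or its complement is connected and spanning, which
-- makes the connectivity of M easy to bound; every graphic matroid is a minor of one of these.
module Submission where

open import Defs
open import Data.Fin.Subset using (Subset)
open import Data.Nat using (ℕ)
open import Data.Product using (Σ; _×_)

import Level
open import Level using (Setω)
import Algebra.Properties.CommutativeMonoid.Sum
import Algebra.Properties.Ring
import Algebra.Properties.Semiring.Mult
import Algebra.Properties.Semiring.Sum
import Algebra.Solver.Ring
open import Algebra.Solver.Ring.AlmostCommutativeRing
  using (fromCommutativeRing; _-Raw-AlmostCommutative⟶_)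
open import Data.Bool
  using (Bool; true; false; not; _∧_; _∨_; _xor_; if_then_else_; T)
open import Data.Bool.ListAction using (all; any)
open import Data.Bool.Properties using (xor-comm; xor-same; not-involutive)
open import Data.Empty as Empty using (⊥-elim)
open import Data.Fin as Fin
  using (Fin; zero; suc; _≟_; _↑ˡ_; _↑ʳ_; splitAt; combine; remQuot; finToFun; funToFin)
open import Data.Fin.Properties as Fin
  using (any?; all?; ¬∀⟶∃¬; <-cmp; ↑ˡ-injective; ↑ʳ-injective; splitAt-↑ˡ; splitAt-↑ʳ;
         join-splitAt; remQuot-combine; finToFun-funToFin)
open import Data.Fin.Subset
  using (inside; outside; _∈_; _∉_; _⊆_; _∪_; _∩_; ∁; ⊤; ⊥; ∣_∣; ⁅_⁆)
open import Data.Fin.Subset.Properties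
  using (_∈?_; ∉⊥; ∈⊤; ⊥⊆; ⊆-antisym; ∣p∣≤n; ∣⊥∣≡0; ∣⊤∣≡n; ∣⁅x⁆∣≡1; x∈⁅x⁆; x∈⁅y⁆⇒x≡y;
         x∉p⇒x∈∁p; x∈∁p⇒x∉p; x∉∁p⇒x∈p; x∈p∪q⁻; x∈p∪q⁺; q⊆p∪q; p∩q⊆p; p∩q⊆q;
         ∪-identityˡ; ∪-identityʳ; drop-there)
open import Data.Integer as ℤ using (ℤ; -[1+_])
open import Data.Integer.Properties using ([1+m]⊖[1+n]≡m⊖n)
open import Data.List as List using (List; []; _∷_)
open import Data.Maybe using (Maybe; just; nothing)
open import Data.Nat as ℕ
  using (zero; suc; _+_; _∸_; _≤_; _<_; _⊓_; _^_; _≡ᵇ_; z≤n; s≤s)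
import Data.Nat.Properties as ℕ
open import Data.Nat.Solver using (module +-*-Solver)
open import Data.Product as Product using (∃; ∃-syntax; _,_; proj₁; proj₂)
open import Data.Product.Properties using (,-injective)
open import Data.Rational as ℚ using (1ℚ)
import Data.Rational.Properties as ℚ
open import Data.Sign as Sign using (Sign)
open import Data.Sum as Sum using (_⊎_; inj₁; inj₂)
open import Data.Unit using (tt)
open import Data.Vec as Vec
  using (Vec; []; _∷_; _++_; lookup; tabulate; replicate; take; drop; _[_]≔_; here; there)
open import Data.Vec.Properties
  using (lookup⇒[]=; []=⇒lookup; lookup∘tabulate; tabulate∘lookup; tabulate-cong; take++drop≡id;
         map-++; map-[]≔; zipWith-++; ++-injective; []≔-updates; []≔-minimal; []≔-lookup;
         []≔-++-↑ˡ; []≔-++-↑ʳ)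
open import Function using (_∘_; id; _⟨_⟩_)
open import Function.Bundles using (_⇔_; mk⇔)
open import Function.Definitions using (Injective)
open import Relation.Binary.Definitions using (tri<; tri≈; tri>)
import Relation.Binary.Reasoning.Setoid
open import Relation.Binary.PropositionalEquality as ≡ using (_≡_; _≢_)
open import Relation.Nullary using (¬_; Dec; yes; no; does)
open import Relation.Nullary.Decidable
  using (dec-true; dec-false; does-⇔; map′; _⊎-dec_; _×-dec_)

-- Subsets of Fin n

-- The parameter α cannot be avoided. By Seymour's decomposition theorem an internally 4-connected
-- regular matroid is graphic, cographic or isomorphic to R10, so no regular matroid serves when,
-- say, both graphs are K5. The number of terminals comes from connectivity. The two edge sets have
-- to be joined with connectivity at least 3, since otherwise they form a 3-separation with two
-- large sides. Their connectivity is the rank of L, and the Laplacian of a graph on t vertices has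
-- rank at most t - 1. A star is convenient because merging terminals produces nothing worse than
-- partial sums of its three weights. A further obstacle is that the fields carry no decidable
-- equality, so ranks and bases cannot be found by elimination. The rank is therefore defined
-- combinatorially, and a field only supplies witnesses whose distinguished entry is invertible. The
-- witnesses that involve L are polynomial identities over ℤ together with invertible values of the
-- form ± αⁱ (1 - α)ʲ, so one finite Boolean computation settles them for all fields.

private variable
  μ ν : ℕ

infixl 6 _⊞_ _⊟_

_⊞_ _⊟_ : Subset ν → Fin ν → Subset ν
X ⊞ e = X [ e ]≔ inside
X ⊟ e = X [ e ]≔ outside

-- Sets are built by adding one new element at a time, because components, ranks and certificates
-- are all controlled through the effect of a single element.
subset-ind : ∀ {ℓ} {ν} (P : Subset ν → Set ℓ) → P ⊥ →
  (∀ X e → e ∉ X → P X → P (X ⊞ e)) → ∀ X → P X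
subset-ind {ν = zero}  P base step [] = base
subset-ind {ν = suc ν} P base step (b ∷ X) = extend b
  where
  tail-case : P (outside ∷ X)
  tail-case = subset-ind (λ Y → P (outside ∷ Y)) base
    (λ Y e e∉Y → step (outside ∷ Y) (suc e) (e∉Y ∘ drop-there)) X

  extend : ∀ b → P (b ∷ X)
  extend outside = tail-case
  extend inside  = step (outside ∷ X) zero (λ ()) tail-case

∈-⊞ : ∀ (X : Subset ν) e → e ∈ X ⊞ e
∈-⊞ X e = []≔-updates X e

⊆-⊞ : ∀ (X : Subset ν) e → X ⊆ X ⊞ e
⊆-⊞ X e {x} x∈X with x ≟ e
... | yes ≡.refl = ∈-⊞ X e
... | no x≢e   = []≔-minimal X x e x≢e x∈X

∉-⊟ : ∀ (X : Subset ν) e → e ∉ X ⊟ e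
∉-⊟ (x ∷ X) zero    ()
∉-⊟ (x ∷ X) (suc e) (there p) = ∉-⊟ X e p

∈-⊞⁻ : ∀ (X : Subset ν) e {x} → x ∈ X ⊞ e → x ≡ e ⊎ x ∈ X
∈-⊞⁻ (b ∷ X) zero    here      = inj₁ ≡.refl
∈-⊞⁻ (b ∷ X) zero    (there p) = inj₂ (there p)
∈-⊞⁻ (b ∷ X) (suc e) here      = inj₂ here
∈-⊞⁻ (b ∷ X) (suc e) (there p) with ∈-⊞⁻ X e p
... | inj₁ ≡.refl = inj₁ ≡.refl
... | inj₂ q    = inj₂ (there q)

∈-⊟ : ∀ (X : Subset ν) e {x} → x ∈ X → x ≢ e → x ∈ X ⊟ e
∈-⊟ X e {x} x∈X x≢e = []≔-minimal X x e x≢e x∈X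

∈-⊟⁻ : ∀ (X : Subset ν) e {x} → x ∈ X ⊟ e → x ∈ X
∈-⊟⁻ (b ∷ X) zero    (there p) = there p
∈-⊟⁻ (b ∷ X) (suc e) here      = here
∈-⊟⁻ (b ∷ X) (suc e) (there p) = there (∈-⊟⁻ X e p)

⊟-⊞ : ∀ (X : Subset ν) e → e ∈ X → (X ⊟ e) ⊞ e ≡ X
⊟-⊞ (_ ∷ X) zero    here      = ≡.refl
⊟-⊞ (b ∷ X) (suc e) (there p) = ≡.cong (b ∷_) (⊟-⊞ X e p)

⊞-∈ : ∀ (X : Subset ν) e → e ∈ X → X ⊞ e ≡ X
⊞-∈ X e e∈X = ≡.trans (≡.cong (X [ e ]≔_) (≡.sym ([]=⇒lookup e∈X))) ([]≔-lookup X e)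

∣⊞∣ : ∀ (X : Subset ν) e → e ∉ X → ∣ X ⊞ e ∣ ≡ suc ∣ X ∣
∣⊞∣ (outside ∷ X) zero    e∉X = ≡.refl
∣⊞∣ (inside ∷ X)  zero    e∉X = ⊥-elim (e∉X here)
∣⊞∣ (outside ∷ X) (suc e) e∉X = ∣⊞∣ X e (e∉X ∘ there)
∣⊞∣ (inside ∷ X)  (suc e) e∉X = ≡.cong suc (∣⊞∣ X e (e∉X ∘ there))

∣⊟∣ : ∀ (X : Subset ν) e → e ∈ X → suc ∣ X ⊟ e ∣ ≡ ∣ X ∣
∣⊟∣ X e e∈X = ≡.trans (≡.sym (∣⊞∣ (X ⊟ e) e (∉-⊟ X e))) (≡.cong ∣_∣ (⊟-⊞ X e e∈X))

∪-⊞ : ∀ (X Y : Subset ν) e → X ∪ (Y ⊞ e) ≡ (X ∪ Y) ⊞ e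
∪-⊞ (outside ∷ X) (y ∷ Y) zero    = ≡.refl
∪-⊞ (inside ∷ X)  (y ∷ Y) zero    = ≡.refl
∪-⊞ (x ∷ X)       (y ∷ Y) (suc e) = ≡.cong (_ ∷_) (∪-⊞ X Y e)

⊞-∪ : ∀ (X Y : Subset ν) e → (X ⊞ e) ∪ Y ≡ (X ∪ Y) ⊞ e
⊞-∪ (x ∷ X) (y ∷ Y) zero    = ≡.refl
⊞-∪ (x ∷ X) (y ∷ Y) (suc e) = ≡.cong (_ ∷_) (⊞-∪ X Y e)

∁-⊞ : ∀ (X : Subset ν) e → ∁ (X ⊞ e) ≡ ∁ X ⊟ e
∁-⊞ X e = map-[]≔ not X e

∁-involutive : ∀ (X : Subset ν) → ∁ (∁ X) ≡ X
∁-involutive []            = ≡.refl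
∁-involutive (inside ∷ X)  = ≡.cong (inside ∷_) (∁-involutive X)
∁-involutive (outside ∷ X) = ≡.cong (outside ∷_) (∁-involutive X)

∁⊥≡⊤ : ∁ (⊥ {ν}) ≡ ⊤
∁⊥≡⊤ {zero}  = ≡.refl
∁⊥≡⊤ {suc ν} = ≡.cong (inside ∷_) ∁⊥≡⊤

∁⊤≡⊥ : ∁ (⊤ {ν}) ≡ ⊥
∁⊤≡⊥ {zero}  = ≡.refl
∁⊤≡⊥ {suc ν} = ≡.cong (outside ∷_) ∁⊤≡⊥

∣X∣+∣∁X∣ : ∀ (X : Subset ν) → ∣ X ∣ + ∣ ∁ X ∣ ≡ ν
∣X∣+∣∁X∣ []            = ≡.refl
∣X∣+∣∁X∣ (inside ∷ X)  = ≡.cong suc (∣X∣+∣∁X∣ X)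
∣X∣+∣∁X∣ (outside ∷ X) = ≡.trans (ℕ.+-suc _ _) (≡.cong suc (∣X∣+∣∁X∣ X))

∣++∣ : ∀ (A : Subset μ) (B : Subset ν) → ∣ A ++ B ∣ ≡ ∣ A ∣ + ∣ B ∣
∣++∣ []            B = ≡.refl
∣++∣ (inside ∷ A)  B = ≡.cong suc (∣++∣ A B)
∣++∣ (outside ∷ A) B = ∣++∣ A B

⊥++⊥ : ⊥ {μ} ++ ⊥ {ν} ≡ ⊥
⊥++⊥ {zero}  = ≡.refl
⊥++⊥ {suc μ} = ≡.cong (outside ∷_) (⊥++⊥ {μ})

⊤++⊤ : ⊤ {μ} ++ ⊤ {ν} ≡ ⊤
⊤++⊤ {zero}  = ≡.refl
⊤++⊤ {suc μ} = ≡.cong (inside ∷_) (⊤++⊤ {μ})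

∈-++ˡ : ∀ {A : Subset μ} (B : Subset ν) {i} → i ∈ A → i ↑ˡ ν ∈ A ++ B
∈-++ˡ B here      = here
∈-++ˡ B (there p) = there (∈-++ˡ B p)

∈-++ʳ : ∀ (A : Subset μ) {B : Subset ν} {i} → i ∈ B → μ ↑ʳ i ∈ A ++ B
∈-++ʳ []      p = p
∈-++ʳ (_ ∷ A) p = there (∈-++ʳ A p)

∈-++ˡ⁻ : ∀ (A : Subset μ) {B : Subset ν} {i} → i ↑ˡ ν ∈ A ++ B → i ∈ A
∈-++ˡ⁻ (_ ∷ A) {i = zero}  here      = here
∈-++ˡ⁻ (_ ∷ A) {i = suc i} (there p) = there (∈-++ˡ⁻ A p)

∈-++ʳ⁻ : ∀ (A : Subset μ) {B : Subset ν} {i} → μ ↑ʳ i ∈ A ++ B → i ∈ B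
∈-++ʳ⁻ []      p         = p
∈-++ʳ⁻ (_ ∷ A) (there p) = ∈-++ʳ⁻ A p

∣∣-injection : ∀ {μ ν} (f : Fin μ → Fin ν) (R : Subset μ) (S : Subset ν) →
  (∀ u → u ∈ R → f u ∈ S) → (∀ u w → u ∈ R → w ∈ R → f u ≡ f w → u ≡ w) →
  ∣ R ∣ ≤ ∣ S ∣
∣∣-injection {μ} {ν} f = subset-ind P base step
  where
  P : Subset μ → Set
  P R = ∀ S → (∀ u → u ∈ R → f u ∈ S) →
    (∀ u w → u ∈ R → w ∈ R → f u ≡ f w → u ≡ w) → ∣ R ∣ ≤ ∣ S ∣

  base : P ⊥
  base S _ _ = ≡.subst (_≤ ∣ S ∣) (≡.sym (∣⊥∣≡0 μ)) z≤n

  step : ∀ X e → e ∉ X → P X → P (X ⊞ e)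
  step X e e∉X ih S into inj = ≡.subst₂ _≤_ (≡.sym (∣⊞∣ X e e∉X)) (∣⊟∣ S (f e) fe∈S)
    (s≤s (ih (S ⊟ f e)
      (λ u u∈X → ∈-⊟ S (f e) (into u (⊆-⊞ X e u∈X))
        λ eq → e∉X (≡.subst (_∈ X) (inj u e (⊆-⊞ X e u∈X) (∈-⊞ X e) eq) u∈X))
      (λ u w u∈X w∈X → inj u w (⊆-⊞ X e u∈X) (⊆-⊞ X e w∈X))))
    where
    fe∈S : f e ∈ S
    fe∈S = into e (∈-⊞ X e)

nonempty : ∀ (X : Subset ν) → 1 ≤ ∣ X ∣ → ∃[ e ] e ∈ X
nonempty (inside ∷ X)  _ = zero , here
nonempty (outside ∷ X) h with nonempty X h
... | e , p = suc e , there p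

-- Components and ranks of graphs

∈-tabulate : ∀ {n} {p : Fin n → Bool} {i} → p i ≡ true → i ∈ tabulate p
∈-tabulate {p = p} {i} eq = lookup⇒[]= i (tabulate p) (≡.trans (lookup∘tabulate p i) eq)

∈-tabulate⁻ : ∀ {n} {p : Fin n → Bool} {i} → i ∈ tabulate p → p i ≡ true
∈-tabulate⁻ {p = p} {i} i∈ = ≡.trans (≡.sym (lookup∘tabulate p i)) ([]=⇒lookup i∈)

does-true⇒ : ∀ {p} {P : Set p} (P? : Dec P) → does P? ≡ true → P
does-true⇒ (yes p) _ = p

module Components (G : Graph) where
  tail head : Fin (E G) → Fin (V G)
  tail i = proj₁ (ends G i)
  head i = proj₂ (ends G i)

  conn-trans : ∀ {X u v w} → Conn G X u v → Conn G X v w → Conn G X u w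
  conn-trans p here      = p
  conn-trans p (fwd i q) = fwd i (conn-trans p q)
  conn-trans p (bwd i q) = bwd i (conn-trans p q)

  conn-edge : ∀ {X i} → i ∈ X → Conn G X (tail i) (head i)
  conn-edge i∈X = fwd i∈X here

  conn-sym : ∀ {X u v} → Conn G X u v → Conn G X v u
  conn-sym here      = here
  conn-sym (fwd i p) = conn-trans (bwd i here) (conn-sym p)
  conn-sym (bwd i p) = conn-trans (fwd i here) (conn-sym p)

  conn-mono : ∀ {X Y u v} → X ⊆ Y → Conn G X u v → Conn G Y u v
  conn-mono X⊆Y here      = here
  conn-mono X⊆Y (fwd i p) = fwd (X⊆Y i) (conn-mono X⊆Y p)
  conn-mono X⊆Y (bwd i p) = bwd (X⊆Y i) (conn-mono X⊆Y p)

  conn-const : ∀ {a} {A : Set a} {X u v} (f : Fin (V G) → A) →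
    (∀ i → i ∈ X → f (tail i) ≡ f (head i)) → Conn G X u v → f u ≡ f v
  conn-const f const here              = ≡.refl
  conn-const f const (fwd {i = i} x p) = ≡.trans (conn-const f const p) (const i x)
  conn-const f const (bwd {i = i} x p) = ≡.trans (conn-const f const p) (≡.sym (const i x))

  -- `Conn` is an inductive relation with no evident decision procedure. A choice of a
  -- representative in every component, maintained while edges are added, turns connectivity into
  -- equality of vertices.
  record Labelling (X : Subset (E G)) : Set where
    field
      rep      : Fin (V G) → Fin (V G)
      rep-conn : ∀ u → Conn G X u (rep u)
      rep-≡    : ∀ {u v} → Conn G X u v → rep u ≡ rep v

  -- A walk that uses `e` repeatedly contains a detour returning to an end of `e`. Dropping such
  -- detours leaves at most one crossing, in one of the two directions.
  conn-⊞⁻ : ∀ X e {u v} → Conn G (X ⊞ e) u v →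
    Conn G X u v ⊎ (Conn G X u (tail e) × Conn G X (head e) v) ⊎
                   (Conn G X u (head e) × Conn G X (tail e) v)
  conn-⊞⁻ X e here = inj₁ here
  conn-⊞⁻ X e (fwd i∈ p) with ∈-⊞⁻ X e i∈ | conn-⊞⁻ X e p
  ... | inj₂ i∈X  | inj₁ q              = inj₁ (fwd i∈X q)
  ... | inj₂ i∈X  | inj₂ (inj₁ (q , r)) = inj₂ (inj₁ (q , fwd i∈X r))
  ... | inj₂ i∈X  | inj₂ (inj₂ (q , r)) = inj₂ (inj₂ (q , fwd i∈X r))
  ... | inj₁ ≡.refl | inj₁ q              = inj₂ (inj₁ (q , here))
  ... | inj₁ ≡.refl | inj₂ (inj₁ (q , r)) = inj₂ (inj₁ (q , here))
  ... | inj₁ ≡.refl | inj₂ (inj₂ (q , r)) = inj₁ q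
  conn-⊞⁻ X e (bwd i∈ p) with ∈-⊞⁻ X e i∈ | conn-⊞⁻ X e p
  ... | inj₂ i∈X  | inj₁ q              = inj₁ (bwd i∈X q)
  ... | inj₂ i∈X  | inj₂ (inj₁ (q , r)) = inj₂ (inj₁ (q , bwd i∈X r))
  ... | inj₂ i∈X  | inj₂ (inj₂ (q , r)) = inj₂ (inj₂ (q , bwd i∈X r))
  ... | inj₁ ≡.refl | inj₁ q              = inj₂ (inj₂ (q , here))
  ... | inj₁ ≡.refl | inj₂ (inj₂ (q , r)) = inj₂ (inj₂ (q , here))
  ... | inj₁ ≡.refl | inj₂ (inj₁ (q , r)) = inj₁ q

  labelling : ∀ X → Labelling X
  labelling = subset-ind Labelling base step
    where
    base : Labelling ⊥
    base = record
      { rep      = λ u → u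
      ; rep-conn = λ u → here
      ; rep-≡    = conn-const (λ u → u) (λ i i∈⊥ → ⊥-elim (∉⊥ i∈⊥))
      }

    step : ∀ X e → e ∉ X → Labelling X → Labelling (X ⊞ e)
    step X e _ L = record { rep = rep′ ; rep-conn = rep′-conn ; rep-≡ = conn-const rep′ const }
      where
      open Labelling L
      a = tail e
      b = head e

      rep′ : Fin (V G) → Fin (V G)
      rep′ u = if does (rep u ≟ rep a) then rep b else rep u

      rep′-conn : ∀ u → Conn G (X ⊞ e) u (rep′ u)
      rep′-conn u with rep u ≟ rep a
      ... | no _   = conn-mono (⊆-⊞ X e) (rep-conn u)
      ... | yes eq = conn-trans
        (conn-mono (⊆-⊞ X e) (conn-trans (≡.subst (Conn G X u) eq (rep-conn u)) (conn-sym (rep-conn a))))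
        (conn-trans (conn-edge (∈-⊞ X e)) (conn-mono (⊆-⊞ X e) (rep-conn b)))

      ends-agree : rep′ a ≡ rep′ b
      ends-agree with rep a ≟ rep a | rep b ≟ rep a
      ... | no neq | _     = ⊥-elim (neq ≡.refl)
      ... | yes _  | yes _ = ≡.refl
      ... | yes _  | no _  = ≡.refl

      const : ∀ i → i ∈ X ⊞ e → rep′ (tail i) ≡ rep′ (head i)
      const i i∈ with ∈-⊞⁻ X e i∈
      ... | inj₁ ≡.refl = ends-agree
      ... | inj₂ i∈X  =
        ≡.cong (λ w → if does (w ≟ rep a) then rep b else w) (rep-≡ (conn-edge i∈X))

  conn? : ∀ X u v → Dec (Conn G X u v)
  conn? X u v = map′
    (λ eq → conn-trans (rep-conn u) (≡.subst (λ w → Conn G X w v) (≡.sym eq) (conn-sym (rep-conn v))))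
    rep-≡ (rep u ≟ rep v)
    where open Labelling (labelling X)

  components : ∀ X → ∃ (NumComponents G X)
  components X = ∣ R ∣ , R , (λ v → rep v , rep∈R v , rep-conn v) , separated , ≡.refl
    where
    open Labelling (labelling X)

    R : Subset (V G)
    R = tabulate (λ u → does (rep u ≟ u))

    rep∈R : ∀ v → rep v ∈ R
    rep∈R v = ∈-tabulate (dec-true (rep (rep v) ≟ rep v) (rep-≡ (conn-sym (rep-conn v))))

    separated : ∀ u w → u ∈ R → w ∈ R → Conn G X u w → u ≡ w
    separated u w u∈R w∈R p = ≡.trans (≡.sym (fixed u u∈R)) (≡.trans (rep-≡ p) (fixed w w∈R))
      where
      fixed : ∀ u → u ∈ R → rep u ≡ u
      fixed u u∈R = does-true⇒ (rep u ≟ u) (∈-tabulate⁻ u∈R)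

  -- Each representative for the coarser relation selects one for the finer relation, and two that
  -- select the same one are connected, hence equal. Used in both directions, this shows that the
  -- number of components does not depend on the representatives.
  numComponents-≤ : ∀ {X Y k l} → (∀ {u v} → Conn G Y u v → Conn G X u v) →
    NumComponents G X k → NumComponents G Y l → k ≤ l
  numComponents-≤ Y⇒X (R , cover , sep , ≡.refl) (S , cover′ , sep′ , ≡.refl) =
    ∣∣-injection (λ u → proj₁ (cover′ u)) R S (λ u _ → proj₁ (proj₂ (cover′ u)))
      λ u w u∈R w∈R eq → sep u w u∈R w∈R
        (conn-trans (Y⇒X (proj₂ (proj₂ (cover′ u))))
          (≡.subst (λ z → Conn G _ z w) (≡.sym eq) (conn-sym (Y⇒X (proj₂ (proj₂ (cover′ w)))))))

  rank : Subset (E G) → ℕ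
  rank X = V G ∸ proj₁ (components X)

  rank+components : ∀ {X k} → NumComponents G X k → rank X + k ≡ V G
  rank+components {X} {k} c = ≡.trans (≡.cong ((V G ∸ proj₁ (components X)) +_) (ℕ.≤-antisym
      (numComponents-≤ (λ p → p) c (proj₂ (components X)))
      (numComponents-≤ (λ p → p) (proj₂ (components X)) c)))
    (ℕ.m∸n+n≡m (≡.subst (_≤ V G) (proj₂ (proj₂ (proj₂ (proj₂ (components X))))) (∣p∣≤n (proj₁ (proj₂ (components X))))))

  isCycleMatroidRank : IsCycleMatroidRank G rank
  isCycleMatroidRank X = _ , proj₂ (components X) , rank+components (proj₂ (components X))

  rank-⊥ : rank ⊥ ≡ 0
  rank-⊥ = ℕ.+-cancelʳ-≡ (V G) _ _ (rank+components
    (⊤ , (λ v → v , ∈⊤ , here) ,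
     (λ u w _ _ → conn-const (λ u → u) (λ i i∈⊥ → ⊥-elim (∉⊥ i∈⊥))) , ∣⊤∣≡n (V G)))

  rank-≥ : ∀ {X Y} → (∀ {u v} → Conn G Y u v → Conn G X u v) → rank Y ≤ rank X
  rank-≥ {X} {Y} Y⇒X = ℕ.∸-monoʳ-≤ (V G)
    (numComponents-≤ Y⇒X (proj₂ (components X)) (proj₂ (components Y)))

  rank-⊞-conn : ∀ X e → Conn G X (tail e) (head e) → rank (X ⊞ e) ≡ rank X
  rank-⊞-conn X e p = ℕ.≤-antisym (rank-≥ shrink) (rank-≥ (conn-mono (⊆-⊞ X e)))
    where
    shrink : ∀ {u v} → Conn G (X ⊞ e) u v → Conn G X u v
    shrink q with conn-⊞⁻ X e q
    ... | inj₁ r              = r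
    ... | inj₂ (inj₁ (r , s)) = conn-trans r (conn-trans p s)
    ... | inj₂ (inj₂ (r , s)) = conn-trans r (conn-trans (conn-sym p) s)

  -- The representative of the tail's component is discarded, and that component falls to the
  -- representative of the head's.
  merge-components : ∀ X e {k} → ¬ Conn G X (tail e) (head e) → NumComponents G X k →
    ∃[ l ] (NumComponents G (X ⊞ e) l × suc l ≡ k)
  merge-components X e ¬p (R , cover , sep , ≡.refl) =
    ∣ R ⊟ a ∣ , (R ⊟ a , cover′ , sep′ , ≡.refl) , ∣⊟∣ R a a∈R
    where
    a b : Fin (V G)
    a = proj₁ (cover (tail e))
    b = proj₁ (cover (head e))

    a∈R : a ∈ R
    a∈R = proj₁ (proj₂ (cover (tail e)))

    tail~a : Conn G X (tail e) a
    tail~a = proj₂ (proj₂ (cover (tail e)))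

    head~b : Conn G X (head e) b
    head~b = proj₂ (proj₂ (cover (head e)))

    b≢a : b ≢ a
    b≢a b≡a = ¬p (conn-trans tail~a (≡.subst (λ z → Conn G X z (head e)) b≡a (conn-sym head~b)))

    cover′ : ∀ v → ∃[ u ] (u ∈ R ⊟ a × Conn G (X ⊞ e) v u)
    cover′ v with cover v
    ... | u , u∈R , v~u with u ≟ a
    ...   | no u≢a   = u , ∈-⊟ R a u∈R u≢a , conn-mono (⊆-⊞ X e) v~u
    ...   | yes ≡.refl = b , ∈-⊟ R a (proj₁ (proj₂ (cover (head e)))) b≢a ,
      conn-trans (conn-mono (⊆-⊞ X e) (conn-trans v~u (conn-sym tail~a)))
        (conn-trans (conn-edge (∈-⊞ X e)) (conn-mono (⊆-⊞ X e) head~b))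

    a-unique : ∀ {u} → u ∈ R ⊟ a → ¬ Conn G X u (tail e)
    a-unique {u} u∈ q = ∉-⊟ R a
      (≡.subst (_∈ R ⊟ a) (sep u a (∈-⊟⁻ R a u∈) a∈R (conn-trans q tail~a)) u∈)

    sep′ : ∀ u w → u ∈ R ⊟ a → w ∈ R ⊟ a → Conn G (X ⊞ e) u w → u ≡ w
    sep′ u w u∈ w∈ p with conn-⊞⁻ X e p
    ... | inj₁ q              = sep u w (∈-⊟⁻ R a u∈) (∈-⊟⁻ R a w∈) q
    ... | inj₂ (inj₁ (q , _)) = ⊥-elim (a-unique u∈ q)
    ... | inj₂ (inj₂ (_ , q)) = ⊥-elim (a-unique w∈ (conn-sym q))

  rank-⊞-¬conn : ∀ X e → ¬ Conn G X (tail e) (head e) → rank (X ⊞ e) ≡ suc (rank X)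
  rank-⊞-¬conn X e ¬p with merge-components X e ¬p (proj₂ (components X))
  ... | l , comps , eq = ℕ.+-cancelʳ-≡ l _ _ (≡.trans (rank+components comps)
    (≡.sym (≡.trans (≡.sym (ℕ.+-suc (rank X) l))
      (≡.trans (≡.cong (rank X +_) eq) (rank+components (proj₂ (components X)))))))

-- Linear algebra over a field

module FieldTheory {c ℓ} (F : Field c ℓ) where
  open Field F renaming (_+_ to _⊕_; _*_ to _⊗_; -_ to ⊖_) hiding (_-_; zero) public
  open Algebra.Properties.Semiring.Mult semiring using (×-homo-+; ×1-homo-*) renaming (_×_ to _×ₙ_)
  open Algebra.Properties.Ring ring using (-‿involutive; -‿distribˡ-*; -‿distribʳ-*; -0#≈0#; -‿+-comm)
  module ≈-Reasoning = Relation.Binary.Reasoning.Setoid setoid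
  open ≈-Reasoning

  -- Integer coefficients for the ring solver

  ⟦_⟧ℤ : ℤ → Carrier
  ⟦ ℤ.+ n ⟧ℤ      = n ×ₙ 1#
  ⟦ -[1+ n ] ⟧ℤ = ⊖ (suc n ×ₙ 1#)

  cancel-1 : ∀ x y → x ⊕ ⊖ y ≈ (1# ⊕ x) ⊕ ⊖ (1# ⊕ y)
  cancel-1 x y = sym (begin
    (1# ⊕ x) ⊕ ⊖ (1# ⊕ y)     ≈⟨ +-cong (+-comm 1# x) (sym (-‿+-comm 1# y)) ⟩
    (x ⊕ 1#) ⊕ (⊖ 1# ⊕ ⊖ y)   ≈⟨ +-assoc _ _ _ ⟩
    x ⊕ (1# ⊕ (⊖ 1# ⊕ ⊖ y))   ≈⟨ +-congˡ (sym (+-assoc _ _ _)) ⟩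
    x ⊕ ((1# ⊕ ⊖ 1#) ⊕ ⊖ y)   ≈⟨ +-congˡ (+-congʳ (-‿inverseʳ 1#)) ⟩
    x ⊕ (0# ⊕ ⊖ y)            ≈⟨ +-congˡ (+-identityˡ _) ⟩
    x ⊕ ⊖ y                   ∎)

  ⟦⊖⟧ : ∀ m n → ⟦ m ℤ.⊖ n ⟧ℤ ≈ m ×ₙ 1# ⊕ ⊖ (n ×ₙ 1#)
  ⟦⊖⟧ zero    zero    = sym (-‿inverseʳ 0#)
  ⟦⊖⟧ zero    (suc n) = sym (+-identityˡ _)
  ⟦⊖⟧ (suc m) zero    = sym (trans (+-congˡ -0#≈0#) (+-identityʳ _))
  ⟦⊖⟧ (suc m) (suc n) = trans (reflexive (≡.cong ⟦_⟧ℤ ([1+m]⊖[1+n]≡m⊖n m n)))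
    (trans (⟦⊖⟧ m n) (cancel-1 _ _))

  ⟦+⟧ : ∀ i j → ⟦ i ℤ.+ j ⟧ℤ ≈ ⟦ i ⟧ℤ ⊕ ⟦ j ⟧ℤ
  ⟦+⟧ (ℤ.+ m)      (ℤ.+ n)      = ×-homo-+ 1# m n
  ⟦+⟧ (ℤ.+ m)      -[1+ n ]   = ⟦⊖⟧ m (suc n)
  ⟦+⟧ -[1+ m ]   (ℤ.+ n)      = trans (⟦⊖⟧ n (suc m)) (+-comm _ _)
  ⟦+⟧ -[1+ m ]   -[1+ n ]   = begin
    ⊖ (suc (suc (m ℕ.+ n)) ×ₙ 1#)
      ≈⟨ -‿cong (trans (sym (+-assoc 1# 1# _)) (trans (+-congˡ (×-homo-+ 1# m n)) shuffle)) ⟩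
    ⊖ (suc m ×ₙ 1# ⊕ suc n ×ₙ 1#)
      ≈⟨ sym (-‿+-comm _ _) ⟩
    ⊖ (suc m ×ₙ 1#) ⊕ ⊖ (suc n ×ₙ 1#) ∎
    where
    shuffle : (1# ⊕ 1#) ⊕ (m ×ₙ 1# ⊕ n ×ₙ 1#) ≈ (1# ⊕ m ×ₙ 1#) ⊕ (1# ⊕ n ×ₙ 1#)
    shuffle = begin
      (1# ⊕ 1#) ⊕ (m ×ₙ 1# ⊕ n ×ₙ 1#) ≈⟨ +-assoc _ _ _ ⟩
      1# ⊕ (1# ⊕ (m ×ₙ 1# ⊕ n ×ₙ 1#)) ≈⟨ +-congˡ (sym (+-assoc _ _ _)) ⟩
      1# ⊕ ((1# ⊕ m ×ₙ 1#) ⊕ n ×ₙ 1#) ≈⟨ +-congˡ (+-congʳ (+-comm _ _)) ⟩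
      1# ⊕ ((m ×ₙ 1# ⊕ 1#) ⊕ n ×ₙ 1#) ≈⟨ +-congˡ (+-assoc _ _ _) ⟩
      1# ⊕ (m ×ₙ 1# ⊕ (1# ⊕ n ×ₙ 1#)) ≈⟨ sym (+-assoc _ _ _) ⟩
      (1# ⊕ m ×ₙ 1#) ⊕ (1# ⊕ n ×ₙ 1#) ∎

  ⟦-⟧ : ∀ i → ⟦ ℤ.- i ⟧ℤ ≈ ⊖ ⟦ i ⟧ℤ
  ⟦-⟧ (ℤ.+ zero)  = sym -0#≈0#
  ⟦-⟧ (ℤ.+ suc n) = refl
  ⟦-⟧ -[1+ n ]  = sym (-‿involutive _)

  ⟦+◃⟧ : ∀ n → ⟦ Sign.+ ℤ.◃ n ⟧ℤ ≈ n ×ₙ 1#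
  ⟦+◃⟧ zero    = refl
  ⟦+◃⟧ (suc n) = refl

  ⟦-◃⟧ : ∀ n → ⟦ Sign.- ℤ.◃ n ⟧ℤ ≈ ⊖ (n ×ₙ 1#)
  ⟦-◃⟧ zero    = sym -0#≈0#
  ⟦-◃⟧ (suc n) = refl

  ⟦*⟧ : ∀ i j → ⟦ i ℤ.* j ⟧ℤ ≈ ⟦ i ⟧ℤ ⊗ ⟦ j ⟧ℤ
  ⟦*⟧ (ℤ.+ m)    (ℤ.+ n)    = trans (⟦+◃⟧ (m ℕ.* n)) (×1-homo-* m n)
  ⟦*⟧ (ℤ.+ m)    -[1+ n ] = trans (⟦-◃⟧ (m ℕ.* suc n))
    (trans (-‿cong (×1-homo-* m (suc n))) (-‿distribʳ-* _ _))
  ⟦*⟧ -[1+ m ] (ℤ.+ n)    = trans (⟦-◃⟧ (suc m ℕ.* n))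
    (trans (-‿cong (×1-homo-* (suc m) n)) (-‿distribˡ-* _ _))
  ⟦*⟧ -[1+ m ] -[1+ n ] = begin
    ⟦ Sign.+ ℤ.◃ (suc m ℕ.* suc n) ⟧ℤ        ≈⟨ ×1-homo-* (suc m) (suc n) ⟩
    (suc m ×ₙ 1#) ⊗ (suc n ×ₙ 1#)            ≈⟨ sym (-‿involutive _) ⟩
    ⊖ (⊖ ((suc m ×ₙ 1#) ⊗ (suc n ×ₙ 1#)))    ≈⟨ -‿cong (-‿distribˡ-* _ _) ⟩
    ⊖ ((⊖ (suc m ×ₙ 1#)) ⊗ (suc n ×ₙ 1#))    ≈⟨ -‿distribʳ-* _ _ ⟩
    (⊖ (suc m ×ₙ 1#)) ⊗ (⊖ (suc n ×ₙ 1#))    ∎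

  -- Coefficients are compared in ℤ, so the ring solver applies although equality in the field is
  -- not decidable.
  coefficientRing : ℤ.+-*-rawRing -Raw-AlmostCommutative⟶ fromCommutativeRing commutativeRing
  coefficientRing = record
    { ⟦_⟧ = ⟦_⟧ℤ ; +-homo = ⟦+⟧ ; *-homo = ⟦*⟧ ; -‿homo = ⟦-⟧
    -- The numeral one evaluates to `1# ⊕ 0#` and not to `1#` itself.
    ; 0-homo = refl ; 1-homo = +-identityʳ 1# }

  private
    same-coefficient : ∀ i j → Maybe (⟦ i ⟧ℤ ≈ ⟦ j ⟧ℤ)
    same-coefficient i j with i ℤ.≟ j
    ... | yes ≡.refl = just refl
    ... | no _       = nothing

  open Algebra.Solver.Ring ℤ.+-*-rawRing (fromCommutativeRing commutativeRing)
    coefficientRing same-coefficient public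
    using (solve; _:=_; _:+_; _:*_; :-_; con)

  -- Finite sums and units

  private
    module MonoidSum = Algebra.Properties.CommutativeMonoid.Sum +-commutativeMonoid
    module SemiringSum = Algebra.Properties.Semiring.Sum semiring

    ∑≡sum : ∀ {n} (g : Fin n → Carrier) → ∑ F g ≡ MonoidSum.sum g
    ∑≡sum {zero}  g = ≡.refl
    ∑≡sum {suc n} g = ≡.cong (g zero ⊕_) (∑≡sum (λ j → g (suc j)))

    ∑≈sum : ∀ {n} (g : Fin n → Carrier) → ∑ F g ≈ MonoidSum.sum g
    ∑≈sum g = reflexive (∑≡sum g)

  ∑-cong : ∀ {n} {f g : Fin n → Carrier} → (∀ i → f i ≈ g i) → ∑ F f ≈ ∑ F g
  ∑-cong {f = f} {g} eq = trans (∑≈sum f) (trans (MonoidSum.sum-cong-≋ eq) (sym (∑≈sum g)))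

  ∑-0 : ∀ {n} {f : Fin n → Carrier} → (∀ i → f i ≈ 0#) → ∑ F f ≈ 0#
  ∑-0 {n} {f} eq = trans (∑-cong eq) (trans (∑≈sum {n} _) (MonoidSum.sum-replicate-zero n))

  ∑-⊕ : ∀ {n} (f g : Fin n → Carrier) → ∑ F (λ i → f i ⊕ g i) ≈ ∑ F f ⊕ ∑ F g
  ∑-⊕ {n} f g = trans (∑≈sum {n} _)
    (trans (MonoidSum.∑-distrib-+ f g) (sym (+-cong (∑≈sum f) (∑≈sum g))))

  ∑-⊗ˡ : ∀ {n} x (g : Fin n → Carrier) → ∑ F (λ i → x ⊗ g i) ≈ x ⊗ ∑ F g
  ∑-⊗ˡ {n} x g = trans (∑≈sum {n} _)
    (trans (sym (SemiringSum.*-distribˡ-sum x g)) (*-congˡ (sym (∑≈sum g))))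

  ∑-comm : ∀ {m n} (f : Fin m → Fin n → Carrier) →
    ∑ F (λ i → ∑ F (λ j → f i j)) ≈ ∑ F (λ j → ∑ F (λ i → f i j))
  ∑-comm f = trans (trans (∑-cong λ i → ∑≈sum (f i)) (∑≈sum (λ i → MonoidSum.sum (f i))))
    (trans (MonoidSum.∑-comm f) (sym (trans (∑-cong λ j → ∑≈sum (λ i → f i j))
      (∑≈sum (λ j → MonoidSum.sum (λ i → f i j))))))

  ∑-single : ∀ {n} i {f : Fin n → Carrier} → (∀ j → j ≢ i → f j ≈ 0#) → ∑ F f ≈ f i
  ∑-single zero    zeros = trans (+-congˡ (∑-0 λ j → zeros (suc j) λ ())) (+-identityʳ _)
  ∑-single (suc i) zeros = trans (+-cong (zeros zero λ ())
    (∑-single i λ j j≢i → zeros (suc j) (j≢i ∘ Fin.suc-injective))) (+-identityˡ _)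

  ∑-+ : ∀ m {n} (f : Fin (m ℕ.+ n) → Carrier) →
    ∑ F f ≈ ∑ F (λ i → f (i ↑ˡ n)) ⊕ ∑ F (λ j → f (m ↑ʳ j))
  ∑-+ zero    f = sym (+-identityˡ _)
  ∑-+ (suc m) f = trans (+-congˡ (∑-+ m (λ i → f (suc i)))) (sym (+-assoc _ _ _))

  -- The constructive form of being nonzero: invertibility passes to products and allows
  -- cancellation without deciding equality.
  Unit : Carrier → Set _
  Unit x = ∃[ y ] (x ⊗ y ≈ 1#)

  unit-cong : ∀ {x y} → x ≈ y → Unit x → Unit y
  unit-cong x≈y (z , eq) = z , trans (*-congʳ (sym x≈y)) eq

  unit-⊗ : ∀ {x y} → Unit x → Unit y → Unit (x ⊗ y)
  unit-⊗ {x} {y} (x′ , p) (y′ , q) = x′ ⊗ y′ , trans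
    (solve 4 (λ x y x′ y′ → (x :* y) :* (x′ :* y′) := (x :* x′) :* (y :* y′)) refl x y x′ y′)
    (trans (*-cong p q) (*-identityˡ 1#))

  unit-⊖ : ∀ {x} → Unit x → Unit (⊖ x)
  unit-⊖ {x} (y , p) = ⊖ y , trans
    (solve 2 (λ x y → (:- x) :* (:- y) := x :* y) refl x y) p

  unit-1 : Unit 1#
  unit-1 = 1# , *-identityˡ 1#

  unit-cancel : ∀ {x y} → Unit x → y ⊗ x ≈ 0# → y ≈ 0#
  unit-cancel {x} {y} (z , p) q = begin
    y             ≈⟨ sym (*-identityʳ y) ⟩
    y ⊗ 1#        ≈⟨ *-congˡ (sym p) ⟩
    y ⊗ (x ⊗ z)   ≈⟨ sym (*-assoc y x z) ⟩
    (y ⊗ x) ⊗ z   ≈⟨ *-congʳ q ⟩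
    0# ⊗ z        ≈⟨ zeroˡ z ⟩
    0#            ∎

  unit≉0 : ∀ {x} → Unit x → ¬ (x ≈ 0#)
  unit≉0 (y , p) x≈0 = 0≉1 (trans (sym (zeroˡ y)) (trans (*-congʳ (sym x≈0)) p))

-- Flows and potentials

module Flows {c ℓ} (F : Field c ℓ) (G : Graph) where
  open FieldTheory F
  open ≈-Reasoning
  open Components G

  Potential : Set c
  Potential = Fin (V G) → Carrier

  d : Potential → Fin (E G) → Carrier
  d φ i = φ (head i) ⊕ ⊖ φ (tail i)

  ⟨_,d_⟩ : (Fin (E G) → Carrier) → Potential → Carrier
  ⟨ y ,d φ ⟩ = ∑ F (λ i → y i ⊗ d φ i)

  -- A flow on X is determined up to circulations by its divergence; the
  -- divergence is recorded dually, as the functional φ ↦ ⟨ y ,d φ ⟩.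
  record Flow (X : Subset (E G)) (div : Potential → Carrier) : Set (c Level.⊔ ℓ) where
    field
      flow     : Fin (E G) → Carrier
      support  : ∀ i → i ∉ X → flow i ≈ 0#
      diverges : ∀ φ → ⟨ flow ,d φ ⟩ ≈ div φ
  open Flow public

  private variable
    X Y   : Subset (E G)
    D D′  : Potential → Carrier

  flow-resp : (∀ φ → D φ ≈ D′ φ) → Flow X D → Flow X D′
  flow-resp eq f = record
    { flow = flow f ; support = support f ; diverges = λ φ → trans (diverges f φ) (eq φ) }

  flow-mono : X ⊆ Y → Flow X D → Flow Y D
  flow-mono X⊆Y f = record
    { flow = flow f ; support = λ i i∉Y → support f i (i∉Y ∘ X⊆Y) ; diverges = diverges f }

  flow-0 : Flow X (λ _ → 0#)
  flow-0 = record
    { flow = λ _ → 0# ; support = λ _ _ → refl ; diverges = λ φ → ∑-0 {E G} λ i → zeroˡ (d φ i) }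

  flow-⊕ : Flow X D → Flow X D′ → Flow X (λ φ → D φ ⊕ D′ φ)
  flow-⊕ f g = record
    { flow     = λ i → flow f i ⊕ flow g i
    ; support  = λ i i∉X → trans (+-cong (support f i i∉X) (support g i i∉X)) (+-identityˡ 0#)
    ; diverges = λ φ → trans (∑-cong {E G} λ i → distribʳ (d φ i) (flow f i) (flow g i))
        (trans (∑-⊕ {E G} (λ i → flow f i ⊗ d φ i) (λ i → flow g i ⊗ d φ i)) (+-cong (diverges f φ) (diverges g φ)))
    }

  flow-⊗ : ∀ k → Flow X D → Flow X (λ φ → k ⊗ D φ)
  flow-⊗ k f = record
    { flow     = λ i → k ⊗ flow f i
    ; support  = λ i i∉X → trans (*-congˡ (support f i i∉X)) (zeroʳ k)
    ; diverges = λ φ → trans (∑-cong {E G} λ i → *-assoc k (flow f i) (d φ i))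
        (trans (∑-⊗ˡ {E G} k (λ i → flow f i ⊗ d φ i)) (*-congˡ (diverges f φ)))
    }

  flow-∑ : ∀ {n} {D : Fin n → Potential → Carrier} →
    (∀ k → Flow X (D k)) → Flow X (λ φ → ∑ F (λ k → D k φ))
  flow-∑ {n = zero}  f = flow-0
  flow-∑ {n = suc n} f = flow-⊕ (f zero) (flow-∑ (λ k → f (suc k)))

  flow-edge : ∀ {i} → i ∈ X → Flow X (λ φ → d φ i)
  flow-edge {i = i} i∈X = record
    { flow     = λ j → if does (j ≟ i) then 1# else 0#
    ; support  = support-edge
    ; diverges = λ φ → trans (∑-single i (off φ)) (on φ)
    }
    where
    support-edge : ∀ j → j ∉ _ → (if does (j ≟ i) then 1# else 0#) ≈ 0#
    support-edge j j∉X with j ≟ i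
    ... | yes ≡.refl = ⊥-elim (j∉X i∈X)
    ... | no _       = refl

    off : ∀ φ j → j ≢ i → (if does (j ≟ i) then 1# else 0#) ⊗ d φ j ≈ 0#
    off φ j j≢i with j ≟ i
    ... | yes j≡i = ⊥-elim (j≢i j≡i)
    ... | no _    = zeroˡ _

    on : ∀ φ → (if does (i ≟ i) then 1# else 0#) ⊗ d φ i ≈ d φ i
    on φ with i ≟ i
    ... | yes _  = *-identityˡ _
    ... | no i≢i = ⊥-elim (i≢i ≡.refl)

  flow-edge-self : ∀ {i} (i∈X : i ∈ X) → flow (flow-edge i∈X) i ≈ 1#
  flow-edge-self {i = i} i∈X with i ≟ i
  ... | yes _  = refl
  ... | no i≢i = ⊥-elim (i≢i ≡.refl)

  -- A walk carries one unit from `u` to `v`; a step against the direction of an edge enters with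
  -- coefficient -1.
  flow-path : ∀ {u v} → Conn G X u v → Flow X (λ φ → φ v ⊕ ⊖ φ u)
  flow-path {u = u} here = flow-resp (λ φ → sym (-‿inverseʳ (φ u))) flow-0
  flow-path {u = u} (fwd {i = i} i∈X p) = flow-resp
    (λ φ → solve 3 (λ h t u → (t :+ :- u) :+ (h :+ :- t) := h :+ :- u) refl
      (φ (head i)) (φ (tail i)) (φ u))
    (flow-⊕ (flow-path p) (flow-edge i∈X))
  flow-path {u = u} (bwd {i = i} i∈X p) = flow-resp
    (λ φ → solve 3 (λ h t u → (h :+ :- u) :+ con (ℤ.- (ℤ.+ 1)) :* (h :+ :- t) := t :+ :- u) refl
      (φ (head i)) (φ (tail i)) (φ u))
    (flow-⊕ (flow-path p) (flow-⊗ ⟦ ℤ.- (ℤ.+ 1) ⟧ℤ (flow-edge i∈X)))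

-- The coupling of two partitions of the terminals

-- Polynomials in α with integer coefficients, constant term first.
Poly : Set
Poly = List ℤ

infixl 6 _+ₚ_
infixl 7 _*ₚ_ _·ₚ_

_+ₚ_ : Poly → Poly → Poly
[]      +ₚ q       = q
(a ∷ p) +ₚ []      = a ∷ p
(a ∷ p) +ₚ (b ∷ q) = a ℤ.+ b ∷ p +ₚ q

_·ₚ_ : ℤ → Poly → Poly
a ·ₚ p = List.map (a ℤ.*_) p

_*ₚ_ : Poly → Poly → Poly
[]      *ₚ q = []
(a ∷ p) *ₚ q = a ·ₚ q +ₚ (ℤ.+ 0 ∷ p *ₚ q)

zero? : ℤ → Bool
zero? (ℤ.+ zero) = true
zero? _        = false

-- Coefficient lists are not normalised, so the zero polynomial is any list of zeros.
isZero : Poly → Bool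
isZero = all zero?

-ₚ_ : Poly → Poly
-ₚ p = (-[1+ 0 ]) ·ₚ p

0ₚ 1ₚ αₚ βₚ -1ₚ : Poly
0ₚ  = []
1ₚ  = ℤ.+ 1 ∷ []
αₚ  = ℤ.+ 0 ∷ ℤ.+ 1 ∷ []
βₚ  = ℤ.+ 1 ∷ -[1+ 0 ] ∷ []
-1ₚ = -[1+ 0 ] ∷ []

-- The weights sum to 0, and every other nonempty partial sum is a unit: a sum of two of them
-- is minus the third. This is where an element α ∉ {0, 1} enters.
weight : Fin 3 → Poly
weight zero             = αₚ
weight (suc zero)       = βₚ
weight (suc (suc zero)) = -1ₚ

-- The weighted Laplacian of the star with centre 0 on the four terminals.
laplacian : Fin 4 → Fin 4 → Poly
laplacian zero    zero    = 0ₚ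
laplacian zero    (suc j) = -ₚ weight j
laplacian (suc i) zero    = -ₚ weight i
laplacian (suc i) (suc j) = if does (i ≟ j) then weight i else 0ₚ

∑ₚ : ∀ {n} → (Fin n → Poly) → Poly
∑ₚ {zero}  g = 0ₚ
∑ₚ {suc n} g = g zero +ₚ ∑ₚ (λ j → g (suc j))

-- A partition of the terminals, sending each terminal to the least one in its block.
Labels : Set
Labels = Vec (Fin 4) 4

-- Entry `b` of QᵀLPu, where P and Q are the 0-1 block matrices of `p` and `q`: the potential is
-- constant on the blocks of `p`, and the resulting charges are collected over the blocks of `q`.
blockSum : Labels → Labels → Vec Poly 4 → Fin 4 → Poly
blockSum p q u b = ∑ₚ λ i → if does (lookup q i ≟ b)
  then ∑ₚ (λ j → laplacian i j *ₚ lookup u (lookup p j)) else 0ₚ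

-- Listed up to sign, which `isUnit` ignores. Monomials in α and 1 - α of degree at most two suffice
-- for every certificate that `table` asks for.
units : List Poly
units = 1ₚ ∷ αₚ ∷ βₚ ∷ αₚ *ₚ βₚ ∷ αₚ *ₚ αₚ ∷ βₚ *ₚ βₚ ∷ []

isUnit : Poly → Bool
isUnit x = any (λ y → isZero (x +ₚ y) ∨ isZero (x +ₚ -ₚ y)) units

allFin : ∀ {n} → (Fin n → Bool) → Bool
allFin {zero}  f = true
allFin {suc n} f = f zero ∧ allFin (λ i → f (suc i))

separates : Labels → Labels → Fin 4 → Fin 4 → Vec Poly 4 → Bool
separates p q s t u = isUnit (lookup u (lookup p s) +ₚ -ₚ lookup u (lookup p t)) ∧
  allFin (λ b → isZero (blockSum p q u b))

-- The scalar κ does not have to be guessed: it is read off from what the candidate `v` produces at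
-- the block of `s`. Any unit is acceptable, since relations can be rescaled.
spanned : Labels → Labels → Fin 4 → Vec Poly 4 → Poly
spanned p q s v = blockSum q p v (lookup p s)

demand : Labels → Fin 4 → Fin 4 → Poly → Fin 4 → Poly
demand p s t κ b =
  if does (b ≟ lookup p s) then κ else if does (b ≟ lookup p t) then -ₚ κ else 0ₚ

spans : Labels → Labels → Fin 4 → Fin 4 → Vec Poly 4 → Bool
spans p q s t v = isUnit (spanned p q s v) ∧
  allFin λ b → isZero (blockSum q p v b +ₚ -ₚ demand p s t (spanned p q s v) b)

alphabet : List Poly
alphabet = 0ₚ ∷ 1ₚ ∷ αₚ ∷ βₚ ∷ -1ₚ ∷ -ₚ αₚ ∷ -ₚ βₚ ∷ []

-- Adding a constant to a potential changes neither its differences nor its image under the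
-- Laplacian, so the value at the centre is normalised to 0. That `alphabet` is large enough is
-- confirmed by `table`.
search : (Vec Poly 4 → Bool) → Bool
search f = any (λ x → any (λ y → any (λ z → f (0ₚ ∷ x ∷ y ∷ z ∷ [])) alphabet) alphabet) alphabet

-- If `f` is nowhere true, the value is the last index; the applications below are to predicates
-- that hold somewhere.
first : ∀ {n} → (Fin (suc n) → Bool) → Fin (suc n)
first {zero}  f = zero
first {suc n} f = if f zero then zero else suc (first (λ i → f (suc i)))

merge : Labels → Fin 4 → Fin 4 → Labels
merge p s t = tabulate λ i → first λ j →
  does (lookup p j ≟ lookup p i) ∨
  (does (lookup p j ≟ lookup p s) ∧ does (lookup p t ≟ lookup p i)) ∨
  (does (lookup p j ≟ lookup p t) ∧ does (lookup p s ≟ lookup p i))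

canonical : Labels → Bool
canonical p = allFin λ i → does (lookup p i ≟ first λ j → does (lookup p j ≟ lookup p i))

count : ∀ {n} → (Fin n → Bool) → ℕ
count {zero}  f = 0
count {suc n} f = (if f zero then 1 else 0) + count (λ i → f (suc i))

anyFin : ∀ {n} → (Fin n → Bool) → Bool
anyFin f = not (allFin (λ i → not (f i)))

free : Labels → Labels → Fin 4 → Bool
free p q i = not (does (lookup p i ≟ lookup p zero)) ∧ not (does (lookup q i ≟ lookup q zero))

blocks : Labels → Labels → ℕ
blocks p q = count λ b → anyFin λ i → does (lookup p i ≟ b) ∧ free p q i

opaque
  -- The rank of the Laplacian after merging its columns along p and its rows along q. The
  -- exceptional value 0 is the 1 × 1 matrix with entry α + (1 − α) − 1.
  τ : Labels → Labels → ℕ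
  τ p q = if (count (free p q) ≡ᵇ 3) ∧ (blocks p q ≡ᵇ 1) ∧ (blocks q p ≡ᵇ 1) then 0
          else blocks p q ⊓ blocks q p

-- Merging the blocks of s and t in p preserves the rank iff some potential separates s from t,
-- and lowers it by one iff the functional φ ↦ φ s − φ t lies in the row space.
decided : Labels → Labels → Fin 4 → Fin 4 → Bool
decided p q s t =
  if τ (merge p s t) q ≡ᵇ τ p q then search (separates p q s t)
  else (suc (τ (merge p s t) q) ≡ᵇ τ p q) ∧ search (spans p q s t)

_⇒ᵇ_ : Bool → Bool → Bool
true  ⇒ᵇ b = b
false ⇒ᵇ b = true

allVec : ∀ {m n} → (Vec (Fin n) m → Bool) → Bool
allVec {zero}  f = f []
allVec {suc m} f = allFin λ x → allVec λ xs → f (x ∷ xs)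

tableEntry : Labels → Labels → Fin 4 → Fin 4 → Bool
tableEntry p q s t = not (does (lookup p s ≟ lookup p t)) ⇒ᵇ decided p q s t

tableRow : Labels → Labels → Bool
tableRow p q = canonical q ⇒ᵇ ((τ p q ≡ᵇ τ q p) ∧ allFin λ s → allFin λ t → tableEntry p q s t)

tableRows : Labels → Bool
tableRows p = canonical p ⇒ᵇ allVec (tableRow p)

opaque
  unfolding τ

  -- A finite check over 15 canonical labellings on either side, 16 pairs of terminals and at most
  -- 7³ candidate vectors for each. Testing `canonical` first discards all other label vectors
  -- cheaply.
  table : allVec tableRows ≡ true
  table = ≡.refl

oneBlock : Labels
oneBlock = Vec.replicate 4 zero

discrete : Labels
discrete = tabulate λ i → i

opaque
  unfolding τ

  table-oneBlockʳ : allVec (λ p → τ p oneBlock ≡ᵇ 0) ≡ true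
  table-oneBlockʳ = ≡.refl

  table-oneBlockˡ : allVec (λ p → τ oneBlock p ≡ᵇ 0) ≡ true
  table-oneBlockˡ = ≡.refl

  τ-discrete : τ discrete discrete ≡ 3
  τ-discrete = ≡.refl

-- From Boolean checks to statements

∧-trueˡ : ∀ a b → a ∧ b ≡ true → a ≡ true
∧-trueˡ true b eq = ≡.refl

∧-trueʳ : ∀ a b → a ∧ b ≡ true → b ≡ true
∧-trueʳ true b eq = eq

∨-true : ∀ {a b} → a ∨ b ≡ true → a ≡ true ⊎ b ≡ true
∨-true {true}  eq = inj₁ ≡.refl
∨-true {false} eq = inj₂ eq

any-true : ∀ {a} {A : Set a} (f : A → Bool) xs → any f xs ≡ true → ∃[ x ] f x ≡ true
any-true f (x ∷ xs) eq = Sum.[ (x ,_) , any-true f xs ]′ (∨-true {f x} eq)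

allFin-true : ∀ {n} {f : Fin n → Bool} → allFin f ≡ true → ∀ i → f i ≡ true
allFin-true {f = f} eq zero    = ∧-trueˡ (f zero) _ eq
allFin-true {f = f} eq (suc i) = allFin-true {f = λ i → f (suc i)} (∧-trueʳ (f zero) _ eq) i

allVec-true : ∀ {m n} {f : Vec (Fin n) m → Bool} → allVec f ≡ true → ∀ xs → f xs ≡ true
allVec-true eq []       = eq
allVec-true eq (x ∷ xs) = allVec-true (allFin-true eq x) xs

search-true : ∀ f → search f ≡ true → ∃[ u ] f u ≡ true
search-true f found = u , any-true₃
  where
  at₁ : Poly → Bool
  at₁ x = any (λ y → any (λ z → f (0ₚ ∷ x ∷ y ∷ z ∷ [])) alphabet) alphabet
  x = any-true at₁ alphabet found
  at₂ : Poly → Bool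
  at₂ y = any (λ z → f (0ₚ ∷ proj₁ x ∷ y ∷ z ∷ [])) alphabet
  y = any-true at₂ alphabet (proj₂ x)
  at₃ : Poly → Bool
  at₃ z = f (0ₚ ∷ proj₁ x ∷ proj₁ y ∷ z ∷ [])
  z = any-true at₃ alphabet (proj₂ y)
  u : Vec Poly 4
  u = 0ₚ ∷ proj₁ x ∷ proj₁ y ∷ proj₁ z ∷ []
  any-true₃ : f u ≡ true
  any-true₃ = proj₂ z

≡ᵇ-true : ∀ {m n} → (m ℕ.≡ᵇ n) ≡ true → m ≡ n
≡ᵇ-true {m} {n} eq = ℕ.≡ᵇ⇒≡ m n (≡.subst T (≡.sym eq) tt)

if-true : ∀ b x y → (if b then x else y) ≡ true → (b ≡ true × x ≡ true) ⊎ y ≡ true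
if-true true  x y eq = inj₁ (≡.refl , eq)
if-true false x y eq = inj₂ eq

decided-cases : ∀ p q s t → decided p q s t ≡ true →
  (τ (merge p s t) q ≡ τ p q × search (separates p q s t) ≡ true) ⊎
  (suc (τ (merge p s t) q) ≡ τ p q × search (spans p q s t) ≡ true)
decided-cases p q s t eq = Sum.map
  (λ { (same , found) → ≡ᵇ-true same , found })
  (λ rest → ≡ᵇ-true (∧-trueˡ drops (search (spans p q s t)) rest) ,
            ∧-trueʳ drops (search (spans p q s t)) rest)
  (if-true (τ (merge p s t) q ℕ.≡ᵇ τ p q) (search (separates p q s t))
    (drops ∧ search (spans p q s t)) eq)
  where
  drops : Bool
  drops = suc (τ (merge p s t) q) ℕ.≡ᵇ τ p q

⇒ᵇ-true : ∀ a {b} → (a ⇒ᵇ b) ≡ true → a ≡ true → b ≡ true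
⇒ᵇ-true true eq _ = eq

tableRow-true : ∀ p q → canonical p ≡ true → canonical q ≡ true →
  ((τ p q ℕ.≡ᵇ τ q p) ∧ allFin λ s → allFin λ t → tableEntry p q s t) ≡ true
tableRow-true p q cp cq = ⇒ᵇ-true (canonical q)
  (allVec-true {f = tableRow p} (⇒ᵇ-true (canonical p) (allVec-true {f = tableRows} table p) cp) q) cq

τ-sym : ∀ p q → canonical p ≡ true → canonical q ≡ true → τ p q ≡ τ q p
τ-sym p q cp cq = ≡ᵇ-true (∧-trueˡ (τ p q ℕ.≡ᵇ τ q p) _ (tableRow-true p q cp cq))

table-decided : ∀ p q s t → canonical p ≡ true → canonical q ≡ true →
  lookup p s ≢ lookup p t → decided p q s t ≡ true
table-decided p q s t cp cq ps≢pt = ⇒ᵇ-true (not (does (lookup p s ≟ lookup p t)))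
  (allFin-true {f = tableEntry p q s} (allFin-true {f = λ s → allFin (tableEntry p q s)}
    (∧-trueʳ (τ p q ℕ.≡ᵇ τ q p) _ (tableRow-true p q cp cq)) s) t)
  (≡.cong not (dec-false (lookup p s ≟ lookup p t) ps≢pt))

laplacian-sym : ∀ i j → laplacian i j ≡ laplacian j i
laplacian-sym zero    zero    = ≡.refl
laplacian-sym zero    (suc j) = ≡.refl
laplacian-sym (suc i) zero    = ≡.refl
laplacian-sym (suc i) (suc j) with i ≟ j | j ≟ i
... | yes ≡.refl | yes _   = ≡.refl
... | yes ≡.refl | no j≢j  = ⊥-elim (j≢j ≡.refl)
... | no i≢i  | yes ≡.refl = ⊥-elim (i≢i ≡.refl)
... | no _    | no _       = ≡.refl

-- Evaluation of the table in a field

module Evaluation {c ℓ} (F : Field c ℓ) (notGF2 : NotGF2 F) where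
  open FieldTheory F
  open ≈-Reasoning

  α : Carrier
  α = proj₁ notGF2

  ⟦_⟧ : Poly → Carrier
  ⟦ [] ⟧    = 0#
  ⟦ a ∷ p ⟧ = ⟦ a ⟧ℤ ⊕ α ⊗ ⟦ p ⟧

  ⟦+ₚ⟧ : ∀ p q → ⟦ p +ₚ q ⟧ ≈ ⟦ p ⟧ ⊕ ⟦ q ⟧
  ⟦+ₚ⟧ []      q       = sym (+-identityˡ _)
  ⟦+ₚ⟧ (a ∷ p) []      = sym (+-identityʳ _)
  ⟦+ₚ⟧ (a ∷ p) (b ∷ q) = trans (+-cong (⟦+⟧ a b) (*-congˡ (⟦+ₚ⟧ p q)))
    (solve 5 (λ a b x p q → (a :+ b) :+ x :* (p :+ q) := (a :+ x :* p) :+ (b :+ x :* q))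
      refl ⟦ a ⟧ℤ ⟦ b ⟧ℤ α ⟦ p ⟧ ⟦ q ⟧)

  ⟦·ₚ⟧ : ∀ a p → ⟦ a ·ₚ p ⟧ ≈ ⟦ a ⟧ℤ ⊗ ⟦ p ⟧
  ⟦·ₚ⟧ a []      = sym (zeroʳ _)
  ⟦·ₚ⟧ a (b ∷ p) = trans (+-cong (⟦*⟧ a b) (*-congˡ (⟦·ₚ⟧ a p)))
    (solve 4 (λ a b x p → a :* b :+ x :* (a :* p) := a :* (b :+ x :* p)) refl ⟦ a ⟧ℤ ⟦ b ⟧ℤ α ⟦ p ⟧)

  ⟦*ₚ⟧ : ∀ p q → ⟦ p *ₚ q ⟧ ≈ ⟦ p ⟧ ⊗ ⟦ q ⟧
  ⟦*ₚ⟧ []      q = sym (zeroˡ _)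
  ⟦*ₚ⟧ (a ∷ p) q = begin
    ⟦ a ·ₚ q +ₚ (ℤ.+ 0 ∷ p *ₚ q) ⟧           ≈⟨ ⟦+ₚ⟧ (a ·ₚ q) _ ⟩
    ⟦ a ·ₚ q ⟧ ⊕ (0# ⊕ α ⊗ ⟦ p *ₚ q ⟧)     ≈⟨ +-cong (⟦·ₚ⟧ a q) (+-congˡ (*-congˡ (⟦*ₚ⟧ p q))) ⟩
    ⟦ a ⟧ℤ ⊗ ⟦ q ⟧ ⊕ (0# ⊕ α ⊗ (⟦ p ⟧ ⊗ ⟦ q ⟧))
      ≈⟨ solve 4 (λ a x p q → a :* q :+ (con (ℤ.+ 0) :+ x :* (p :* q)) := (a :+ x :* p) :* q)
           refl ⟦ a ⟧ℤ α ⟦ p ⟧ ⟦ q ⟧ ⟩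
    (⟦ a ⟧ℤ ⊕ α ⊗ ⟦ p ⟧) ⊗ ⟦ q ⟧           ∎

  ⟦-ₚ⟧ : ∀ p → ⟦ -ₚ p ⟧ ≈ ⊖ ⟦ p ⟧
  ⟦-ₚ⟧ p = trans (⟦·ₚ⟧ -[1+ 0 ] p)
    (solve 1 (λ p → con -[1+ 0 ] :* p := :- p) refl ⟦ p ⟧)

  ⟦-⟧ₚ : ∀ p q → ⟦ p +ₚ -ₚ q ⟧ ≈ ⟦ p ⟧ ⊕ ⊖ ⟦ q ⟧
  ⟦-⟧ₚ p q = trans (⟦+ₚ⟧ p (-ₚ q)) (+-congˡ (⟦-ₚ⟧ q))

  ⟦∑ₚ⟧ : ∀ {n} (g : Fin n → Poly) → ⟦ ∑ₚ g ⟧ ≈ ∑ F (λ i → ⟦ g i ⟧)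
  ⟦∑ₚ⟧ {zero}  g = refl
  ⟦∑ₚ⟧ {suc n} g = trans (⟦+ₚ⟧ (g zero) _) (+-congˡ (⟦∑ₚ⟧ (λ j → g (suc j))))

  isZero-sound : ∀ p → isZero p ≡ true → ⟦ p ⟧ ≈ 0#
  isZero-sound []             _  = refl
  isZero-sound (ℤ.+ zero ∷ p)   eq = begin
    0# ⊕ α ⊗ ⟦ p ⟧   ≈⟨ +-congˡ (*-congˡ (isZero-sound p eq)) ⟩
    0# ⊕ α ⊗ 0#      ≈⟨ trans (+-identityˡ _) (zeroʳ α) ⟩
    0#               ∎
  isZero-sound (ℤ.+ suc _ ∷ p)  ()
  isZero-sound (-[1+ _ ] ∷ p) ()

  difference-zero : ∀ p q → isZero (p +ₚ -ₚ q) ≡ true → ⟦ p ⟧ ≈ ⟦ q ⟧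
  difference-zero p q eq = begin
    ⟦ p ⟧                        ≈⟨ solve 2 (λ p q → p := (p :+ :- q) :+ q) refl ⟦ p ⟧ ⟦ q ⟧ ⟩
    (⟦ p ⟧ ⊕ ⊖ ⟦ q ⟧) ⊕ ⟦ q ⟧    ≈⟨ +-congʳ (trans (sym (⟦-⟧ₚ p q)) (isZero-sound (p +ₚ -ₚ q) eq)) ⟩
    0# ⊕ ⟦ q ⟧                   ≈⟨ +-identityˡ _ ⟩
    ⟦ q ⟧                        ∎

  unit-α : Unit ⟦ αₚ ⟧
  unit-α = unit-cong (solve 1 (λ x → x := con (ℤ.+ 0) :+ x :* (con (ℤ.+ 1) :+ x :* con (ℤ.+ 0))) refl α)
    (inverse α (proj₁ (proj₂ notGF2)))

  unit-β : Unit ⟦ βₚ ⟧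
  unit-β = inverse ⟦ βₚ ⟧ λ β≈0 → proj₂ (proj₂ notGF2) (begin
    α                      ≈⟨ solve 1 (λ x → x := con (ℤ.+ 1) :+
                                :- (con (ℤ.+ 1) :+ x :* (con -[1+ 0 ] :+ x :* con (ℤ.+ 0)))) refl α ⟩
    ⟦ ℤ.+ 1 ⟧ℤ ⊕ ⊖ ⟦ βₚ ⟧    ≈⟨ +-cong (+-identityʳ 1#) (-‿cong β≈0) ⟩
    1# ⊕ ⊖ 0#              ≈⟨ solve 1 (λ x → x :+ :- con (ℤ.+ 0) := x) refl 1# ⟩
    1#                     ∎)

  data AllUnits : List Poly → Set (c Level.⊔ ℓ) where
    []  : AllUnits []
    _∷_ : ∀ {x xs} → Unit ⟦ x ⟧ → AllUnits xs → AllUnits (x ∷ xs)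

  units-sound : AllUnits units
  units-sound = unit-cong (solve 1 (λ x → con (ℤ.+ 1) := con (ℤ.+ 1) :+ x :* con (ℤ.+ 0)) refl α)
      (unit-cong (sym (+-identityʳ 1#)) unit-1)
    ∷ unit-α ∷ unit-β
    ∷ product αₚ βₚ unit-α unit-β ∷ product αₚ αₚ unit-α unit-α ∷ product βₚ βₚ unit-β unit-β ∷ []
    where
    product : ∀ x y → Unit ⟦ x ⟧ → Unit ⟦ y ⟧ → Unit ⟦ x *ₚ y ⟧
    product x y ux uy = unit-cong (sym (⟦*ₚ⟧ x y)) (unit-⊗ ux uy)

  isUnit-sound : ∀ x → isUnit x ≡ true → Unit ⟦ x ⟧
  isUnit-sound x = go units-sound
    where
    go : ∀ {ys} → AllUnits ys →
      any (λ y → isZero (x +ₚ y) ∨ isZero (x +ₚ -ₚ y)) ys ≡ true → Unit ⟦ x ⟧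
    go (_∷_ {y} uy us) eq with ∨-true {isZero (x +ₚ y) ∨ isZero (x +ₚ -ₚ y)} eq
    ... | inj₂ rest = go us rest
    ... | inj₁ eqy with ∨-true {isZero (x +ₚ y)} eqy
    ...   | inj₂ minus = unit-cong (sym (difference-zero x y minus)) uy
    ...   | inj₁ plus  = unit-cong (begin
      ⊖ ⟦ y ⟧                       ≈⟨ solve 2 (λ x y → :- y := x :+ :- (x :+ y)) refl ⟦ x ⟧ ⟦ y ⟧ ⟩
      ⟦ x ⟧ ⊕ ⊖ (⟦ x ⟧ ⊕ ⟦ y ⟧)
        ≈⟨ +-congˡ (-‿cong (trans (sym (⟦+ₚ⟧ x y)) (isZero-sound (x +ₚ y) plus))) ⟩
      ⟦ x ⟧ ⊕ ⊖ 0#                  ≈⟨ solve 1 (λ x → x :+ :- con (ℤ.+ 0) := x) refl ⟦ x ⟧ ⟩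
      ⟦ x ⟧                         ∎) (unit-⊖ uy)

  L : Fin 4 → Fin 4 → Carrier
  L i j = ⟦ laplacian i j ⟧

  L-sym : ∀ i j → L i j ≈ L j i
  L-sym i j = reflexive (≡.cong ⟦_⟧ (laplacian-sym i j))

  L-apply : (Fin 4 → Carrier) → Fin 4 → Carrier
  L-apply φ i = ∑ F (λ j → L i j ⊗ φ j)

  when : Bool → Carrier → Carrier
  when b x = if b then x else 0#

  blockTotal : Labels → (Fin 4 → Carrier) → Fin 4 → Carrier
  blockTotal q g b = ∑ F (λ i → when (does (lookup q i ≟ b)) (g i))

  ⟦blockSum⟧ : ∀ p q u b →
    ⟦ blockSum p q u b ⟧ ≈ blockTotal q (L-apply λ j → ⟦ lookup u (lookup p j) ⟧) b
  ⟦blockSum⟧ p q u b = trans (⟦∑ₚ⟧ summand) (∑-cong term)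
    where
    summand : Fin 4 → Poly
    summand i = if does (lookup q i ≟ b)
      then ∑ₚ (λ j → laplacian i j *ₚ lookup u (lookup p j)) else 0ₚ

    term : ∀ i → ⟦ summand i ⟧ ≈
      when (does (lookup q i ≟ b)) (L-apply (λ j → ⟦ lookup u (lookup p j) ⟧) i)
    term i with does (lookup q i ≟ b)
    ... | false = refl
    ... | true  = trans (⟦∑ₚ⟧ (λ j → laplacian i j *ₚ lookup u (lookup p j)))
      (∑-cong λ j → ⟦*ₚ⟧ (laplacian i j) (lookup u (lookup p j)))

  record Separation (p q : Labels) (s t : Fin 4) : Set (c Level.⊔ ℓ) where
    field
      u        : Fin 4 → Carrier
      unit     : Unit (u (lookup p s) ⊕ ⊖ u (lookup p t))
      balanced : ∀ b → blockTotal q (L-apply λ j → u (lookup p j)) b ≈ 0#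

  record Spanning (p q : Labels) (s t : Fin 4) : Set (c Level.⊔ ℓ) where
    field
      v      : Fin 4 → Carrier
      κ      : Carrier
      unit   : Unit κ
      totals : ∀ b → blockTotal p (L-apply λ j → v (lookup q j)) b ≈
        (if does (b ≟ lookup p s) then κ else if does (b ≟ lookup p t) then ⊖ κ else 0#)

  -- Evaluation at α respects sums and products, and `isUnit` accepts only products of invertible
  -- elements up to sign. A vector of polynomials found by the search therefore serves in every
  -- admissible field.
  separation : ∀ p q s t → search (separates p q s t) ≡ true → Separation p q s t
  separation p q s t found = record
    { u        = λ i → ⟦ lookup u i ⟧
    ; unit     = unit-cong (⟦-⟧ₚ (lookup u (lookup p s)) (lookup u (lookup p t)))
        (isUnit-sound gap (∧-trueˡ (isUnit gap) _ u-separates))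
    ; balanced = λ b → trans (sym (⟦blockSum⟧ p q u b)) (isZero-sound (blockSum p q u b)
        (allFin-true {f = λ b → isZero (blockSum p q u b)} (∧-trueʳ (isUnit gap) _ u-separates) b))
    }
    where
    u : Vec Poly 4
    u = proj₁ (search-true (separates p q s t) found)

    u-separates : separates p q s t u ≡ true
    u-separates = proj₂ (search-true (separates p q s t) found)

    gap : Poly
    gap = lookup u (lookup p s) +ₚ -ₚ lookup u (lookup p t)

  ⟦demand⟧ : ∀ p s t κ b → ⟦ demand p s t κ b ⟧ ≈
    (if does (b ≟ lookup p s) then ⟦ κ ⟧ else if does (b ≟ lookup p t) then ⊖ ⟦ κ ⟧ else 0#)
  ⟦demand⟧ p s t κ b with does (b ≟ lookup p s) | does (b ≟ lookup p t)
  ... | true  | _     = refl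
  ... | false | true  = ⟦-ₚ⟧ κ
  ... | false | false = refl

  spanning : ∀ p q s t → search (spans p q s t) ≡ true → Spanning p q s t
  spanning p q s t found = from-search (search-true (spans p q s t) found)
    where
    from-search : ∃[ v ] spans p q s t v ≡ true → Spanning p q s t
    from-search (v , v-spans) = record
      { v      = λ i → ⟦ lookup v i ⟧
      ; κ      = ⟦ κ ⟧
      ; unit   = isUnit-sound κ (∧-trueˡ (isUnit κ) (allFin meets-demand) v-spans)
      ; totals = λ b → trans (sym (⟦blockSum⟧ q p v b))
          (trans (difference-zero (blockSum q p v b) (demand p s t κ b)
            (allFin-true {f = meets-demand}
              (∧-trueʳ (isUnit κ) (allFin meets-demand) v-spans) b))
          (⟦demand⟧ p s t κ b))
      }
      where
      κ : Poly
      κ = spanned p q s v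

      meets-demand : Fin 4 → Bool
      meets-demand b = isZero (blockSum q p v b +ₚ -ₚ demand p s t κ b)

-- Sums over the blocks of a partition

module BlockSums {c ℓ} (F : Field c ℓ) where
  open FieldTheory F
  open ≈-Reasoning

  ∑-indicator : ∀ {n} (a : Fin n) (f : Fin n → Carrier) x →
    ∑ F (λ i → f i ⊗ (if does (i ≟ a) then x else 0#)) ≈ f a ⊗ x
  ∑-indicator a f x = trans (∑-single a {g} off) on
    where
    g : Fin _ → Carrier
    g i = f i ⊗ (if does (i ≟ a) then x else 0#)

    off : ∀ i → i ≢ a → g i ≈ 0#
    off i i≢a with i ≟ a
    ... | yes i≡a = ⊥-elim (i≢a i≡a)
    ... | no _    = zeroʳ _

    on : g a ≈ f a ⊗ x
    on with a ≟ a
    ... | yes _  = refl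
    ... | no a≢a = ⊥-elim (a≢a ≡.refl)

  ∑-dipole : ∀ {n} (a b : Fin n) → a ≢ b → (f : Fin n → Carrier) → ∀ κ →
    ∑ F (λ i → f i ⊗ (if does (i ≟ a) then κ else if does (i ≟ b) then ⊖ κ else 0#)) ≈
    κ ⊗ (f a ⊕ ⊖ f b)
  ∑-dipole {n} a b a≢b f κ = begin
    ∑ F (λ i → f i ⊗ (if does (i ≟ a) then κ else if does (i ≟ b) then ⊖ κ else 0#))
      ≈⟨ ∑-cong {n} split ⟩
    ∑ F (λ i → at a κ i ⊕ at b (⊖ κ) i)
      ≈⟨ ∑-⊕ {n} (at a κ) (at b (⊖ κ)) ⟩
    ∑ F (at a κ) ⊕ ∑ F (at b (⊖ κ))
      ≈⟨ +-cong (∑-indicator a f κ) (∑-indicator b f (⊖ κ)) ⟩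
    f a ⊗ κ ⊕ f b ⊗ (⊖ κ)
      ≈⟨ solve 3 (λ x y k → x :* k :+ y :* (:- k) := k :* (x :+ :- y)) refl (f a) (f b) κ ⟩
    κ ⊗ (f a ⊕ ⊖ f b) ∎
    where
    at : Fin n → Carrier → Fin n → Carrier
    at a x i = f i ⊗ (if does (i ≟ a) then x else 0#)

    split : ∀ i → f i ⊗ (if does (i ≟ a) then κ else if does (i ≟ b) then ⊖ κ else 0#) ≈
      at a κ i ⊕ at b (⊖ κ) i
    split i with i ≟ a | i ≟ b
    ... | yes ≡.refl | yes ≡.refl = ⊥-elim (a≢b ≡.refl)
    ... | yes _      | no _       = sym (trans (+-congˡ (zeroʳ _)) (+-identityʳ _))
    ... | no _       | yes _      = sym (trans (+-congʳ (zeroʳ _)) (+-identityˡ _))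
    ... | no _       | no _       = sym (trans (+-congʳ (zeroʳ _)) (+-identityˡ _))

  ∑-blocks : ∀ {m n} (q : Fin n → Fin m) (f : Fin m → Carrier) (g : Fin n → Carrier) →
    ∑ F (λ i → f (q i) ⊗ g i) ≈
    ∑ F (λ b → f b ⊗ ∑ F (λ i → if does (q i ≟ b) then g i else 0#))
  ∑-blocks {m} {n} q f g = sym (begin
    ∑ F (λ b → f b ⊗ ∑ F (λ i → cell b i))     ≈⟨ ∑-cong {m} (λ b → sym (∑-⊗ˡ {n} (f b) (cell b))) ⟩
    ∑ F (λ b → ∑ F (λ i → f b ⊗ cell b i))     ≈⟨ ∑-comm {m} {n} (λ b i → f b ⊗ cell b i) ⟩
    ∑ F (λ i → ∑ F (λ b → f b ⊗ cell b i))     ≈⟨ ∑-cong {n} column ⟩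
    ∑ F (λ i → f (q i) ⊗ g i)                  ∎)
    where
    cell : Fin m → Fin n → Carrier
    cell b i = if does (q i ≟ b) then g i else 0#

    flip-test : ∀ b i → does (q i ≟ b) ≡ does (b ≟ q i)
    flip-test b i = does-⇔ (mk⇔ ≡.sym ≡.sym) (q i ≟ b) (b ≟ q i)

    column : ∀ i → ∑ F (λ b → f b ⊗ cell b i) ≈ f (q i) ⊗ g i
    column i = trans
      (∑-cong {m} λ b → *-congˡ (reflexive
        (≡.cong (λ test → if test then g i else 0#) (flip-test b i))))
      (∑-indicator (q i) f (g i))

  module _ {G : Graph} {X : Subset (E G)} where
    open Flows F G

    -- Moving every charge to the representative of its block leaves the block sums.
    flow-gather : ∀ {n} (t : Fin n → Fin (V G)) (q : Fin n → Fin n) →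
      (∀ i → Conn G X (t (q i)) (t i)) → (g : Fin n → Carrier) →
      Flow X (λ φ → ∑ F (λ i → φ (t i) ⊗ g i) ⊕
        ⊖ ∑ F (λ b → φ (t b) ⊗ ∑ F (λ i → if does (q i ≟ b) then g i else 0#)))
    flow-gather {n} t q reach g = flow-resp regroup
      (flow-∑ (λ i → flow-⊗ (g i) (flow-path (reach i))))
      where
      minus : Carrier
      minus = ⟦ ℤ.- (ℤ.+ 1) ⟧ℤ

      regroup : ∀ φ → ∑ F (λ i → g i ⊗ (φ (t i) ⊕ ⊖ φ (t (q i)))) ≈
        ∑ F (λ i → φ (t i) ⊗ g i) ⊕
        ⊖ ∑ F (λ b → φ (t b) ⊗ ∑ F (λ i → if does (q i ≟ b) then g i else 0#))
      regroup φ = begin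
        ∑ F (λ i → g i ⊗ (φ (t i) ⊕ ⊖ φ (t (q i))))
          ≈⟨ ∑-cong {n} (λ i → solve 3 (λ g a b → g :* (a :+ :- b) :=
               a :* g :+ con (ℤ.- (ℤ.+ 1)) :* (b :* g)) refl (g i) (φ (t i)) (φ (t (q i)))) ⟩
        ∑ F (λ i → φ (t i) ⊗ g i ⊕ minus ⊗ (φ (t (q i)) ⊗ g i))
          ≈⟨ ∑-⊕ {n} (λ i → φ (t i) ⊗ g i) (λ i → minus ⊗ (φ (t (q i)) ⊗ g i)) ⟩
        ∑ F (λ i → φ (t i) ⊗ g i) ⊕ ∑ F (λ i → minus ⊗ (φ (t (q i)) ⊗ g i))
          ≈⟨ +-congˡ (∑-⊗ˡ {n} minus (λ i → φ (t (q i)) ⊗ g i)) ⟩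
        ∑ F (λ i → φ (t i) ⊗ g i) ⊕ minus ⊗ ∑ F (λ i → φ (t (q i)) ⊗ g i)
          ≈⟨ +-congˡ (solve 1 (λ x → con (ℤ.- (ℤ.+ 1)) :* x := :- x) refl _) ⟩
        ∑ F (λ i → φ (t i) ⊗ g i) ⊕ ⊖ ∑ F (λ i → φ (t (q i)) ⊗ g i)
          ≈⟨ +-congˡ (-‿cong (∑-blocks q (λ b → φ (t b)) g)) ⟩
        ∑ F (λ i → φ (t i) ⊗ g i) ⊕
          ⊖ ∑ F (λ b → φ (t b) ⊗ ∑ F (λ i → if does (q i ≟ b) then g i else 0#)) ∎

-- Partitions of the terminals induced by edge sets

first-true : ∀ {n} (f : Fin (suc n) → Bool) i → f i ≡ true → f (first f) ≡ true
first-true {zero}  f zero    eq = eq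
first-true {suc n} f i       eq with f zero in f0
first-true {suc n} f i       eq | true  = f0
first-true {suc n} f zero    eq | false = ⊥-elim (false≢true (≡.trans (≡.sym f0) eq))
  where
  false≢true : false ≢ true
  false≢true ()
first-true {suc n} f (suc i) eq | false = first-true (λ i → f (suc i)) i eq

first-cong : ∀ {n} {f g : Fin (suc n) → Bool} → (∀ i → f i ≡ g i) → first f ≡ first g
first-cong {zero}          eq = ≡.refl
first-cong {suc n} {f} {g} eq rewrite eq zero =
  ≡.cong (λ k → if g zero then zero else suc k) (first-cong (λ i → eq (suc i)))

allFin-intro : ∀ {n} (f : Fin n → Bool) → (∀ i → f i ≡ true) → allFin f ≡ true
allFin-intro {zero}  f eq = ≡.refl
allFin-intro {suc n} f eq rewrite eq zero = allFin-intro (λ i → f (suc i)) (λ i → eq (suc i))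

module Terminals (G : Graph) (t : Fin 4 → Fin (V G)) where
  open Components G

  joined : Subset (E G) → Fin 4 → Fin 4 → Bool
  joined X i j = does (conn? X (t j) (t i))

  label : Subset (E G) → Fin 4 → Fin 4
  label X i = first (joined X i)

  labels : Subset (E G) → Labels
  labels X = tabulate (label X)

  lookup-labels : ∀ X i → lookup (labels X) i ≡ label X i
  lookup-labels X = lookup∘tabulate (label X)

  label-conn : ∀ X i → Conn G X (t (label X i)) (t i)
  label-conn X i = does-true⇒ (conn? X (t (label X i)) (t i))
    (first-true (joined X i) i (dec-true (conn? X (t i) (t i)) here))

  label-≡ : ∀ X {i j} → Conn G X (t i) (t j) → label X i ≡ label X j
  label-≡ X {i} {j} p = first-cong λ k → does-⇔
    (mk⇔ (λ q → conn-trans q p) (λ q → conn-trans q (conn-sym p)))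
    (conn? X (t k) (t i)) (conn? X (t k) (t j))

  label-≡⁻ : ∀ X {i j} → label X i ≡ label X j → Conn G X (t i) (t j)
  label-≡⁻ X {i} {j} eq = conn-trans (conn-sym (label-conn X i))
    (≡.subst (λ k → Conn G X (t k) (t j)) (≡.sym eq) (label-conn X j))

  lookup-≡ : ∀ X {i j} → Conn G X (t i) (t j) → lookup (labels X) i ≡ lookup (labels X) j
  lookup-≡ X {i} {j} p =
    ≡.trans (lookup-labels X i) (≡.trans (label-≡ X p) (≡.sym (lookup-labels X j)))

  lookup-≡⁻ : ∀ X {i j} → lookup (labels X) i ≡ lookup (labels X) j → Conn G X (t i) (t j)
  lookup-≡⁻ X {i} {j} eq = label-≡⁻ X
    (≡.trans (≡.sym (lookup-labels X i)) (≡.trans eq (lookup-labels X j)))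

  lookup-conn : ∀ X i → Conn G X (t (lookup (labels X) i)) (t i)
  lookup-conn X i = ≡.subst (λ k → Conn G X (t k) (t i)) (≡.sym (lookup-labels X i)) (label-conn X i)

  labels-cong : ∀ {X Y} → (∀ i j → Conn G X (t i) (t j) ⇔ Conn G Y (t i) (t j)) →
    labels X ≡ labels Y
  labels-cong {X} {Y} eqv = tabulate-cong λ i → first-cong λ j →
    does-⇔ (eqv j i) (conn? X (t j) (t i)) (conn? Y (t j) (t i))

  labels-canonical : ∀ X → canonical (labels X) ≡ true
  labels-canonical X = allFin-intro _ λ i → dec-true (lookup (labels X) i ≟ _)
    (≡.trans (lookup-labels X i) (first-cong λ j → does-⇔
      (mk⇔ (lookup-≡ X) (lookup-≡⁻ X)) (conn? X (t j) (t i))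
      (lookup (labels X) j ≟ lookup (labels X) i)))

  labels-⊞ : ∀ X e s s′ → Conn G X (tail e) (t s) → Conn G X (head e) (t s′) →
    labels (X ⊞ e) ≡ merge (labels X) s s′
  labels-⊞ X e s s′ ps ps′ = tabulate-cong λ i → first-cong λ j → does-⇔ (eqv i j)
    (conn? (X ⊞ e) (t j) (t i))
    ((l j ≟ l i) ⊎-dec ((l j ≟ l s) ×-dec (l s′ ≟ l i)) ⊎-dec ((l j ≟ l s′) ×-dec (l s ≟ l i)))
    where
    l : Fin 4 → Fin 4
    l = lookup (labels X)

    up : ∀ {u v} → Conn G X u v → Conn G (X ⊞ e) u v
    up = conn-mono (⊆-⊞ X e)

    across : Conn G (X ⊞ e) (t s) (t s′)
    across = conn-trans (up (conn-sym ps)) (conn-trans (conn-edge (∈-⊞ X e)) (up ps′))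

    eqv : ∀ i j → Conn G (X ⊞ e) (t j) (t i) ⇔
      (l j ≡ l i ⊎ (l j ≡ l s × l s′ ≡ l i) ⊎ (l j ≡ l s′ × l s ≡ l i))
    eqv i j = mk⇔ to from
      where
      to : Conn G (X ⊞ e) (t j) (t i) →
        l j ≡ l i ⊎ (l j ≡ l s × l s′ ≡ l i) ⊎ (l j ≡ l s′ × l s ≡ l i)
      to p with conn-⊞⁻ X e p
      ... | inj₁ q              = inj₁ (lookup-≡ X q)
      ... | inj₂ (inj₁ (q , r)) = inj₂ (inj₁
        (lookup-≡ X (conn-trans q ps) , lookup-≡ X (conn-trans (conn-sym ps′) r)))
      ... | inj₂ (inj₂ (q , r)) = inj₂ (inj₂
        (lookup-≡ X (conn-trans q ps′) , lookup-≡ X (conn-trans (conn-sym ps) r)))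

      from : l j ≡ l i ⊎ (l j ≡ l s × l s′ ≡ l i) ⊎ (l j ≡ l s′ × l s ≡ l i) →
        Conn G (X ⊞ e) (t j) (t i)
      from (inj₁ q) = up (lookup-≡⁻ X q)
      from (inj₂ (inj₁ (q , r))) =
        conn-trans (up (lookup-≡⁻ X q)) (conn-trans across (up (lookup-≡⁻ X r)))
      from (inj₂ (inj₂ (q , r))) =
        conn-trans (up (lookup-≡⁻ X q)) (conn-trans (conn-sym across) (up (lookup-≡⁻ X r)))

-- Certificates

module Certificates {c ℓ} (F : Field c ℓ) (notGF2 : NotGF2 F) where
  open FieldTheory F
  open ≈-Reasoning
  open Evaluation F notGF2
  open BlockSums F

  L-apply-cong : ∀ {f g : Fin 4 → Carrier} → (∀ j → f j ≈ g j) → ∀ i → L-apply f i ≈ L-apply g i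
  L-apply-cong f≈g i = ∑-cong λ j → *-congˡ {L i j} (f≈g j)

  when-cong : ∀ test {x y} → x ≈ y → when test x ≈ when test y
  when-cong true  eq = eq
  when-cong false eq = refl

  supply : (Fin 4 → Carrier) → (Fin 4 → Carrier) → Carrier
  supply f g = ∑ F (λ i → g i ⊗ L-apply f i)

  supply-0 : ∀ {f} g → (∀ j → f j ≈ 0#) → supply f g ≈ 0#
  supply-0 {f} g f≈0 = ∑-0 {f = λ i → g i ⊗ L-apply f i} λ i →
    trans (*-congˡ (∑-0 {f = λ j → L i j ⊗ f j} λ j → trans (*-congˡ (f≈0 j)) (zeroʳ _))) (zeroʳ _)

  supply-sym : ∀ f g → supply f g ≈ supply g f
  supply-sym f g = begin
    ∑ F (λ i → g i ⊗ L-apply f i)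
      ≈⟨ ∑-cong (λ i → sym (∑-⊗ˡ (g i) (λ j → L i j ⊗ f j))) ⟩
    ∑ F (λ i → ∑ F (λ j → g i ⊗ (L i j ⊗ f j)))
      ≈⟨ ∑-comm (λ i j → g i ⊗ (L i j ⊗ f j)) ⟩
    ∑ F (λ j → ∑ F (λ i → g i ⊗ (L i j ⊗ f j)))
      ≈⟨ ∑-cong (λ j → ∑-cong λ i → trans (*-congˡ (*-congʳ (L-sym i j)))
           (solve 3 (λ g l f → g :* (l :* f) := f :* (l :* g)) refl (g i) (L j i) (f j))) ⟩
    ∑ F (λ j → ∑ F (λ i → f j ⊗ (L j i ⊗ g i)))
      ≈⟨ ∑-cong (λ j → ∑-⊗ˡ (f j) (λ i → L j i ⊗ g i)) ⟩
    ∑ F (λ j → f j ⊗ L-apply g j) ∎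

  module _ (G₁ : Graph) (t₁ : Fin 4 → Fin (V G₁)) (G₂ : Graph) (t₂ : Fin 4 → Fin (V G₂))
           (A : Subset (E G₁)) (R : Subset (E G₂)) (e : Fin (E G₁)) where
    private
      module Fl₁ = Flows F G₁
      module Fl₂ = Flows F G₂

    -- Let `R` be the complement of a set B of edges of `G₂`. This is a row vector that vanishes on
    -- A ∪ B and has a unit at `e`: its flow part is supported on `R`, hence zero on B.
    record PotentialCert : Set (c Level.⊔ ℓ) where
      field
        φ        : Fl₁.Potential
        constant : ∀ i → i ∈ A → Fl₁.d φ i ≈ 0#
        unit     : Unit (Fl₁.d φ e)
        balance  : Fl₂.Flow R (λ ψ → supply (φ ∘ t₁) (ψ ∘ t₂))

    -- The opposite witness, a relation supported on A, `e` and B: since `ψ` is constant along the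
    -- edges of `R`, the entries -dψ vanish outside B.
    record FlowCert : Set (c Level.⊔ ℓ) where
      field
        ψ        : Fl₂.Potential
        constant : ∀ i → i ∈ R → Fl₂.d ψ i ≈ 0#
        balance  : Fl₁.Flow (A ⊞ e) (λ φ → supply (ψ ∘ t₂) (φ ∘ t₁))
        unit     : Unit (Fl₁.flow balance e)

  module Extension (G : Graph) (t : Fin 4 → Fin (V G)) (X : Subset (E G)) (u : Fin 4 → Carrier) where
    open Components G
    open Terminals G t
    open Flows F G

    reaches? : ∀ v → Dec (∃[ j ] Conn G X (t j) v)
    reaches? v = any? λ j → conn? X (t j) v

    -- A component of `X` without terminals receives the value 0, which keeps the potential constant
    -- on it and does not enter the Laplacian.
    value : ∀ {v} → Dec (∃[ j ] Conn G X (t j) v) → Carrier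
    value (yes (j , _)) = u (lookup (labels X) j)
    value (no _)        = 0#

    extend : Potential
    extend v = value (reaches? v)

    value-at : ∀ {v} (r : Dec (∃[ j ] Conn G X (t j) v)) j → Conn G X (t j) v →
      value r ≡ u (lookup (labels X) j)
    value-at (yes (k , q)) j p = ≡.cong u (lookup-≡ X (conn-trans q (conn-sym p)))
    value-at (no ¬r)       j p = ⊥-elim (¬r (j , p))

    extend-at : ∀ {v} j → Conn G X (t j) v → extend v ≡ u (lookup (labels X) j)
    extend-at {v} = value-at (reaches? v)

    value-conn : ∀ {v w} (r : Dec (∃[ j ] Conn G X (t j) v)) (r′ : Dec (∃[ j ] Conn G X (t j) w)) →
      Conn G X v w → value r ≡ value r′
    value-conn (yes (j , p)) r′             q = ≡.sym (value-at r′ j (conn-trans p q))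
    value-conn (no ¬r)       (yes (j , p′)) q = ⊥-elim (¬r (j , conn-trans p′ (conn-sym q)))
    value-conn (no ¬r)       (no _)         q = ≡.refl

    extend-constant : ∀ i → i ∈ X → d extend i ≈ 0#
    extend-constant i i∈X = trans
      (+-congˡ (-‿cong (reflexive (value-conn (reaches? (tail i)) (reaches? (head i)) (conn-edge i∈X)))))
      (-‿inverseʳ _)

  module _ {G₁ : Graph} {t₁ : Fin 4 → Fin (V G₁)} {G₂ : Graph} {t₂ : Fin 4 → Fin (V G₂)}
           (A : Subset (E G₁)) (R : Subset (E G₂)) (e : Fin (E G₁)) where
    private
      module C₁ = Components G₁
      module T₁ = Terminals G₁ t₁
      module T₂ = Terminals G₂ t₂
      module Fl₁ = Flows F G₁
      module Fl₂ = Flows F G₂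
    open C₁ using (tail; head)

    -- `e` closes a cycle with edges of `A`. The circulation around it has divergence 0, which is
    -- the image under L of the zero potential on `G₂`.
    closed-flow : e ∉ A → Conn G₁ A (tail e) (head e) → FlowCert G₁ t₁ G₂ t₂ A R e
    closed-flow e∉A p = record
      { ψ        = λ _ → 0#
      ; constant = λ _ _ → -‿inverseʳ 0#
      ; balance  = Fl₁.flow-resp (λ φ → trans
          (solve 2 (λ h t → (t :+ :- h) :+ (h :+ :- t) := con (ℤ.+ 0)) refl (φ (head e)) (φ (tail e)))
          (sym (supply-0 (φ ∘ t₁) (λ _ → refl))))
          (Fl₁.flow-⊕ (Fl₁.flow-mono (⊆-⊞ A e) back) (Fl₁.flow-edge (∈-⊞ A e)))
      ; unit     = unit-cong (sym (trans (+-cong (Fl₁.support back e e∉A)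
          (Fl₁.flow-edge-self (∈-⊞ A e))) (+-identityˡ 1#))) unit-1
      }
      where
      back : Fl₁.Flow A (λ φ → φ (tail e) ⊕ ⊖ φ (head e))
      back = Fl₁.flow-path (C₁.conn-sym p)

    -- Here z is the end of e whose component is raised to potential 1.
    floating-potential : ∀ z → (∀ j → ¬ Conn G₁ A (t₁ j) z) →
      (z ≡ tail e × ¬ Conn G₁ A z (head e)) ⊎ (z ≡ head e × ¬ Conn G₁ A z (tail e)) →
      PotentialCert G₁ t₁ G₂ t₂ A R e
    floating-potential z ¬t end = record
      { φ        = φ
      ; constant = λ i i∈A → trans (+-congˡ (-‿cong (reflexive
          (same (C₁.conn? A z (tail i)) (C₁.conn? A z (head i)) (C₁.conn-edge i∈A))))) (-‿inverseʳ _)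
      ; unit     = unit end
      ; balance  = Fl₂.flow-resp (λ ψ → sym (supply-0 (ψ ∘ t₂) λ j →
          reflexive (outside-z (C₁.conn? A z (t₁ j)) (λ p → ¬t j (C₁.conn-sym p))))) Fl₂.flow-0
      }
      where
      level : ∀ {v} → Dec (Conn G₁ A z v) → Carrier
      level r = if does r then 1# else 0#

      φ : Fl₁.Potential
      φ v = level (C₁.conn? A z v)

      inside-z : ∀ {v} (r : Dec (Conn G₁ A z v)) → Conn G₁ A z v → level r ≡ 1#
      inside-z (yes _) p = ≡.refl
      inside-z (no ¬p) p = ⊥-elim (¬p p)

      outside-z : ∀ {v} (r : Dec (Conn G₁ A z v)) → ¬ Conn G₁ A z v → level r ≡ 0#
      outside-z (yes p) ¬p = ⊥-elim (¬p p)
      outside-z (no _)  ¬p = ≡.refl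

      same : ∀ {v w} (r : Dec (Conn G₁ A z v)) (r′ : Dec (Conn G₁ A z w)) → Conn G₁ A v w →
        level r ≡ level r′
      same (yes p) r′ q = ≡.sym (inside-z r′ (C₁.conn-trans p q))
      same (no ¬p) r′ q = ≡.sym (outside-z r′ (λ p → ¬p (C₁.conn-trans p (C₁.conn-sym q))))

      unit : (z ≡ tail e × ¬ Conn G₁ A z (head e)) ⊎ (z ≡ head e × ¬ Conn G₁ A z (tail e)) →
        Unit (Fl₁.d φ e)
      unit (inj₁ (≡.refl , ¬p)) = unit-cong (sym (trans
        (+-cong (reflexive (outside-z (C₁.conn? A z (head e)) ¬p))
                (-‿cong (reflexive (inside-z (C₁.conn? A z z) here)))) (+-identityˡ _)))
        (unit-⊖ unit-1)
      unit (inj₂ (≡.refl , ¬p)) = unit-cong (sym (trans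
        (+-cong (reflexive (inside-z (C₁.conn? A z z) here))
                (-‿cong (reflexive (outside-z (C₁.conn? A z (tail e)) ¬p))))
        (solve 1 (λ x → x :+ :- con (ℤ.+ 0) := x) refl 1#)))
        unit-1

    module _ {s s′ : Fin 4} (ps : Conn G₁ A (tail e) (t₁ s)) (ps′ : Conn G₁ A (head e) (t₁ s′)) where
      private
        p q : Labels
        p = T₁.labels A
        q = T₂.labels R

      -- The charges Lφ sum to zero over every block of terminals joined by `R`, so they can be
      -- routed inside `R`: moved to the representatives of the blocks, they cancel.
      separating-potential : Separation p q s s′ → PotentialCert G₁ t₁ G₂ t₂ A R e
      separating-potential sep = record
        { φ        = φ
        ; constant = Extension.extend-constant G₁ t₁ A u
        ; unit     = unit-cong (trans
            (solve 2 (λ a b → :- (a :+ :- b) := b :+ :- a) refl (u (lookup p s)) (u (lookup p s′)))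
            (sym (+-cong (at s′ (C₁.conn-sym ps′)) (-‿cong (at s (C₁.conn-sym ps))))))
            (unit-⊖ unit)
        ; balance  = Fl₂.flow-resp drop-totals
            (flow-gather t₂ (lookup q) (T₂.lookup-conn R) (L-apply (φ ∘ t₁)))
        }
        where
        open Separation sep

        φ : Fl₁.Potential
        φ = Extension.extend G₁ t₁ A u

        at : ∀ {v} j → Conn G₁ A (t₁ j) v → φ v ≈ u (lookup p j)
        at j r = reflexive (Extension.extend-at G₁ t₁ A u j r)

        total-0 : ∀ b → blockTotal q (L-apply (φ ∘ t₁)) b ≈ 0#
        total-0 b = trans (∑-cong λ i → when-cong (does (lookup q i ≟ b))
          (L-apply-cong (λ j → at j here) i)) (balanced b)

        drop-totals : ∀ ψ → supply (φ ∘ t₁) (ψ ∘ t₂) ⊕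
          ⊖ ∑ F (λ b → ψ (t₂ b) ⊗ blockTotal q (L-apply (φ ∘ t₁)) b) ≈ supply (φ ∘ t₁) (ψ ∘ t₂)
        drop-totals ψ = trans (+-congˡ (-‿cong (∑-0 {f = λ b → ψ (t₂ b) ⊗ blockTotal q (L-apply (φ ∘ t₁)) b}
          λ b → trans (*-congˡ (total-0 b)) (zeroʳ _))))
          (solve 1 (λ x → x :+ :- con (ℤ.+ 0) := x) refl (supply (φ ∘ t₁) (ψ ∘ t₂)))

      -- Collected at the representatives of the blocks of `A`, the charges Lψ form a dipole ±κ on
      -- the blocks of the two ends of `e`. Routing it along `A` to these ends and closing it
      -- through `e` puts the unit -κ on `e`.
      spanning-flow : e ∉ A → lookup p s ≢ lookup p s′ → Spanning p q s s′ → FlowCert G₁ t₁ G₂ t₂ A R e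
      spanning-flow e∉A s≢s′ span = record
        { ψ        = ψ
        ; constant = Extension.extend-constant G₂ t₂ R v
        ; balance  = Fl₁.flow-resp cancel (Fl₁.flow-⊕ (Fl₁.flow-mono (⊆-⊞ A e) inside-A)
            (Fl₁.flow-⊗ (⊖ κ) (Fl₁.flow-edge (∈-⊞ A e))))
        ; unit     = unit-cong (sym (trans (+-cong (Fl₁.support inside-A e e∉A)
            (*-congˡ (Fl₁.flow-edge-self (∈-⊞ A e))))
            (trans (+-identityˡ _) (*-identityʳ _)))) (unit-⊖ unit)
        }
        where
        open Spanning span

        ψ : Fl₂.Potential
        ψ = Extension.extend G₂ t₂ R v

        g : Fin 4 → Carrier
        g = L-apply (ψ ∘ t₂)

        a b : Fin 4
        a = lookup p s
        b = lookup p s′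

        inside-A : Fl₁.Flow A (λ φ →
          (supply (ψ ∘ t₂) (φ ∘ t₁) ⊕ ⊖ ∑ F (λ k → φ (t₁ k) ⊗ blockTotal p g k)) ⊕
          κ ⊗ ((φ (t₁ a) ⊕ ⊖ φ (tail e)) ⊕ (φ (head e) ⊕ ⊖ φ (t₁ b))))
        inside-A = Fl₁.flow-⊕ (flow-gather t₁ (lookup p) (T₁.lookup-conn A) g)
          (Fl₁.flow-⊗ κ (Fl₁.flow-⊕
            (Fl₁.flow-path (C₁.conn-trans ps (C₁.conn-sym (T₁.lookup-conn A s))))
            (Fl₁.flow-path (C₁.conn-trans (T₁.lookup-conn A s′) (C₁.conn-sym ps′)))))

        total : ∀ k → blockTotal p g k ≈
          (if does (k ≟ a) then κ else if does (k ≟ b) then ⊖ κ else 0#)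
        total k = trans (∑-cong λ i → when-cong (does (lookup p i ≟ k))
          (L-apply-cong (λ j → reflexive (Extension.extend-at G₂ t₂ R v j here)) i)) (totals k)

        dipole : ∀ (φ : Fl₁.Potential) → ∑ F (λ k → φ (t₁ k) ⊗ blockTotal p g k) ≈ κ ⊗ (φ (t₁ a) ⊕ ⊖ φ (t₁ b))
        dipole φ = trans (∑-cong λ k → *-congˡ {φ (t₁ k)} (total k)) (∑-dipole a b s≢s′ (φ ∘ t₁) κ)

        cancel : ∀ φ →
          ((supply (ψ ∘ t₂) (φ ∘ t₁) ⊕ ⊖ ∑ F (λ k → φ (t₁ k) ⊗ blockTotal p g k)) ⊕
           κ ⊗ ((φ (t₁ a) ⊕ ⊖ φ (tail e)) ⊕ (φ (head e) ⊕ ⊖ φ (t₁ b)))) ⊕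
          (⊖ κ) ⊗ Fl₁.d φ e ≈ supply (ψ ∘ t₂) (φ ∘ t₁)
        cancel φ = trans (+-congʳ (+-congʳ (+-congˡ (-‿cong (dipole φ)))))
          (solve 6 (λ x k a b t h → ((x :+ :- (k :* (a :+ :- b))) :+
              k :* ((a :+ :- t) :+ (h :+ :- b))) :+ (:- k) :* (h :+ :- t) := x) refl
            (supply (ψ ∘ t₂) (φ ∘ t₁)) κ (φ (t₁ a)) (φ (t₁ b)) (φ (tail e)) (φ (head e)))

-- Increments of the coupled rank

opaque
  -- `R` stands for the complement of the chosen subset of `E G₂`. In this form the two graphs play
  -- symmetric roles, so it is enough to study the addition of an edge of the first graph;
  -- `coupledRank-swap` transfers the result to the second.
  coupledRank : (G₁ : Graph) → (Fin 4 → Fin (V G₁)) → (G₂ : Graph) → (Fin 4 → Fin (V G₂)) →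
    Subset (E G₁) → Subset (E G₂) → ℕ
  coupledRank G₁ t₁ G₂ t₂ A R = Components.rank G₁ A +
    (Components.rank G₂ R + τ (Terminals.labels G₁ t₁ A) (Terminals.labels G₂ t₂ R))

  coupledRank-def : ∀ G₁ t₁ G₂ t₂ A R → coupledRank G₁ t₁ G₂ t₂ A R ≡ Components.rank G₁ A +
    (Components.rank G₂ R + τ (Terminals.labels G₁ t₁ A) (Terminals.labels G₂ t₂ R))
  coupledRank-def G₁ t₁ G₂ t₂ A R = ≡.refl

coupledRank-swap : ∀ G₁ t₁ G₂ t₂ A R →
  coupledRank G₁ t₁ G₂ t₂ A R ≡ coupledRank G₂ t₂ G₁ t₁ R A
coupledRank-swap G₁ t₁ G₂ t₂ A R = ≡.trans (coupledRank-def G₁ t₁ G₂ t₂ A R)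
  (≡.trans (swap-sum (Components.rank G₁ A) (Components.rank G₂ R) _)
  (≡.trans (≡.cong (λ k → Components.rank G₂ R + (Components.rank G₁ A + k))
      (τ-sym (Terminals.labels G₁ t₁ A) (Terminals.labels G₂ t₂ R)
        (Terminals.labels-canonical G₁ t₁ A) (Terminals.labels-canonical G₂ t₂ R)))
    (≡.sym (coupledRank-def G₂ t₂ G₁ t₁ R A))))
  where
  swap-sum : ∀ a b c → a + (b + c) ≡ b + (a + c)
  swap-sum a b c = ≡.trans (≡.sym (ℕ.+-assoc a b c))
    (≡.trans (≡.cong (_+ c) (ℕ.+-comm a b)) (ℕ.+-assoc b a c))

module _ (G₁ : Graph) (t₁ : Fin 4 → Fin (V G₁)) (G₂ : Graph) (t₂ : Fin 4 → Fin (V G₂)) where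

  -- The change of the combinatorial rank is kept together with its witnesses over all fields, so
  -- that a single case distinction, made without reference to a field, decides both.
  data Increment (A : Subset (E G₁)) (R : Subset (E G₂)) (e : Fin (E G₁)) : Setω where
    one  : coupledRank G₁ t₁ G₂ t₂ (A ⊞ e) R ≡ suc (coupledRank G₁ t₁ G₂ t₂ A R) →
      (∀ {c ℓ} (F : Field c ℓ) (α : NotGF2 F) → Certificates.PotentialCert F α G₁ t₁ G₂ t₂ A R e) →
      Increment A R e
    none : coupledRank G₁ t₁ G₂ t₂ (A ⊞ e) R ≡ coupledRank G₁ t₁ G₂ t₂ A R →
      (∀ {c ℓ} (F : Field c ℓ) (α : NotGF2 F) → Certificates.FlowCert F α G₁ t₁ G₂ t₂ A R e) →
      Increment A R e

  module _ (A : Subset (E G₁)) (R : Subset (E G₂)) (e : Fin (E G₁)) (e∉A : e ∉ A) where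
    open Components G₁
    open Terminals G₁ t₁
    private
      module T₂ = Terminals G₂ t₂

      ρ : ℕ
      ρ = Components.rank G₂ R

      Reach : Fin (V G₁) → Set
      Reach v = ∃[ j ] Conn G₁ A (t₁ j) v

      up : ∀ {u v} → Conn G₁ A u v → Conn G₁ (A ⊞ e) u v
      up = conn-mono (⊆-⊞ A e)

      sum-same : ∀ {a a′ k k′} → a′ ≡ a → k′ ≡ k → a′ + (ρ + k′) ≡ a + (ρ + k)
      sum-same ≡.refl ≡.refl = ≡.refl

      sum-suc : ∀ {a a′ k k′} → a′ ≡ suc a → k′ ≡ k → a′ + (ρ + k′) ≡ suc (a + (ρ + k))
      sum-suc ≡.refl ≡.refl = ≡.refl

      sum-cancel : ∀ {a a′ k k′} → a′ ≡ suc a → suc k′ ≡ k → a′ + (ρ + k′) ≡ a + (ρ + k)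
      sum-cancel {a} {k′ = k′} ≡.refl ≡.refl =
        ≡.sym (≡.trans (≡.cong (a +_) (ℕ.+-suc ρ k′)) (ℕ.+-suc a (ρ + k′)))

      τ-with : Labels → ℕ
      τ-with p = τ p (T₂.labels R)

      def : ∀ A → coupledRank G₁ t₁ G₂ t₂ A R ≡ rank A + (ρ + τ-with (labels A))
      def A = coupledRank-def G₁ t₁ G₂ t₂ A R

      same-rank : rank (A ⊞ e) + (ρ + τ-with (labels (A ⊞ e))) ≡ rank A + (ρ + τ-with (labels A)) →
        coupledRank G₁ t₁ G₂ t₂ (A ⊞ e) R ≡ coupledRank G₁ t₁ G₂ t₂ A R
      same-rank eq = ≡.trans (def (A ⊞ e)) (≡.trans eq (≡.sym (def A)))

      suc-rank : rank (A ⊞ e) + (ρ + τ-with (labels (A ⊞ e))) ≡ suc (rank A + (ρ + τ-with (labels A))) →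
        coupledRank G₁ t₁ G₂ t₂ (A ⊞ e) R ≡ suc (coupledRank G₁ t₁ G₂ t₂ A R)
      suc-rank eq = ≡.trans (def (A ⊞ e)) (≡.trans eq (≡.cong suc (≡.sym (def A))))

      closed : Conn G₁ A (tail e) (head e) → Increment A R e
      closed p = none
        (same-rank (sum-same (rank-⊞-conn A e p) (≡.cong τ-with (labels-cong λ i j → mk⇔ down up))))
        (λ F α → Certificates.closed-flow F α A R e e∉A p)
        where
        down : ∀ {u v} → Conn G₁ (A ⊞ e) u v → Conn G₁ A u v
        down q with conn-⊞⁻ A e q
        ... | inj₁ r              = r
        ... | inj₂ (inj₁ (r , s)) = conn-trans r (conn-trans p s)
        ... | inj₂ (inj₂ (r , s)) = conn-trans r (conn-trans (conn-sym p) s)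

      module _ (¬p : ¬ Conn G₁ A (tail e) (head e)) where
        -- One end of `e` lies in a component without terminals. Attaching it leaves the partition
        -- of the terminals, and with it τ, unchanged, while the graphic rank grows.
        floating : ∀ z → ¬ Reach z →
          (z ≡ tail e × ¬ Conn G₁ A z (head e)) ⊎ (z ≡ head e × ¬ Conn G₁ A z (tail e)) →
          Increment A R e
        floating z ¬r end = one
          (suc-rank (sum-suc (rank-⊞-¬conn A e ¬p)
            (≡.cong τ-with (labels-cong λ i j → mk⇔ (down end) up))))
          (λ F α → Certificates.floating-potential F α A R e z (λ j r → ¬r (j , r)) end)
          where
          down : ∀ {i j} →
            (z ≡ tail e × ¬ Conn G₁ A z (head e)) ⊎ (z ≡ head e × ¬ Conn G₁ A z (tail e)) →
            Conn G₁ (A ⊞ e) (t₁ i) (t₁ j) → Conn G₁ A (t₁ i) (t₁ j)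
          down _ q with conn-⊞⁻ A e q
          down _ q                   | inj₁ r              = r
          down (inj₁ (≡.refl , _)) q | inj₂ (inj₁ (r , _)) = ⊥-elim (¬r (_ , r))
          down (inj₁ (≡.refl , _)) q | inj₂ (inj₂ (_ , r)) = ⊥-elim (¬r (_ , conn-sym r))
          down (inj₂ (≡.refl , _)) q | inj₂ (inj₁ (_ , r)) = ⊥-elim (¬r (_ , conn-sym r))
          down (inj₂ (≡.refl , _)) q | inj₂ (inj₂ (r , _)) = ⊥-elim (¬r (_ , r))

        -- Here `e` merges two blocks of terminals. The table decides whether the gain in graphic
        -- rank survives or is cancelled by a drop of τ.
        anchored : Reach (tail e) → Reach (head e) → Increment A R e
        anchored (s , ps) (s′ , ps′) = from-table
          (decided-cases p q s s′ (table-decided p q s s′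
            (labels-canonical A) (T₂.labels-canonical R) s≢s′))
          where
          p q : Labels
          p = labels A
          q = T₂.labels R

          s≢s′ : lookup p s ≢ lookup p s′
          s≢s′ eq = ¬p (conn-trans (conn-sym ps) (conn-trans (lookup-≡⁻ A eq) ps′))

          merged : τ-with (labels (A ⊞ e)) ≡ τ-with (merge p s s′)
          merged = ≡.cong τ-with (labels-⊞ A e s s′ (conn-sym ps) (conn-sym ps′))

          from-table : (τ (merge p s s′) q ≡ τ p q × search (separates p q s s′) ≡ true) ⊎
            (suc (τ (merge p s s′) q) ≡ τ p q × search (spans p q s s′) ≡ true) → Increment A R e
          from-table (inj₁ (same , found)) = one
            (suc-rank (sum-suc (rank-⊞-¬conn A e ¬p) (≡.trans merged same)))
            (λ F α → Certificates.separating-potential F α A R e (conn-sym ps) (conn-sym ps′)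
              (Evaluation.separation F α p q s s′ found))
          from-table (inj₂ (drop , found)) = none
            (same-rank (sum-cancel (rank-⊞-¬conn A e ¬p) (≡.trans (≡.cong suc merged) drop)))
            (λ F α → Certificates.spanning-flow F α A R e (conn-sym ps) (conn-sym ps′) e∉A s≢s′
              (Evaluation.spanning F α p q s s′ found))

      cases : Dec (Conn G₁ A (tail e) (head e)) → Dec (Reach (tail e)) → Dec (Reach (head e)) →
        Increment A R e
      cases (yes p) _       _        = closed p
      cases (no ¬p) (no ¬r) _        = floating ¬p (tail e) ¬r (inj₁ (≡.refl , ¬p))
      cases (no ¬p) (yes _) (no ¬r)  = floating ¬p (head e) ¬r (inj₂ (≡.refl , ¬p ∘ conn-sym))
      cases (no ¬p) (yes r) (yes r′) = anchored ¬p r r′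

    increment : Increment A R e
    increment = cases (conn? A (tail e) (head e))
      (any? λ j → conn? A (t₁ j) (tail e)) (any? λ j → conn? A (t₁ j) (head e))

  coupledRank-monoˡ : ∀ A R → coupledRank G₁ t₁ G₂ t₂ ⊥ R ≤ coupledRank G₁ t₁ G₂ t₂ A R
  coupledRank-monoˡ A R = subset-ind (λ A → coupledRank G₁ t₁ G₂ t₂ ⊥ R ≤ coupledRank G₁ t₁ G₂ t₂ A R)
    ℕ.≤-refl (λ A e e∉A ih → ℕ.≤-trans ih (grows (increment A R e e∉A))) A
    where
    grows : ∀ {A e} → Increment A R e →
      coupledRank G₁ t₁ G₂ t₂ A R ≤ coupledRank G₁ t₁ G₂ t₂ (A ⊞ e) R
    grows (one eq _)  = ℕ.≤-trans (ℕ.n≤1+n _) (ℕ.≤-reflexive (≡.sym eq))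
    grows (none eq _) = ℕ.≤-reflexive (≡.sym eq)

-- Matroids from certified ranks

module UnitIncrease {n} (r : Subset n → ℕ) (r-⊥ : r ⊥ ≡ 0)
  (step : ∀ X e → e ∉ X → r (X ⊞ e) ≡ r X ⊎ r (X ⊞ e) ≡ suc (r X))
  (diminishing : ∀ X Y e → X ⊆ Y → e ∉ Y → r (Y ⊞ e) ≡ suc (r Y) → r (X ⊞ e) ≡ suc (r X))
  where

  r-⊞ : ∀ X e → r X ≤ r (X ⊞ e)
  r-⊞ X e with e ∈? X
  ... | yes e∈X = ℕ.≤-reflexive (≡.cong r (≡.sym (⊞-∈ X e e∈X)))
  ... | no e∉X with step X e e∉X
  ...   | inj₁ eq = ℕ.≤-reflexive (≡.sym eq)
  ...   | inj₂ eq = ℕ.≤-trans (ℕ.n≤1+n _) (ℕ.≤-reflexive (≡.sym eq))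

  bound : ∀ X → r X ≤ ∣ X ∣
  bound = subset-ind (λ X → r X ≤ ∣ X ∣) (ℕ.≤-trans (ℕ.≤-reflexive r-⊥) ℕ.z≤n) grow
    where
    grow : ∀ X e → e ∉ X → r X ≤ ∣ X ∣ → r (X ⊞ e) ≤ ∣ X ⊞ e ∣
    grow X e e∉X ih rewrite ∣⊞∣ X e e∉X with step X e e∉X
    ... | inj₁ eq = ℕ.≤-trans (ℕ.≤-reflexive eq) (ℕ.m≤n⇒m≤1+n ih)
    ... | inj₂ eq = ℕ.≤-trans (ℕ.≤-reflexive eq) (ℕ.s≤s ih)

  r-∪ : ∀ D X → r X ≤ r (X ∪ D)
  r-∪ D X = subset-ind (λ D → r X ≤ r (X ∪ D))
    (ℕ.≤-reflexive (≡.cong r (≡.sym (∪-identityʳ X))))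
    (λ D e _ ih → ℕ.≤-trans ih (ℕ.≤-trans (r-⊞ (X ∪ D) e)
      (ℕ.≤-reflexive (≡.cong r (≡.sym (∪-⊞ X D e)))))) D

  absorb : ∀ {X Y : Subset n} → X ⊆ Y → X ∪ Y ≡ Y
  absorb {X} {Y} X⊆Y = ⊆-antisym
    (λ x∈ → Sum.[ X⊆Y , (λ y → y) ]′ (x∈p∪q⁻ X Y x∈)) (q⊆p∪q X Y)

  mono : ∀ X Y → X ⊆ Y → r X ≤ r Y
  mono X Y X⊆Y = ℕ.≤-trans (r-∪ Y X) (ℕ.≤-reflexive (≡.cong r (absorb X⊆Y)))

  -- Diminishing returns for single elements, accumulated over `D`. Applied to X ∩ Y ⊆ X with Y in
  -- place of `D`, this is submodularity.
  diminishing-∪ : ∀ D X Y → X ⊆ Y → r (Y ∪ D) + r X ≤ r (X ∪ D) + r Y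
  diminishing-∪ D X Y X⊆Y = subset-ind (λ D → r (Y ∪ D) + r X ≤ r (X ∪ D) + r Y)
    (ℕ.≤-reflexive (≡.trans (≡.cong₂ _+_ (≡.cong r (∪-identityʳ Y)) ≡.refl)
      (≡.trans (ℕ.+-comm (r Y) (r X)) (≡.cong (λ Z → r Z + r Y) (≡.sym (∪-identityʳ X))))))
    (λ D e _ ih → grow D e ih) D
    where
    grow : ∀ D e → r (Y ∪ D) + r X ≤ r (X ∪ D) + r Y →
      r (Y ∪ (D ⊞ e)) + r X ≤ r (X ∪ (D ⊞ e)) + r Y
    grow D e ih rewrite ∪-⊞ X D e | ∪-⊞ Y D e = go (e ∈? (Y ∪ D))
      where
      go : Dec (e ∈ Y ∪ D) → r ((Y ∪ D) ⊞ e) + r X ≤ r ((X ∪ D) ⊞ e) + r Y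
      go (yes e∈) = ℕ.≤-trans (ℕ.≤-reflexive (≡.cong (λ Z → r Z + r X) (⊞-∈ (Y ∪ D) e e∈)))
        (ℕ.≤-trans ih (ℕ.+-monoˡ-≤ (r Y) (r-⊞ (X ∪ D) e)))
      go (no e∉) with step (Y ∪ D) e e∉
      ... | inj₁ eq = ℕ.≤-trans (ℕ.≤-reflexive (≡.cong (_+ r X) eq))
        (ℕ.≤-trans ih (ℕ.+-monoˡ-≤ (r Y) (r-⊞ (X ∪ D) e)))
      ... | inj₂ eq = ℕ.≤-trans (ℕ.≤-reflexive (≡.cong (_+ r X) eq))
        (ℕ.≤-trans (ℕ.s≤s ih) (ℕ.≤-reflexive (≡.cong (_+ r Y) (≡.sym
          (diminishing (X ∪ D) (Y ∪ D) e ∪-mono e∉ eq)))))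
        where
        ∪-mono : X ∪ D ⊆ Y ∪ D
        ∪-mono x∈ = x∈p∪q⁺ (Sum.map X⊆Y (λ d → d) (x∈p∪q⁻ X D x∈))

  submod : ∀ X Y → r (X ∪ Y) + r (X ∩ Y) ≤ r X + r Y
  submod X Y = ℕ.≤-trans (diminishing-∪ Y (X ∩ Y) X (p∩q⊆p X Y))
    (ℕ.≤-reflexive (≡.trans (≡.cong (λ Z → r Z + r X) (absorb (p∩q⊆q X Y))) (ℕ.+-comm (r Y) (r X))))

ℚ-field : Field _ _
ℚ-field = record
  { commutativeRing = ℚ.+-*-commutativeRing
  ; 0≉1             = λ ()
  ; inverse         = λ x x≢0 →
      let instance _ = ℚ.≢-nonZero x≢0 in ℚ.1/ x , ℚ.*-inverseʳ x
  }

ℚ-notGF2 : NotGF2 ℚ-field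
ℚ-notGF2 = 1ℚ ℚ.+ 1ℚ , (λ ()) , (λ ())

Predicate : ℕ → Setω
Predicate n = ∀ {c ℓ} (F : Field c ℓ) → NotGF2 F → (Fin n → Field.Carrier F) → Set (c Level.⊔ ℓ)

module _ {n} (r : Subset n → ℕ) (Row Relation : Predicate n) where

  data Certified (X : Subset n) (e : Fin n) : Setω where
    independent : r (X ⊞ e) ≡ suc (r X) →
      (∀ {c ℓ} (F : Field c ℓ) (α : NotGF2 F) → let open FieldTheory F in
        ∃[ w ] (Row F α w × (∀ i → i ∈ X → w i ≈ 0#) × Unit (w e))) → Certified X e
    dependent   : r (X ⊞ e) ≡ r X →
      (∀ {c ℓ} (F : Field c ℓ) (α : NotGF2 F) → let open FieldTheory F in
        ∃[ c ] (Relation F α c × (∀ i → i ∉ X ⊞ e → c i ≈ 0#) × Unit (c e))) → Certified X e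

record CertifiedRank (n : ℕ) : Setω where
  field
    rk            : Subset n → ℕ
    rk-⊥          : rk ⊥ ≡ 0
    Row Relation : Predicate n
    orthogonal   : ∀ {c ℓ} (F : Field c ℓ) (α : NotGF2 F) → let open FieldTheory F in
      ∀ {w c} → Row F α w → Relation F α c → ∑ F (λ i → c i ⊗ w i) ≈ 0#
    certified    : ∀ X e → e ∉ X → Certified rk Row Relation X e

module CertifiedMatroid {n} (M : CertifiedRank n) where
  open CertifiedRank M

  -- The supports of `c` and `w` meet only in `e`, so orthogonality would make a product of two
  -- units zero.
  incompatible : ∀ {c ℓ} (F : Field c ℓ) (α : NotGF2 F) → let open FieldTheory F in
    ∀ {X Y e} → X ⊆ Y →
    (∃[ c ] (Relation F α c × (∀ i → i ∉ X ⊞ e → c i ≈ 0#) × Unit (c e))) →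
    (∃[ w ] (Row F α w × (∀ i → i ∈ Y → w i ≈ 0#) × Unit (w e))) → Empty.⊥
  incompatible F α {X} {Y} {e} X⊆Y (c , Rc , c-off , c-unit) (w , Rw , w-on , w-unit) =
    unit≉0 (unit-⊗ c-unit w-unit) (trans (sym (∑-single e off)) (orthogonal F α Rw Rc))
    where
    open FieldTheory F

    off : ∀ j → j ≢ e → c j ⊗ w j ≈ 0#
    off j j≢e with j ∈? X
    ... | yes j∈X = trans (*-congˡ (w-on j (X⊆Y j∈X))) (zeroʳ _)
    ... | no j∉X  = trans (*-congʳ (c-off j λ j∈ →
      Sum.[ j≢e , j∉X ]′ (∈-⊞⁻ X e j∈))) (zeroˡ _)

  -- Evaluating the certificates over a single field suffices for the matroid axioms.
  diminishing : ∀ X Y e → X ⊆ Y → e ∉ Y → rk (Y ⊞ e) ≡ suc (rk Y) → rk (X ⊞ e) ≡ suc (rk X)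
  diminishing X Y e X⊆Y e∉Y eq = go (certified X e (e∉Y ∘ X⊆Y)) (certified Y e e∉Y)
    where
    go : Certified rk Row Relation X e → Certified rk Row Relation Y e → rk (X ⊞ e) ≡ suc (rk X)
    go (independent eqX _) _ = eqX
    go (dependent _ _) (dependent eqY _) = ⊥-elim (ℕ.1+n≢n (≡.trans (≡.sym eq) eqY))
    go (dependent _ rel) (independent _ row) = ⊥-elim (incompatible ℚ-field ℚ-notGF2 X⊆Y
      (rel ℚ-field ℚ-notGF2) (row ℚ-field ℚ-notGF2))

  step : ∀ X e → e ∉ X → rk (X ⊞ e) ≡ rk X ⊎ rk (X ⊞ e) ≡ suc (rk X)
  step X e e∉X = go (certified X e e∉X)
    where
    go : Certified rk Row Relation X e → rk (X ⊞ e) ≡ rk X ⊎ rk (X ⊞ e) ≡ suc (rk X)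
    go (independent eq _) = inj₂ eq
    go (dependent eq _)   = inj₁ eq

  open UnitIncrease rk rk-⊥ step diminishing public using (bound; mono; submod)

  matroid : Matroid
  matroid = record { n = n ; r = rk ; r-bound = bound ; r-mono = mono ; r-submod = submod }

  module _ {c ℓ} (F : Field c ℓ) (α : NotGF2 F) where
    open FieldTheory F

    Annihilated : (Fin n → Carrier) → Set _
    Annihilated w = ∀ {c} → Relation F α c → ∑ F (λ i → c i ⊗ w i) ≈ 0#

    -- The zero row is a filler: it is orthogonal to every relation and imposes no condition on
    -- coefficient vectors.
    certificateRow : ∀ {X e} → Certified rk Row Relation X e → ∃ Annihilated
    certificateRow (independent _ row) =
      let (w , Rw , _) = row F α in w , orthogonal F α Rw
    certificateRow (dependent _ _) = (λ _ → 0#) , λ _ → ∑-0 {n} λ i → zeroʳ _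

    chosenRow : ∀ X e → Dec (e ∈ X) → ∃ Annihilated
    chosenRow X e (yes _)  = (λ _ → 0#) , λ _ → ∑-0 {n} λ i → zeroʳ _
    chosenRow X e (no e∉X) = certificateRow (certified X e e∉X)

    row : Subset n → Fin n → ∃ Annihilated
    row X e = chosenRow X e (e ∈? X)

    chosenRow-separates : ∀ X e (e∈?X : Dec (e ∈ X)) → e ∉ X → rk (X ⊞ e) ≡ suc (rk X) →
      let w = proj₁ (chosenRow X e e∈?X) in (∀ i → i ∈ X → w i ≈ 0#) × Unit (w e)
    chosenRow-separates X e (yes e∈X) e∉X eq = ⊥-elim (e∉X e∈X)
    chosenRow-separates X e (no e∉X)  _   eq = go (certified X e e∉X)
      where
      go : (cert : Certified rk Row Relation X e) → let w = proj₁ (certificateRow cert) in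
        (∀ i → i ∈ X → w i ≈ 0#) × Unit (w e)
      go (independent _ rows) = let (w , _ , on , unit) = rows F α in on , unit
      go (dependent same _)   = ⊥-elim (ℕ.1+n≢n (≡.trans (≡.sym eq) same))

    -- One certificate row for every pair (X , e), with X encoded in Fin (2 ^ n).
    d : ℕ
    d = 2 ^ n ℕ.* n

    toSubset : Fin (2 ^ n) → Subset n
    toSubset k = tabulate λ i → does (finToFun k i ≟ suc zero)

    fromSubset : Subset n → Fin (2 ^ n)
    fromSubset X = funToFin λ i → if lookup X i then suc zero else zero

    toSubset-fromSubset : ∀ X → toSubset (fromSubset X) ≡ X
    toSubset-fromSubset X = ≡.trans (tabulate-cong λ i →
      ≡.trans (≡.cong (λ b → does (b ≟ suc zero))
        (finToFun-funToFin {n} {2} (λ i → if lookup X i then suc zero else zero) i))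
        (test (lookup X i))) (tabulate∘lookup X)
      where
      test : ∀ b → does ((if b then suc zero else zero) ≟ suc {1} zero) ≡ b
      test true  = ≡.refl
      test false = ≡.refl

    matrix : Fin d → Fin n → Carrier
    matrix i = let (k , e) = remQuot {2 ^ n} n i in proj₁ (row (toSubset k) e)

    rowIndex : Subset n → Fin n → Fin d
    rowIndex X e = combine (fromSubset X) e

    matrix-rowIndex : ∀ X e → matrix (rowIndex X e) ≡ proj₁ (row X e)
    matrix-rowIndex X e = ≡.trans
      (≡.cong (λ (k , e) → proj₁ (row (toSubset k) e)) (remQuot-combine (fromSubset X) e))
      (≡.cong (λ Y → proj₁ (row Y e)) (toSubset-fromSubset X))

    matrix-annihilated : ∀ i → Annihilated (matrix i)
    matrix-annihilated i = let (k , e) = remQuot {2 ^ n} n i in proj₂ (row (toSubset k) e)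

    independent-⊥ : LinIndep F matrix ⊥
    independent-⊥ coef off _ j = off j ∉⊥

    -- On a coefficient vector supported on `Y ⊞ e`, the row chosen for `Y` and `e` reads off the
    -- entry at `e` up to a unit. In a null combination this entry is 0, which leaves a vector
    -- supported on `Y`.
    independent-⊞ : ∀ Y e → e ∉ Y → rk (Y ⊞ e) ≡ suc (rk Y) →
      LinIndep F matrix Y → LinIndep F matrix (Y ⊞ e)
    independent-⊞ Y e e∉Y eq indep coef off null = indep coef off-Y null
      where
      w : Fin n → Carrier
      w = proj₁ (row Y e)

      w-separates : (∀ i → i ∈ Y → w i ≈ 0#) × Unit (w e)
      w-separates = chosenRow-separates Y e (e ∈? Y) e∉Y eq

      term : ∀ j → j ≢ e → coef j ⊗ w j ≈ 0#
      term j j≢e with j ∈? Y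
      ... | yes j∈Y = trans (*-congˡ (proj₁ w-separates j j∈Y)) (zeroʳ _)
      ... | no j∉Y  = trans (*-congʳ (off j λ j∈ →
        Sum.[ j≢e , j∉Y ]′ (∈-⊞⁻ Y e j∈))) (zeroˡ _)

      null-row : ∑ F (λ j → coef j ⊗ w j) ≈ 0#
      null-row = trans
        (reflexive (≡.cong (λ v → ∑ F (λ j → coef j ⊗ v j)) (≡.sym (matrix-rowIndex Y e))))
        (null (rowIndex Y e))

      coef-e : coef e ≈ 0#
      coef-e = unit-cancel (proj₂ w-separates) (trans (sym (∑-single e term)) null-row)

      off-Y : ∀ j → j ∉ Y → coef j ≈ 0#
      off-Y j j∉Y with j ≟ e
      ... | yes ≡.refl = coef-e
      ... | no j≢e     = off j λ j∈ → Sum.[ j≢e , j∉Y ]′ (∈-⊞⁻ Y e j∈)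

    -- An element that failed to raise the rank while the set is built up would bring a relation
    -- inside the set, with an invertible entry and orthogonal to every row of the matrix.
    independent-size : ∀ Y → LinIndep F matrix Y → rk Y ≡ ∣ Y ∣
    independent-size = subset-ind (λ Y → LinIndep F matrix Y → rk Y ≡ ∣ Y ∣)
      (λ _ → ≡.trans rk-⊥ (≡.sym (∣⊥∣≡0 n))) grow
      where
      grow : ∀ Y e → e ∉ Y → (LinIndep F matrix Y → rk Y ≡ ∣ Y ∣) →
        LinIndep F matrix (Y ⊞ e) → rk (Y ⊞ e) ≡ ∣ Y ⊞ e ∣
      grow Y e e∉Y ih indep = go (certified Y e e∉Y)
        where
        smaller : LinIndep F matrix Y
        smaller coef off = indep coef λ j j∉ → off j (j∉ ∘ ⊆-⊞ Y e)

        go : Certified rk Row Relation Y e → rk (Y ⊞ e) ≡ ∣ Y ⊞ e ∣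
        go (independent eq _) = ≡.trans eq (≡.trans (≡.cong suc (ih smaller)) (≡.sym (∣⊞∣ Y e e∉Y)))
        go (dependent _ rel)  = let (c , Rc , off , unit) = rel F α in
          ⊥-elim (unit≉0 unit (indep c off (λ i → matrix-annihilated i Rc) e))

    basis : ∀ X → Σ (Subset n) λ Y → Y ⊆ X × LinIndep F matrix Y × ∣ Y ∣ ≡ rk X
    basis = subset-ind (λ X → Σ (Subset n) λ Y → Y ⊆ X × LinIndep F matrix Y × ∣ Y ∣ ≡ rk X)
      (⊥ , (λ x → x) , independent-⊥ , ≡.trans (∣⊥∣≡0 n) (≡.sym rk-⊥)) grow
      where
      grow : ∀ X e → e ∉ X → (Σ (Subset n) λ Y → Y ⊆ X × LinIndep F matrix Y × ∣ Y ∣ ≡ rk X) →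
        Σ (Subset n) λ Y → Y ⊆ X ⊞ e × LinIndep F matrix Y × ∣ Y ∣ ≡ rk (X ⊞ e)
      grow X e e∉X (Y , Y⊆X , indep , size) = go (step X e e∉X)
        where
        ⊞-mono : Y ⊞ e ⊆ X ⊞ e
        ⊞-mono x∈ with ∈-⊞⁻ Y e x∈
        ... | inj₁ ≡.refl = ∈-⊞ X e
        ... | inj₂ x∈Y    = ⊆-⊞ X e (Y⊆X x∈Y)

        go : rk (X ⊞ e) ≡ rk X ⊎ rk (X ⊞ e) ≡ suc (rk X) →
          Σ (Subset n) λ Y → Y ⊆ X ⊞ e × LinIndep F matrix Y × ∣ Y ∣ ≡ rk (X ⊞ e)
        go (inj₁ same) = Y , (λ x → ⊆-⊞ X e (Y⊆X x)) , indep , ≡.trans size (≡.sym same)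
        go (inj₂ more) = Y ⊞ e , ⊞-mono ,
          independent-⊞ Y e (e∉X ∘ Y⊆X) (diminishing Y X e Y⊆X e∉X more) indep ,
          ≡.trans (∣⊞∣ Y e (e∉X ∘ Y⊆X)) (≡.trans (≡.cong suc size) (≡.sym more))

  nearRegular : NearRegular matroid
  nearRegular F α = d F α , matrix F α , λ X →
    basis F α X , λ Y Y⊆X indep →
      ℕ.≤-trans (ℕ.≤-reflexive (≡.sym (independent-size F α Y indep))) (mono Y X Y⊆X)

-- The coupled matroid

module Coupled (G₁ : Graph) (t₁ : Fin 4 → Fin (V G₁)) (G₂ : Graph) (t₂ : Fin 4 → Fin (V G₂)) where
  private
    m = E G₁
    k = E G₂

  coupled : Subset m → Subset k → ℕ
  coupled = coupledRank G₁ t₁ G₂ t₂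

  offset : ℕ
  offset = coupled ⊥ (∁ ⊥)

  -- The dual rank of B in `G₂` is `∣ B ∣` plus the rank of the complement minus a constant. The
  -- constants are left in here; `offset` is the level of the empty set, and `offset-≤` makes its
  -- subtraction exact.
  level : Subset m → Subset k → ℕ
  level A B = ∣ B ∣ + coupled A (∁ B)

  rank : Subset (m + k) → ℕ
  rank X = level (take m X) (drop m X) ∸ offset

  rank-++ : ∀ A B → rank (A ++ B) ≡ level A B ∸ offset
  rank-++ A B with ++-injective (take m (A ++ B)) A (take++drop≡id m (A ++ B))
  ... | eqA , eqB = ≡.cong₂ (λ A B → level A B ∸ offset) eqA eqB

  -- Adding `j` to `B` removes it from the complement, so the case distinction is made for returning
  -- `j` to `∁ (B ⊞ j)`. A gain of `coupled` there means that `level` stays the same, and no gain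
  -- means that `level` grows.
  incrementʳ : ∀ A B j → j ∉ B → Increment G₂ t₂ G₁ t₁ (∁ (B ⊞ j)) A j
  incrementʳ A B j j∉B = increment G₂ t₂ G₁ t₁ (∁ (B ⊞ j)) A j
    (λ j∈ → x∈∁p⇒x∉p j∈ (∈-⊞ B j))

  ∁-⊞-⊞ : ∀ (B : Subset k) j → j ∉ B → ∁ (B ⊞ j) ⊞ j ≡ ∁ B
  ∁-⊞-⊞ B j j∉B = ≡.trans (≡.cong (_⊞ j) (∁-⊞ B j)) (⊟-⊞ (∁ B) j (x∉p⇒x∈∁p j∉B))

  level-⊞ʳ-one : ∀ A B j → j ∉ B →
    coupledRank G₂ t₂ G₁ t₁ (∁ (B ⊞ j) ⊞ j) A ≡ suc (coupledRank G₂ t₂ G₁ t₁ (∁ (B ⊞ j)) A) →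
    level A (B ⊞ j) ≡ level A B
  level-⊞ʳ-one A B j j∉B eq = begin
    ∣ B ⊞ j ∣ + coupled A (∁ (B ⊞ j))       ≡⟨ ≡.cong₂ _+_ (∣⊞∣ B j j∉B) (coupledRank-swap G₁ t₁ G₂ t₂ A _) ⟩
    suc ∣ B ∣ + coupled′ (∁ (B ⊞ j))        ≡⟨ ≡.sym (ℕ.+-suc ∣ B ∣ _) ⟩
    ∣ B ∣ + suc (coupled′ (∁ (B ⊞ j)))      ≡⟨ ≡.cong (∣ B ∣ +_) (≡.sym eq) ⟩
    ∣ B ∣ + coupled′ (∁ (B ⊞ j) ⊞ j)        ≡⟨ ≡.cong (λ R → ∣ B ∣ + coupled′ R) (∁-⊞-⊞ B j j∉B) ⟩
    ∣ B ∣ + coupled′ (∁ B)                  ≡⟨ ≡.cong (∣ B ∣ +_) (≡.sym (coupledRank-swap G₁ t₁ G₂ t₂ A _)) ⟩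
    level A B                               ∎
    where
    open ≡.≡-Reasoning
    coupled′ : Subset k → ℕ
    coupled′ R = coupledRank G₂ t₂ G₁ t₁ R A

  level-⊞ʳ-none : ∀ A B j → j ∉ B →
    coupledRank G₂ t₂ G₁ t₁ (∁ (B ⊞ j) ⊞ j) A ≡ coupledRank G₂ t₂ G₁ t₁ (∁ (B ⊞ j)) A →
    level A (B ⊞ j) ≡ suc (level A B)
  level-⊞ʳ-none A B j j∉B eq = begin
    ∣ B ⊞ j ∣ + coupled A (∁ (B ⊞ j))       ≡⟨ ≡.cong₂ _+_ (∣⊞∣ B j j∉B) (coupledRank-swap G₁ t₁ G₂ t₂ A _) ⟩
    suc (∣ B ∣ + coupled′ (∁ (B ⊞ j)))      ≡⟨ ≡.cong (λ x → suc (∣ B ∣ + x)) (≡.sym eq) ⟩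
    suc (∣ B ∣ + coupled′ (∁ (B ⊞ j) ⊞ j))  ≡⟨ ≡.cong (λ R → suc (∣ B ∣ + coupled′ R)) (∁-⊞-⊞ B j j∉B) ⟩
    suc (∣ B ∣ + coupled′ (∁ B))            ≡⟨ ≡.cong (λ x → suc (∣ B ∣ + x)) (≡.sym (coupledRank-swap G₁ t₁ G₂ t₂ A _)) ⟩
    suc (level A B)                         ∎
    where
    open ≡.≡-Reasoning
    coupled′ : Subset k → ℕ
    coupled′ R = coupledRank G₂ t₂ G₁ t₁ R A

  level-⊞ˡ : ∀ A B i → i ∉ A → level A B ≤ level (A ⊞ i) B
  level-⊞ˡ A B i i∉A = go (increment G₁ t₁ G₂ t₂ A (∁ B) i i∉A)
    where
    go : Increment G₁ t₁ G₂ t₂ A (∁ B) i → level A B ≤ level (A ⊞ i) B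
    go (one eq _)  = ℕ.+-monoʳ-≤ ∣ B ∣ (ℕ.≤-trans (ℕ.n≤1+n _) (ℕ.≤-reflexive (≡.sym eq)))
    go (none eq _) = ℕ.+-monoʳ-≤ ∣ B ∣ (ℕ.≤-reflexive (≡.sym eq))

  level-⊞ʳ : ∀ A B j → j ∉ B → level A B ≤ level A (B ⊞ j)
  level-⊞ʳ A B j j∉B = go (incrementʳ A B j j∉B)
    where
    go : Increment G₂ t₂ G₁ t₁ (∁ (B ⊞ j)) A j → level A B ≤ level A (B ⊞ j)
    go (one eq _)  = ℕ.≤-reflexive (≡.sym (level-⊞ʳ-one A B j j∉B eq))
    go (none eq _) = ℕ.≤-trans (ℕ.n≤1+n _) (ℕ.≤-reflexive (≡.sym (level-⊞ʳ-none A B j j∉B eq)))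

  offset-≤ : ∀ A B → offset ≤ level A B
  offset-≤ A B = ℕ.≤-trans
    (subset-ind (λ B → offset ≤ level ⊥ B)
      (ℕ.≤-reflexive (≡.cong (_+ coupled ⊥ (∁ ⊥)) (≡.sym (∣⊥∣≡0 k))))
      (λ B j j∉B ih → ℕ.≤-trans ih (level-⊞ʳ ⊥ B j j∉B)) B)
    (subset-ind (λ A → level ⊥ B ≤ level A B) ℕ.≤-refl
      (λ A i i∉A ih → ℕ.≤-trans ih (level-⊞ˡ A B i i∉A)) A)

  rank+offset : ∀ A B → rank (A ++ B) + offset ≡ level A B
  rank+offset A B = ≡.trans (≡.cong (_+ offset) (rank-++ A B)) (ℕ.m∸n+n≡m (offset-≤ A B))

  rank-⊥ : rank ⊥ ≡ 0
  rank-⊥ = ℕ.+-cancelʳ-≡ offset _ _ (≡.trans (≡.cong (λ X → rank X + offset) (≡.sym (⊥++⊥ {m} {k})))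
    (≡.trans (rank+offset ⊥ ⊥) (≡.cong (_+ offset) (∣⊥∣≡0 k))))

  ⊞-++ˡ : ∀ (A : Subset m) (B : Subset k) i → (A ++ B) ⊞ (i ↑ˡ k) ≡ (A ⊞ i) ++ B
  ⊞-++ˡ A B i = []≔-++-↑ˡ A B i

  ⊞-++ʳ : ∀ (A : Subset m) (B : Subset k) j → (A ++ B) ⊞ (m ↑ʳ j) ≡ A ++ (B ⊞ j)
  ⊞-++ʳ A B j = []≔-++-↑ʳ A B j

  from-levels : ∀ A B A′ B′ {l} → level A B ≡ l → level A′ B′ ≡ l → rank (A ++ B) ≡ rank (A′ ++ B′)
  from-levels A B A′ B′ p q = ℕ.+-cancelʳ-≡ offset _ _
    (≡.trans (rank+offset A B) (≡.trans p (≡.trans (≡.sym q) (≡.sym (rank+offset A′ B′)))))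

  rank-suc : ∀ A B A′ B′ → level A′ B′ ≡ suc (level A B) → rank (A′ ++ B′) ≡ suc (rank (A ++ B))
  rank-suc A B A′ B′ eq = ℕ.+-cancelʳ-≡ offset _ _
    (≡.trans (rank+offset A′ B′) (≡.trans eq (≡.cong suc (≡.sym (rank+offset A B)))))

  module Vectors {c ℓ} (F : Field c ℓ) (α : NotGF2 F) where
    open FieldTheory F
    open ≈-Reasoning
    open Certificates F α using (supply; supply-sym)
    module Fl₁ = Flows F G₁
    module Fl₂ = Flows F G₂

    record Row (w : Fin (m + k) → Carrier) : Set (c Level.⊔ ℓ) where
      field
        φ       : Fl₁.Potential
        y       : Fin k → Carrier
        leftʷ   : ∀ i → w (i ↑ˡ k) ≈ Fl₁.d φ i
        rightʷ  : ∀ j → w (m ↑ʳ j) ≈ y j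
        balance : ∀ ψ → Fl₂.⟨ y ,d ψ ⟩ ≈ supply (φ ∘ t₁) (ψ ∘ t₂)

    record Relation (v : Fin (m + k) → Carrier) : Set (c Level.⊔ ℓ) where
      field
        ψ       : Fl₂.Potential
        x       : Fin m → Carrier
        leftᵛ   : ∀ i → v (i ↑ˡ k) ≈ x i
        rightᵛ  : ∀ j → v (m ↑ʳ j) ≈ ⊖ Fl₂.d ψ j
        balance : ∀ φ → Fl₁.⟨ x ,d φ ⟩ ≈ supply (ψ ∘ t₂) (φ ∘ t₁)

    -- The left halves pair to the bilinear form of L at ψ and φ, the right halves to minus this
    -- form with the arguments exchanged.
    orthogonal : ∀ {w v} → Row w → Relation v → ∑ F (λ i → v i ⊗ w i) ≈ 0#
    orthogonal {w} {v} ρ σ = begin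
      ∑ F (λ i → v i ⊗ w i)
        ≈⟨ ∑-+ m (λ i → v i ⊗ w i) ⟩
      ∑ F (λ i → v (i ↑ˡ k) ⊗ w (i ↑ˡ k)) ⊕ ∑ F (λ j → v (m ↑ʳ j) ⊗ w (m ↑ʳ j))
        ≈⟨ +-cong (∑-cong {m} λ i → *-cong (leftᵛ i) (leftʷ i)) (∑-cong {k} λ j → trans
             (*-cong (rightᵛ j) (rightʷ j))
             (solve 2 (λ d y → (:- d) :* y := con (ℤ.- (ℤ.+ 1)) :* (y :* d)) refl (Fl₂.d ψ j) (y j))) ⟩
      Fl₁.⟨ x ,d φ ⟩ ⊕ ∑ F (λ j → ⟦ ℤ.- (ℤ.+ 1) ⟧ℤ ⊗ (y j ⊗ Fl₂.d ψ j))
        ≈⟨ +-congˡ (∑-⊗ˡ {k} ⟦ ℤ.- (ℤ.+ 1) ⟧ℤ (λ j → y j ⊗ Fl₂.d ψ j)) ⟩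
      Fl₁.⟨ x ,d φ ⟩ ⊕ ⟦ ℤ.- (ℤ.+ 1) ⟧ℤ ⊗ Fl₂.⟨ y ,d ψ ⟩
        ≈⟨ +-cong (trans (Relation.balance σ φ) (supply-sym (ψ ∘ t₂) (φ ∘ t₁)))
             (*-congˡ (Row.balance ρ ψ)) ⟩
      supply (φ ∘ t₁) (ψ ∘ t₂) ⊕ ⟦ ℤ.- (ℤ.+ 1) ⟧ℤ ⊗ supply (φ ∘ t₁) (ψ ∘ t₂)
        ≈⟨ solve 1 (λ s → s :+ con (ℤ.- (ℤ.+ 1)) :* s := con (ℤ.+ 0)) refl (supply (φ ∘ t₁) (ψ ∘ t₂)) ⟩
      0# ∎
      where
      open Row ρ using (φ; y; leftʷ; rightʷ)
      open Relation σ using (ψ; x; leftᵛ; rightᵛ)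

    glue : (Fin m → Carrier) → (Fin k → Carrier) → Fin (m + k) → Carrier
    glue f g i = Sum.[ f , g ]′ (splitAt m i)

    glueˡ : ∀ f g i → glue f g (i ↑ˡ k) ≈ f i
    glueˡ f g i = reflexive (≡.cong Sum.[ f , g ]′ (splitAt-↑ˡ m i k))

    glueʳ : ∀ f g j → glue f g (m ↑ʳ j) ≈ g j
    glueʳ f g j = reflexive (≡.cong Sum.[ f , g ]′ (splitAt-↑ʳ m k j))

    zero-on : ∀ {P : Fin (m + k) → Set} {w : Fin (m + k) → Carrier} →
      (∀ i → P (i ↑ˡ k) → w (i ↑ˡ k) ≈ 0#) → (∀ j → P (m ↑ʳ j) → w (m ↑ʳ j) ≈ 0#) →
      ∀ i → P i → w i ≈ 0#
    zero-on {P} {w} l r i = ≡.subst (λ i → P i → w i ≈ 0#) (join-splitAt m k i) (go (splitAt m i))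
      where
      go : ∀ s → P (Fin.join m k s) → w (Fin.join m k s) ≈ 0#
      go (inj₁ i) = l i
      go (inj₂ j) = r j

    ⊖0 : ∀ {x} → x ≈ 0# → ⊖ x ≈ 0#
    ⊖0 x≈0 = trans (-‿cong x≈0) (trans (sym (+-identityˡ _)) (-‿inverseʳ 0#))

    row : ∀ {A R} (φ : Fl₁.Potential) → (∀ i → i ∈ A → Fl₁.d φ i ≈ 0#) →
      Fl₂.Flow R (λ ψ → supply (φ ∘ t₁) (ψ ∘ t₂)) → ∀ B → (∀ {j} → j ∈ B → j ∉ R) →
      Σ (Fin (m + k) → Carrier) λ w → Row w × (∀ i → i ∈ A ++ B → w i ≈ 0#)
    row {A} φ constant f B B∩R = w ,
      record { φ = φ ; y = Fl₂.flow f ; leftʷ = glueˡ _ _ ; rightʷ = glueʳ _ _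
             ; balance = Fl₂.diverges f } ,
      zero-on {P = _∈ A ++ B} (λ i i∈ → trans (glueˡ _ _ i) (constant i (∈-++ˡ⁻ A i∈)))
              (λ j j∈ → trans (glueʳ _ _ j) (Fl₂.support f j (B∩R (∈-++ʳ⁻ A j∈))))
      where
      w : Fin (m + k) → Carrier
      w = glue (Fl₁.d φ) (Fl₂.flow f)

    relation : ∀ {A R} (ψ : Fl₂.Potential) → (∀ j → j ∈ R → Fl₂.d ψ j ≈ 0#) →
      Fl₁.Flow A (λ φ → supply (ψ ∘ t₂) (φ ∘ t₁)) → ∀ B → (∀ {j} → j ∉ B → j ∈ R) →
      Σ (Fin (m + k) → Carrier) λ v → Relation v × (∀ i → i ∉ A ++ B → v i ≈ 0#)
    relation {A} ψ constant f B B∪R = v ,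
      record { ψ = ψ ; x = Fl₁.flow f ; leftᵛ = glueˡ _ _ ; rightᵛ = glueʳ _ _
             ; balance = Fl₁.diverges f } ,
      zero-on {P = _∉ A ++ B} (λ i i∉ → trans (glueˡ _ _ i) (Fl₁.support f i (i∉ ∘ ∈-++ˡ B)))
              (λ j j∉ → trans (glueʳ _ _ j) (⊖0 (constant j (B∪R (j∉ ∘ ∈-++ʳ A)))))
      where
      v : Fin (m + k) → Carrier
      v = glue (Fl₁.flow f) (λ j → ⊖ Fl₂.d ψ j)

  private
    Cert : Subset (m + k) → Fin (m + k) → Setω
    Cert = Certified rank (λ F α → Vectors.Row F α) (λ F α → Vectors.Relation F α)

  certifiedˡ : ∀ A B i → i ∉ A → Cert (A ++ B) (i ↑ˡ k)
  certifiedˡ A B i i∉A = go (increment G₁ t₁ G₂ t₂ A (∁ B) i i∉A)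
    where
    go : Increment G₁ t₁ G₂ t₂ A (∁ B) i → Cert (A ++ B) (i ↑ˡ k)
    go (one eq certs) = independent
      (≡.trans (≡.cong rank (⊞-++ˡ A B i)) (rank-suc A B (A ⊞ i) B
        (≡.trans (≡.cong (∣ B ∣ +_) eq) (ℕ.+-suc ∣ B ∣ _))))
      vector
      where
      vector : ∀ {c ℓ} (F : Field c ℓ) (α : NotGF2 F) → let open FieldTheory F in
        ∃[ w ] (Vectors.Row F α w × (∀ i → i ∈ A ++ B → w i ≈ 0#) × Unit (w (i ↑ˡ k)))
      vector F α =
        let open Certificates.PotentialCert (certs F α)
            (w , Rw , on) = Vectors.row F α φ constant balance B (λ j∈B j∈∁B → x∈∁p⇒x∉p j∈∁B j∈B)
        in w , Rw , on ,
           FieldTheory.unit-cong F (FieldTheory.sym F (Vectors.Row.leftʷ Rw i)) unit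
    go (none eq certs) = dependent
      (≡.trans (≡.cong rank (⊞-++ˡ A B i))
        (from-levels (A ⊞ i) B A B ≡.refl (≡.cong (∣ B ∣ +_) (≡.sym eq))))
      vector
      where
      vector : ∀ {c ℓ} (F : Field c ℓ) (α : NotGF2 F) → let open FieldTheory F in
        ∃[ v ] (Vectors.Relation F α v × (∀ j → j ∉ (A ++ B) ⊞ (i ↑ˡ k) → v j ≈ 0#) × Unit (v (i ↑ˡ k)))
      vector F α =
        let open Certificates.FlowCert (certs F α)
            (v , Rv , off) = Vectors.relation F α ψ constant balance B (λ j∉B → x∉p⇒x∈∁p j∉B)
        in v , Rv , (λ j j∉ → off j (j∉ ∘ ≡.subst (j ∈_) (≡.sym (⊞-++ˡ A B i)))) ,
           FieldTheory.unit-cong F (FieldTheory.sym F (Vectors.Relation.leftᵛ Rv i)) unit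

  -- For an edge of `G₂` the certificates change roles: a potential on `G₂` balanced by a flow on
  -- `G₁` is a relation, and a flow on `G₂` balancing a potential on `G₁` is a row. Hence `one`
  -- gives dependence and `none` independence.
  certifiedʳ : ∀ A B j → j ∉ B → Cert (A ++ B) (m ↑ʳ j)
  certifiedʳ A B j j∉B = go (incrementʳ A B j j∉B)
    where
    R : Subset k
    R = ∁ (B ⊞ j)

    go : Increment G₂ t₂ G₁ t₁ R A j → Cert (A ++ B) (m ↑ʳ j)
    go (one eq certs) = dependent
      (≡.trans (≡.cong rank (⊞-++ʳ A B j))
        (from-levels A (B ⊞ j) A B (level-⊞ʳ-one A B j j∉B eq) ≡.refl))
      vector
      where
      vector : ∀ {c ℓ} (F : Field c ℓ) (α : NotGF2 F) → let open FieldTheory F in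
        ∃[ v ] (Vectors.Relation F α v × (∀ i → i ∉ (A ++ B) ⊞ (m ↑ʳ j) → v i ≈ 0#) × Unit (v (m ↑ʳ j)))
      vector F α =
        let open Certificates.PotentialCert (certs F α)
            (v , Rv , off) = Vectors.relation F α φ constant balance (B ⊞ j) (λ j∉ → x∉p⇒x∈∁p j∉)
        in v , Rv , (λ i i∉ → off i (i∉ ∘ ≡.subst (i ∈_) (≡.sym (⊞-++ʳ A B j)))) ,
           FieldTheory.unit-cong F (FieldTheory.sym F (Vectors.Relation.rightᵛ Rv j))
             (FieldTheory.unit-⊖ F unit)
    go (none eq certs) = independent
      (≡.trans (≡.cong rank (⊞-++ʳ A B j)) (rank-suc A B A (B ⊞ j) (level-⊞ʳ-none A B j j∉B eq)))
      vector
      where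
      vector : ∀ {c ℓ} (F : Field c ℓ) (α : NotGF2 F) → let open FieldTheory F in
        ∃[ w ] (Vectors.Row F α w × (∀ i → i ∈ A ++ B → w i ≈ 0#) × Unit (w (m ↑ʳ j)))
      vector F α =
        let open Certificates.FlowCert (certs F α)
            (w , Rw , on) = Vectors.row F α ψ constant balance B
              (λ i∈B i∈ → x∈∁p⇒x∉p (≡.subst (_ ∈_) (∁-⊞-⊞ B j j∉B) i∈) i∈B)
        in w , Rw , on ,
           FieldTheory.unit-cong F (FieldTheory.sym F (Vectors.Row.rightʷ Rw j)) unit

  certified : ∀ X e → e ∉ X → Cert X e
  certified X e = reassemble (take m X) (drop m X) (splitAt m e)
    (take++drop≡id m X) (join-splitAt m k e)
    where
    reassemble : ∀ A B s {X e} → A ++ B ≡ X → Fin.join m k s ≡ e → e ∉ X → Cert X e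
    reassemble A B (inj₁ i) ≡.refl ≡.refl i∉ = certifiedˡ A B i (i∉ ∘ ∈-++ˡ B)
    reassemble A B (inj₂ j) ≡.refl ≡.refl j∉ = certifiedʳ A B j (j∉ ∘ ∈-++ʳ A)

  certifiedRank : CertifiedRank (m + k)
  certifiedRank = record
    { rk         = rank
    ; rk-⊥       = rank-⊥
    ; Row        = λ F α → Vectors.Row F α
    ; Relation   = λ F α → Vectors.Relation F α
    ; orthogonal = λ F α → Vectors.orthogonal F α
    ; certified  = certified
    }

  open CertifiedMatroid certifiedRank public using (matroid; nearRegular)

-- Complete graphs

opaque
  -- The edges at the first vertex precede those of the complete graph on the remaining vertices.
  -- Ends are listed in increasing order, so an edge is determined by its set of ends.
  edgeCount : ℕ → ℕ
  edgeCount zero    = 0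
  edgeCount (suc N) = N + edgeCount N

  completeEnds : ∀ N → Fin (edgeCount N) → Fin N × Fin N
  completeEnds (suc N) i = Sum.[ (λ j → zero , suc j) , Product.map suc suc ∘ completeEnds N ]′ (splitAt N i)

  completeEnds-< : ∀ N i → proj₁ (completeEnds N i) Fin.< proj₂ (completeEnds N i)
  completeEnds-< (suc N) i with splitAt N i
  ... | inj₁ j = s≤s z≤n
  ... | inj₂ j = s≤s (completeEnds-< N j)

  completeEnds-injective : ∀ N i j → completeEnds N i ≡ completeEnds N j → i ≡ j
  completeEnds-injective (suc N) i j eq = ≡.trans (≡.sym (join-splitAt N _ i))
    (≡.trans (≡.cong (Fin.join N _) (go (splitAt N i) (splitAt N j) eq)) (join-splitAt N _ j))
    where
    f : Fin N ⊎ Fin (edgeCount N) → Fin (suc N) × Fin (suc N)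
    f = Sum.[ (λ j → zero , suc j) , Product.map suc suc ∘ completeEnds N ]′

    go : ∀ s s′ → f s ≡ f s′ → s ≡ s′
    go (inj₁ a) (inj₁ b) eq = ≡.cong inj₁ (Fin.suc-injective (proj₂ (,-injective eq)))
    go (inj₁ a) (inj₂ b) eq with () ← proj₁ (,-injective eq)
    go (inj₂ a) (inj₁ b) eq with () ← proj₁ (,-injective eq)
    go (inj₂ a) (inj₂ b) eq = ≡.cong inj₂ (completeEnds-injective N a b (≡.cong₂ _,_
      (Fin.suc-injective (proj₁ (,-injective eq))) (Fin.suc-injective (proj₂ (,-injective eq)))))

  edge : ∀ N (u v : Fin N) → u Fin.< v → ∃[ i ] completeEnds N i ≡ (u , v)
  edge (suc N) zero    (suc v) _ =
    v ↑ˡ edgeCount N , ≡.cong Sum.[ _ , _ ]′ (splitAt-↑ˡ N v (edgeCount N))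
  edge (suc N) (suc u) (suc v) (s≤s u<v) =
    let (i , eq) = edge N u v u<v in
    N ↑ʳ i , ≡.trans (≡.cong Sum.[ _ , _ ]′ (splitAt-↑ʳ N (edgeCount N) i))
                     (≡.cong (Product.map suc suc) eq)

complete : ℕ → Graph
complete N = record { V = N ; E = edgeCount N ; ends = completeEnds N }

module CompleteGraph (N : ℕ) where
  open Components (complete N)

  K : Graph
  K = complete N

  cross : ∀ {A u v} → ¬ Conn K A u v → Conn K (∁ A) u v
  cross {A} {u} {v} ¬p with <-cmp u v
  ... | tri≈ _ ≡.refl _ = ⊥-elim (¬p here)
  ... | tri< u<v _ _ = let (i , eq) = edge N u v u<v in
    ≡.subst (λ (a , b) → Conn K (∁ A) a b) eq (conn-edge (x∉p⇒x∈∁p λ i∈A →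
      ¬p (≡.subst (λ (a , b) → Conn K A a b) eq (conn-edge i∈A))))
  ... | tri> _ _ v<u = let (i , eq) = edge N v u v<u in
    ≡.subst (λ (b , a) → Conn K (∁ A) a b) eq (conn-sym (conn-edge (x∉p⇒x∈∁p λ i∈A →
      ¬p (≡.subst (λ (b , a) → Conn K A a b) eq (conn-sym (conn-edge i∈A))))))

  Connected : Subset (E K) → Set
  Connected A = ∀ u v → Conn K A u v

  -- Two vertices in one component of `A` have a common neighbour in the complement, namely any
  -- vertex of another component: `u` if their component avoids it, and `v` otherwise.
  complement-connected : ∀ {A u v} → ¬ Conn K A u v → Connected (∁ A)
  complement-connected {A} {u} {v} ¬p x y with conn? A x y | conn? A x u
  ... | no ¬q | _      = cross ¬q
  ... | yes q | no ¬r  = conn-trans (cross ¬r) (cross λ s → ¬r (conn-trans q (conn-sym s)))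
  ... | yes q | yes r  = conn-trans (cross λ s → ¬p (conn-trans (conn-sym r) s))
    (cross λ s → ¬p (conn-trans (conn-sym r) (conn-trans q (conn-sym s))))

  connected-or-complement : ∀ A → Connected A ⊎ Connected (∁ A)
  connected-or-complement A with all? (λ u → all? (conn? A u))
  ... | yes p = inj₁ p
  ... | no ¬p with ¬∀⟶∃¬ N _ (λ u → all? (conn? A u)) ¬p
  ...   | u , ¬q with ¬∀⟶∃¬ N _ (conn? A u) ¬q
  ...     | v , ¬r = inj₂ (complement-connected ¬r)

  -- Incidence vectors over GF(2) and the rank of few edges

  χ : Fin N × Fin N → Fin N → Bool
  χ (u , v) x = does (x ≟ u) xor does (x ≟ v)

  χ-edge : Fin (E K) → Fin N → Bool
  χ-edge i = χ (completeEnds N i)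

  xor-triangle : ∀ a b c → (a xor b) xor (b xor c) ≡ a xor c
  xor-triangle false false c = ≡.refl
  xor-triangle false true  false = ≡.refl
  xor-triangle false true  true  = ≡.refl
  xor-triangle true  false c = ≡.refl
  xor-triangle true  true  c = ≡.refl

  toggleˡ : ∀ b b′ p q → ((b ∧ p) xor (b′ ∧ q)) xor p ≡ (not b ∧ p) xor (b′ ∧ q)
  toggleˡ false b′ p     q = xor-comm (b′ ∧ q) p
  toggleˡ true  b′ false q = xor-comm (b′ ∧ q) false
  toggleˡ true  b′ true  q = xor-comm (not (b′ ∧ q)) true ⟨ ≡.trans ⟩ not-involutive (b′ ∧ q)

  toggleʳ : ∀ b b′ p q → ((b ∧ p) xor (b′ ∧ q)) xor q ≡ (b ∧ p) xor (not b′ ∧ q)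
  toggleʳ b b′ p q = ≡.trans (≡.cong (_xor q) (xor-comm (b ∧ p) (b′ ∧ q)))
    (≡.trans (toggleˡ b′ b q p) (xor-comm (not b′ ∧ q) (b ∧ p)))

  InSpan : Fin (E K) → Fin (E K) → Fin N → Fin N → Set
  InSpan e e′ u v = ∃[ b ] ∃[ b′ ] (∀ x → χ (u , v) x ≡ (b ∧ χ-edge e x) xor (b′ ∧ χ-edge e′ x))

  -- The characteristic vectors over GF(2) turn connectivity into linear dependence.
  conn-span : ∀ {X e e′} → (∀ {i} → i ∈ X → i ≡ e ⊎ i ≡ e′) → ∀ {u v} →
    Conn K X u v → InSpan e e′ u v
  conn-span {X} {e} {e′} X⊆ {u} here = false , false , λ x → xor-same (does (x ≟ u))
  conn-span {X} {e} {e′} X⊆ {u} (fwd {i = i} i∈X p) with X⊆ i∈X | conn-span X⊆ p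
  ... | inj₁ ≡.refl | b , b′ , eq = not b , b′ , λ x →
    ≡.trans (≡.sym (xor-triangle (does (x ≟ u)) (does (x ≟ tail i)) (does (x ≟ head i))))
    (≡.trans (≡.cong (_xor χ-edge e x) (eq x)) (toggleˡ b b′ (χ-edge e x) (χ-edge e′ x)))
  ... | inj₂ ≡.refl | b , b′ , eq = b , not b′ , λ x →
    ≡.trans (≡.sym (xor-triangle (does (x ≟ u)) (does (x ≟ tail i)) (does (x ≟ head i))))
    (≡.trans (≡.cong (_xor χ-edge e′ x) (eq x)) (toggleʳ b b′ (χ-edge e x) (χ-edge e′ x)))
  conn-span {X} {e} {e′} X⊆ {u} (bwd {i = i} i∈X p) with X⊆ i∈X | conn-span X⊆ p
  ... | inj₁ ≡.refl | b , b′ , eq = not b , b′ , λ x →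
    ≡.trans (≡.sym (xor-triangle (does (x ≟ u)) (does (x ≟ head i)) (does (x ≟ tail i))))
    (≡.trans (≡.cong₂ _xor_ (eq x) (xor-comm (does (x ≟ head i)) (does (x ≟ tail i))))
      (toggleˡ b b′ (χ-edge e x) (χ-edge e′ x)))
  ... | inj₂ ≡.refl | b , b′ , eq = b , not b′ , λ x →
    ≡.trans (≡.sym (xor-triangle (does (x ≟ u)) (does (x ≟ head i)) (does (x ≟ tail i))))
    (≡.trans (≡.cong₂ _xor_ (eq x) (xor-comm (does (x ≟ head i)) (does (x ≟ tail i))))
      (toggleʳ b b′ (χ-edge e x) (χ-edge e′ x)))

  χ-tail : ∀ {u v} → u ≢ v → χ (u , v) u ≡ true
  χ-tail {u} {v} u≢v rewrite dec-true (u ≟ u) ≡.refl | dec-false (u ≟ v) u≢v = ≡.refl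

  χ-head : ∀ {u v} → u ≢ v → χ (u , v) v ≡ true
  χ-head {u} {v} u≢v rewrite dec-true (v ≟ v) ≡.refl | dec-false (v ≟ u) (u≢v ∘ ≡.sym) = ≡.refl

  χ-true : ∀ u v x → χ (u , v) x ≡ true → x ≡ u ⊎ x ≡ v
  χ-true u v x eq with x ≟ u | x ≟ v
  χ-true u v x eq | yes p | _     = inj₁ p
  χ-true u v x eq | no _  | yes q = inj₂ q
  χ-true u v x () | no _  | no _

  tail≢head : ∀ i → tail i ≢ head i
  tail≢head i eq = Fin.<⇒≢ (completeEnds-< N i) eq

  χ-injective : ∀ i j → (∀ x → χ-edge i x ≡ χ-edge j x) → i ≡ j
  χ-injective i j eq = completeEnds-injective N i j (≡.cong₂ _,_ tails heads)
    where
    at-tail : tail i ≡ tail j ⊎ tail i ≡ head j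
    at-tail = χ-true (tail j) (head j) (tail i)
      (≡.trans (≡.sym (eq (tail i))) (χ-tail (tail≢head i)))

    at-head : head i ≡ tail j ⊎ head i ≡ head j
    at-head = χ-true (tail j) (head j) (head i)
      (≡.trans (≡.sym (eq (head i))) (χ-head (tail≢head i)))

    swapped : ¬ (tail i ≡ head j × head i ≡ tail j)
    swapped (p , q) = Fin.<-asym (completeEnds-< N i)
      (≡.subst₂ Fin._<_ (≡.sym q) (≡.sym p) (completeEnds-< N j))

    tails : tail i ≡ tail j
    tails with at-tail | at-head
    ... | inj₁ p | _      = p
    ... | inj₂ p | inj₁ q = ⊥-elim (swapped (p , q))
    ... | inj₂ p | inj₂ q = ⊥-elim (tail≢head i (≡.trans p (≡.sym q)))

    heads : head i ≡ head j
    heads with at-head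
    ... | inj₂ q = q
    ... | inj₁ q = ⊥-elim (tail≢head i (≡.trans tails (≡.sym q)))

  -- Incidence vectors of edges are nonzero and pairwise distinct, so the only combination left for
  -- a further edge is the full sum: the third side of a triangle.
  span-cases : ∀ {e e′ f} → f ≢ e → f ≢ e′ → InSpan e e′ (tail f) (head f) →
    ∀ x → χ-edge f x ≡ χ-edge e x xor χ-edge e′ x
  span-cases {e} {e′} {f} f≢e f≢e′ (false , false , eq) =
    ⊥-elim (false≢true (≡.trans (≡.sym (eq (tail f))) (χ-tail (tail≢head f))))
    where
    false≢true : false ≢ true
    false≢true ()
  span-cases {e} {e′} {f} f≢e f≢e′ (false , true  , eq) = ⊥-elim (f≢e′ (χ-injective f e′ eq))
  span-cases {e} {e′} {f} f≢e f≢e′ (true  , false , eq) = ⊥-elim (f≢e (χ-injective f e λ x →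
    ≡.trans (eq x) (xor-comm (χ-edge e x) false)))
  span-cases {e} {e′} {f} f≢e f≢e′ (true  , true  , eq) = eq

  pick : ∀ {k} (A : Subset (E K)) → suc k ≤ ∣ A ∣ → ∃[ e ] (e ∈ A × k ≤ ∣ A ⊟ e ∣)
  pick A h = let (e , e∈A) = nonempty A (ℕ.≤-trans (s≤s z≤n) h) in
    e , e∈A , ℕ.s≤s⁻¹ (ℕ.≤-trans h (ℕ.≤-reflexive (≡.sym (∣⊟∣ A e e∈A))))

  ⊟-≢ : ∀ (A : Subset (E K)) e {f} → f ∈ A ⊟ e → f ≢ e
  ⊟-≢ A e f∈ ≡.refl = ∉-⊟ A e f∈

  rank-mono : ∀ {X Y} → X ⊆ Y → rank X ≤ rank Y
  rank-mono X⊆Y = rank-≥ (conn-mono X⊆Y)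

  ⊞-⊆ : ∀ {X A : Subset (E K)} {e} → X ⊆ A → e ∈ A → X ⊞ e ⊆ A
  ⊞-⊆ {X} {A} {e} X⊆A e∈A x∈ with ∈-⊞⁻ X e x∈
  ... | inj₁ ≡.refl = e∈A
  ... | inj₂ x∈X  = X⊆A x∈X

  rank-single : ∀ e → rank (⊥ ⊞ e) ≡ 1
  rank-single e = ≡.trans (rank-⊞-¬conn ⊥ e λ p → tail≢head e
    (conn-const (λ u → u) (λ i i∈⊥ → ⊥-elim (∉⊥ i∈⊥)) p)) (≡.cong suc rank-⊥)

  ∈-single : ∀ {e i : Fin (E K)} → i ∈ ⊥ ⊞ e → i ≡ e
  ∈-single {e} i∈ = Sum.[ (λ eq → eq) , (λ i∈⊥ → ⊥-elim (∉⊥ i∈⊥)) ]′ (∈-⊞⁻ ⊥ e i∈)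

  rank-pair : ∀ e e′ → e′ ≢ e → rank (⊥ ⊞ e ⊞ e′) ≡ 2
  rank-pair e e′ e′≢e = ≡.trans (rank-⊞-¬conn (⊥ ⊞ e) e′ λ p →
    -- With `e` taken twice, the remaining combination is χ + χ = 0, which is not the vector of an
    -- edge.
    no-span (span-cases e′≢e e′≢e (conn-span {e = e} {e} (inj₁ ∘ ∈-single) p)))
    (≡.cong suc (rank-single e))
    where
    no-span : ¬ (∀ x → χ-edge e′ x ≡ χ-edge e x xor χ-edge e x)
    no-span eq with ≡.trans (≡.sym (χ-tail (tail≢head e′))) (≡.trans (eq (tail e′)) (xor-same (χ-edge e (tail e′))))
    ... | ()

  -- Two edges span at most one further edge, the third side of their triangle, so `f` and `g`
  -- cannot both be spanned.
  rank-triple : ∀ e e′ f g → e′ ≢ e → f ≢ e → f ≢ e′ → g ≢ e → g ≢ e′ → g ≢ f →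
    rank (⊥ ⊞ e ⊞ e′ ⊞ f) ≡ 3 ⊎ rank (⊥ ⊞ e ⊞ e′ ⊞ g) ≡ 3
  rank-triple e e′ f g e′≢e f≢e f≢e′ g≢e g≢e′ g≢f
    with conn? (⊥ ⊞ e ⊞ e′) (tail f) (head f) | conn? (⊥ ⊞ e ⊞ e′) (tail g) (head g)
  ... | no ¬p | _     = inj₁ (≡.trans (rank-⊞-¬conn _ f ¬p) (≡.cong suc (rank-pair e e′ e′≢e)))
  ... | yes _ | no ¬q = inj₂ (≡.trans (rank-⊞-¬conn _ g ¬q) (≡.cong suc (rank-pair e e′ e′≢e)))
  ... | yes p | yes q = ⊥-elim (g≢f (χ-injective g f λ x →
    ≡.trans (span-cases g≢e g≢e′ (conn-span in-pair q) x)
      (≡.sym (span-cases f≢e f≢e′ (conn-span in-pair p) x))))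
    where
    in-pair : ∀ {i : Fin (E K)} → i ∈ ⊥ ⊞ e ⊞ e′ → i ≡ e ⊎ i ≡ e′
    in-pair i∈ with ∈-⊞⁻ (⊥ ⊞ e) e′ i∈
    ... | inj₁ eq = inj₂ eq
    ... | inj₂ i∈′ = inj₁ (∈-single i∈′)

  rank-nonempty : ∀ A → 1 ≤ ∣ A ∣ → 1 ≤ rank A
  rank-nonempty A h = let (e , e∈A , _) = pick A h in
    ℕ.≤-trans (ℕ.≤-reflexive (≡.sym (rank-single e)))
      (rank-mono (⊞-⊆ ⊥⊆ e∈A))

  rank-two : ∀ A → 2 ≤ ∣ A ∣ → 2 ≤ rank A
  rank-two A h =
    let (e , e∈A , h₁) = pick A h
        (e′ , e′∈ , _) = pick (A ⊟ e) h₁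
    in ℕ.≤-trans (ℕ.≤-reflexive (≡.sym (rank-pair e e′ (⊟-≢ A e e′∈))))
      (rank-mono (⊞-⊆ (⊞-⊆ ⊥⊆ e∈A) (∈-⊟⁻ A e e′∈)))

  rank-four : ∀ A → 4 ≤ ∣ A ∣ → 3 ≤ rank A
  rank-four A h = Sum.[ via f∈A , via g∈A ]′ (rank-triple e e′ f g
      (⊟-≢ A e e′∈) (⊟-≢ A e (∈-⊟⁻ B e′ f∈)) (⊟-≢ B e′ f∈)
      (⊟-≢ A e (∈-⊟⁻ B e′ (∈-⊟⁻ C f g∈))) (⊟-≢ B e′ (∈-⊟⁻ C f g∈)) (⊟-≢ C f g∈))
    where
    p₁ = pick A h
    e = proj₁ p₁
    B = A ⊟ e
    p₂ = pick B (proj₂ (proj₂ p₁))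
    e′ = proj₁ p₂
    e′∈ = proj₁ (proj₂ p₂)
    C = B ⊟ e′
    p₃ = pick C (proj₂ (proj₂ p₂))
    f = proj₁ p₃
    f∈ = proj₁ (proj₂ p₃)
    p₄ = pick (C ⊟ f) (proj₂ (proj₂ p₃))
    g = proj₁ p₄
    g∈ = proj₁ (proj₂ p₄)

    f∈A : f ∈ A
    f∈A = ∈-⊟⁻ A e (∈-⊟⁻ B e′ f∈)

    g∈A : g ∈ A
    g∈A = ∈-⊟⁻ A e (∈-⊟⁻ B e′ (∈-⊟⁻ C f g∈))

    via : ∀ {k} → k ∈ A → rank (⊥ ⊞ e ⊞ e′ ⊞ k) ≡ 3 → 3 ≤ rank A
    via k∈A eq = ℕ.≤-trans (ℕ.≤-reflexive (≡.sym eq)) (rank-mono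
      (⊞-⊆ (⊞-⊆ (⊞-⊆ ⊥⊆ (proj₁ (proj₂ p₁))) (∈-⊟⁻ A e e′∈)) k∈A))

  connected-rank : ∀ {A} → Fin N → Connected A → suc (rank A) ≡ N
  connected-rank {A} v conn = ≡.trans (ℕ.+-comm 1 (rank A)) (rank+components
    (⁅ v ⁆ , (λ u → v , x∈⁅x⁆ v , conn u v) ,
     (λ u w u∈ w∈ _ → ≡.trans (x∈⁅y⁆⇒x≡y v u∈) (≡.sym (x∈⁅y⁆⇒x≡y v w∈))) , ∣⁅x⁆∣≡1 v))

-- Internal 4-connectivity

τ-oneBlockʳ : ∀ p → τ p oneBlock ≡ 0
τ-oneBlockʳ p = ≡ᵇ-true (allVec-true {f = λ p → τ p oneBlock ℕ.≡ᵇ 0} table-oneBlockʳ p)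

τ-oneBlockˡ : ∀ p → τ oneBlock p ≡ 0
τ-oneBlockˡ p = ≡ᵇ-true (allVec-true {f = λ p → τ oneBlock p ℕ.≡ᵇ 0} table-oneBlockˡ p)

first-zero : ∀ {n} (f : Fin (suc n) → Bool) → f zero ≡ true → first f ≡ zero
first-zero {zero}  f eq = ≡.refl
first-zero {suc n} f eq rewrite eq = ≡.refl

terminal : ∀ k → Fin 4 → Fin (4 + k)
terminal k i = i ↑ˡ k

module CompleteTerminals (k : ℕ) where
  open CompleteGraph (4 + k)
  open Components K
  open Terminals K (terminal k)

  labels-connected : ∀ {A} → Connected A → labels A ≡ oneBlock
  labels-connected {A} conn = tabulate-cong λ i → first-zero (joined A i)
    (dec-true (conn? A (terminal k zero) (terminal k i)) (conn _ _))

  labels-⊥ : labels ⊥ ≡ discrete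
  labels-⊥ = tabulate-cong λ i → ≡.trans
    (first-cong λ j → does-⇔
      (mk⇔ (λ p → ↑ˡ-injective k j i (conn-const (λ u → u) (λ _ i∈⊥ → ⊥-elim (∉⊥ i∈⊥)) p))
           (λ { ≡.refl → here }))
      (conn? ⊥ (terminal k j) (terminal k i)) (j ≟ i))
    (first-≟ i)
    where
    first-≟ : ∀ i → first (λ j → does (j ≟ i)) ≡ i
    first-≟ zero                   = ≡.refl
    first-≟ (suc zero)             = ≡.refl
    first-≟ (suc (suc zero))       = ≡.refl
    first-≟ (suc (suc (suc zero))) = ≡.refl

  rank-connected : ∀ {A} → Connected A → rank A ≡ 3 + k
  rank-connected conn = ℕ.suc-injective (connected-rank zero conn)

  connected-⊤ : Connected ⊤
  connected-⊤ = ≡.subst Connected ∁⊥≡⊤ (complement-connected {⊥} {zero} {suc zero} λ p →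
    zero≢one (conn-const (λ u → u) (λ _ i∈⊥ → ⊥-elim (∉⊥ i∈⊥)) p))
    where
    zero≢one : zero {3 + k} ≢ suc zero
    zero≢one ()

-- In a simple graph three edges may have rank 2, as a triangle, but four have rank at least 3.
-- Triangles are the reason why sides of size three survive in `sizeFloor-2`.
sizeFloor : ℕ → ℕ
sizeFloor 0 = 0
sizeFloor 1 = 1
sizeFloor 2 = 2
sizeFloor 3 = 2
sizeFloor (suc (suc (suc (suc _)))) = 3

rank-sizeFloor : ∀ N A → sizeFloor ∣ A ∣ ≤ Components.rank (complete N) A
rank-sizeFloor N A = go ∣ A ∣ ℕ.≤-refl
  where
  open CompleteGraph N
  go : ∀ s → s ≤ ∣ A ∣ → sizeFloor s ≤ Components.rank (complete N) A
  go 0 h = z≤n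
  go 1 h = rank-nonempty A h
  go 2 h = rank-two A h
  go 3 h = rank-two A (ℕ.≤-trans (s≤s (s≤s z≤n)) h)
  go (suc (suc (suc (suc s)))) h = rank-four A (ℕ.≤-trans (s≤s (s≤s (s≤s (s≤s z≤n)))) h)

sizeFloor-0 : ∀ a b → sizeFloor a + sizeFloor b < 1 → a + b ≤ 0
sizeFloor-0 0 0 h = z≤n
sizeFloor-0 0 1 (s≤s ())
sizeFloor-0 0 2 (s≤s ())
sizeFloor-0 0 3 (s≤s ())
sizeFloor-0 0 (suc (suc (suc (suc _)))) (s≤s ())
sizeFloor-0 1 b (s≤s ())
sizeFloor-0 2 b (s≤s ())
sizeFloor-0 3 b (s≤s ())
sizeFloor-0 (suc (suc (suc (suc _)))) b (s≤s ())

sizeFloor-1 : ∀ a b → sizeFloor a + sizeFloor b < 2 → a + b ≤ 1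
sizeFloor-1 0 0 h = z≤n
sizeFloor-1 0 1 h = s≤s z≤n
sizeFloor-1 0 2 (s≤s (s≤s ()))
sizeFloor-1 0 3 (s≤s (s≤s ()))
sizeFloor-1 0 (suc (suc (suc (suc _)))) (s≤s (s≤s ()))
sizeFloor-1 1 b (s≤s h) = s≤s (sizeFloor-0 0 b h)
sizeFloor-1 2 b (s≤s (s≤s ()))
sizeFloor-1 3 b (s≤s (s≤s ()))
sizeFloor-1 (suc (suc (suc (suc _)))) b (s≤s (s≤s ()))

sizeFloor-2 : ∀ a b → sizeFloor a + sizeFloor b < 3 → a + b ≤ 3
sizeFloor-2 0 0 h = z≤n
sizeFloor-2 0 1 h = s≤s z≤n
sizeFloor-2 0 2 h = s≤s (s≤s z≤n)
sizeFloor-2 0 3 h = s≤s (s≤s (s≤s z≤n))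
sizeFloor-2 0 (suc (suc (suc (suc _)))) (s≤s (s≤s (s≤s ())))
sizeFloor-2 1 b (s≤s h) = ℕ.≤-trans (s≤s (sizeFloor-1 0 b h)) (s≤s (s≤s z≤n))
sizeFloor-2 2 b (s≤s (s≤s h)) = ℕ.≤-trans (s≤s (s≤s (sizeFloor-0 0 b h))) (s≤s (s≤s z≤n))
sizeFloor-2 3 b (s≤s (s≤s h)) = s≤s (s≤s (s≤s (sizeFloor-0 0 b h)))
sizeFloor-2 (suc (suc (suc (suc _)))) b (s≤s (s≤s (s≤s ())))

module Internally4 (k₁ k₂ : ℕ) where
  private
    module K₁ = CompleteGraph (4 + k₁)
    module K₂ = CompleteGraph (4 + k₂)
    module C₁ = CompleteTerminals k₁
    module C₂ = CompleteTerminals k₂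
    t₁ = terminal k₁
    t₂ = terminal k₂
    r₁ = Components.rank K₁.K
    r₂ = Components.rank K₂.K
    m = E K₁.K
    k = E K₂.K

  open Coupled K₁.K t₁ K₂.K t₂ public

  coupled-connectedʳ : ∀ A {R} → K₂.Connected R → coupled A R ≡ r₁ A + (3 + k₂)
  coupled-connectedʳ A {R} conn = ≡.trans (coupledRank-def K₁.K t₁ K₂.K t₂ A R) (≡.cong (r₁ A +_) (≡.trans
    (≡.cong₂ (λ x p → x + τ (Terminals.labels K₁.K t₁ A) p) (C₂.rank-connected conn) (C₂.labels-connected conn))
    (≡.trans (≡.cong ((3 + k₂) +_) (τ-oneBlockʳ (Terminals.labels K₁.K t₁ A))) (ℕ.+-identityʳ (3 + k₂)))))

  coupled-connectedˡ : ∀ {A} R → K₁.Connected A → coupled A R ≡ (3 + k₁) + r₂ R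
  coupled-connectedˡ {A} R conn = ≡.trans (coupledRank-def K₁.K t₁ K₂.K t₂ A R) (≡.cong₂ _+_ (C₁.rank-connected conn) (≡.trans
    (≡.cong (λ p → r₂ R + τ p (Terminals.labels K₂.K t₂ R)) (C₁.labels-connected conn))
    (≡.trans (≡.cong (r₂ R +_) (τ-oneBlockˡ (Terminals.labels K₂.K t₂ R))) (ℕ.+-identityʳ (r₂ R)))))

  -- By monotonicity the least value occurs at the empty sets, where it is the rank of the unmerged
  -- Laplacian on four terminals.
  coupled-≥3 : ∀ A R → 3 ≤ coupled A R
  coupled-≥3 A R = begin
    3                                      ≡⟨ ≡.sym base ⟩
    coupled ⊥ ⊥                            ≡⟨ coupledRank-swap K₁.K t₁ K₂.K t₂ ⊥ ⊥ ⟩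
    coupledRank K₂.K t₂ K₁.K t₁ ⊥ ⊥        ≤⟨ coupledRank-monoˡ K₂.K t₂ K₁.K t₁ R ⊥ ⟩
    coupledRank K₂.K t₂ K₁.K t₁ R ⊥        ≡⟨ ≡.sym (coupledRank-swap K₁.K t₁ K₂.K t₂ ⊥ R) ⟩
    coupled ⊥ R                            ≤⟨ coupledRank-monoˡ K₁.K t₁ K₂.K t₂ A R ⟩
    coupled A R                            ∎
    where
    open ℕ.≤-Reasoning
    base : coupled ⊥ ⊥ ≡ 3
    base = ≡.trans (coupledRank-def K₁.K t₁ K₂.K t₂ ⊥ ⊥)
      (≡.cong₂ _+_ (Components.rank-⊥ K₁.K) (≡.cong₂ _+_ (Components.rank-⊥ K₂.K)
        (≡.trans (≡.cong₂ τ C₁.labels-⊥ C₂.labels-⊥) τ-discrete)))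

  offset-value : offset ≡ 3 + k₂
  offset-value = ≡.trans (≡.cong (coupled ⊥) ∁⊥≡⊤)
    (≡.trans (coupled-connectedʳ ⊥ C₂.connected-⊤) (≡.cong (_+ (3 + k₂)) (Components.rank-⊥ K₁.K)))

  rank-⊤ : rank ⊤ + offset ≡ k + (3 + k₁)
  rank-⊤ = ≡.trans (≡.cong (λ X → rank X + offset) (≡.sym (⊤++⊤ {m} {k})))
    (≡.trans (rank+offset ⊤ ⊤) (≡.cong₂ _+_ (∣⊤∣≡n k)
      (≡.trans (≡.cong (coupled ⊤) ∁⊤≡⊥)
      (≡.trans (coupled-connectedˡ ⊥ C₁.connected-⊤)
      (≡.trans (≡.cong ((3 + k₁) +_) (Components.rank-⊥ K₂.K)) (ℕ.+-identityʳ _))))))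

  -- In subtractive form: r(X) + r(∁ X) - r(M) is the sum of the two coupled ranks less the ranks of
  -- both complete graphs. The terms `∣ B ∣` and `∣ ∁ B ∣` add up to a constant that r(M) absorbs.
  connectivity : ∀ A B →
    rank (A ++ B) + rank (∁ A ++ ∁ B) + ((3 + k₁) + (3 + k₂)) ≡
    rank ⊤ + (coupled A (∁ B) + coupled (∁ A) B)
  connectivity A B = ℕ.+-cancelʳ-≡ offset _ _ (begin
    rank (A ++ B) + rank (∁ A ++ ∁ B) + ((3 + k₁) + (3 + k₂)) + offset
      ≡⟨ ≡.cong (λ o → rank (A ++ B) + rank (∁ A ++ ∁ B) + ((3 + k₁) + o) + offset) (≡.sym offset-value) ⟩
    rank (A ++ B) + rank (∁ A ++ ∁ B) + ((3 + k₁) + offset) + offset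
      ≡⟨ solve 4 (λ x y m o → x :+ y :+ (m :+ o) :+ o := (x :+ o) :+ (y :+ o) :+ m) ≡.refl
           (rank (A ++ B)) (rank (∁ A ++ ∁ B)) (3 + k₁) offset ⟩
    (rank (A ++ B) + offset) + (rank (∁ A ++ ∁ B) + offset) + (3 + k₁)
      ≡⟨ ≡.cong₂ (λ x y → x + y + (3 + k₁)) (rank+offset A B)
           (≡.trans (rank+offset (∁ A) (∁ B)) (≡.cong (λ C → ∣ ∁ B ∣ + coupled (∁ A) C) (∁-involutive B))) ⟩
    (∣ B ∣ + coupled A (∁ B)) + (∣ ∁ B ∣ + coupled (∁ A) B) + (3 + k₁)
      ≡⟨ solve 5 (λ b g c h m → (b :+ g) :+ (c :+ h) :+ m := ((b :+ c) :+ m) :+ (g :+ h)) ≡.refl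
           (∣ B ∣) (coupled A (∁ B)) (∣ ∁ B ∣) (coupled (∁ A) B) (3 + k₁) ⟩
    ((∣ B ∣ + ∣ ∁ B ∣) + (3 + k₁)) + (coupled A (∁ B) + coupled (∁ A) B)
      ≡⟨ ≡.cong (λ s → (s + (3 + k₁)) + (coupled A (∁ B) + coupled (∁ A) B)) (∣X∣+∣∁X∣ B) ⟩
    (k + (3 + k₁)) + (coupled A (∁ B) + coupled (∁ A) B)
      ≡⟨ ≡.cong (_+ (coupled A (∁ B) + coupled (∁ A) B)) (≡.sym rank-⊤) ⟩
    (rank ⊤ + offset) + (coupled A (∁ B) + coupled (∁ A) B)
      ≡⟨ solve 3 (λ r o g → (r :+ o) :+ g := (r :+ g) :+ o) ≡.refl
           (rank ⊤) offset (coupled A (∁ B) + coupled (∁ A) B) ⟩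
    rank ⊤ + (coupled A (∁ B) + coupled (∁ A) B) + offset ∎)
    where
    open ≡.≡-Reasoning
    open +-*-Solver

  ∁-++ : ∀ (A : Subset m) (B : Subset k) → ∁ (A ++ B) ≡ ∁ A ++ ∁ B
  ∁-++ A B = map-++ _ A B

  separating-bound : ∀ {j} A B → KSeparating j matroid (A ++ B) →
    coupled A (∁ B) + coupled (∁ A) B < ((3 + k₁) + (3 + k₂)) + j
  separating-bound {j} A B sep = ℕ.+-cancelˡ-< (rank ⊤) _ _ (begin-strict
    rank ⊤ + (coupled A (∁ B) + coupled (∁ A) B)
      ≡⟨ ≡.sym (connectivity A B) ⟩
    rank (A ++ B) + rank (∁ A ++ ∁ B) + ((3 + k₁) + (3 + k₂))
      ≡⟨ ≡.cong (λ X → rank (A ++ B) + rank X + ((3 + k₁) + (3 + k₂))) (≡.sym (∁-++ A B)) ⟩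
    rank (A ++ B) + rank (∁ (A ++ B)) + ((3 + k₁) + (3 + k₂))
      <⟨ ℕ.+-monoˡ-< ((3 + k₁) + (3 + k₂)) sep ⟩
    rank ⊤ + j + ((3 + k₁) + (3 + k₂))
      ≡⟨ ≡.trans (ℕ.+-assoc (rank ⊤) j _) (≡.cong (rank ⊤ +_) (ℕ.+-comm j _)) ⟩
    rank ⊤ + (((3 + k₁) + (3 + k₂)) + j) ∎)
    where open ℕ.≤-Reasoning

  -- One of A, ∁ A spans, and so does one of B, ∁ B. If the two spanning sets lie on different
  -- sides of the partition, the coupling alone contributes connectivity at least 3.
  small-side : ∀ {j} → j ≤ 3 → ∀ A B → KSeparating j matroid (A ++ B) →
    r₁ A + r₂ B < j ⊎ r₁ (∁ A) + r₂ (∁ B) < j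
  small-side {j} j≤3 A B sep =
    go (K₁.connected-or-complement A) (K₂.connected-or-complement B)
    where
    open +-*-Solver
    M₁ M₂ : ℕ
    M₁ = 3 + k₁
    M₂ = 3 + k₂

    bound : ∀ {x y} → coupled A (∁ B) ≡ x → coupled (∁ A) B ≡ y → x + y < (M₁ + M₂) + j
    bound ≡.refl ≡.refl = separating-bound A B sep

    no-crossing : ∀ g → 3 ≤ g → ¬ (M₁ + M₂) + g < (M₁ + M₂) + j
    no-crossing g 3≤g h = ℕ.<-irrefl ≡.refl
      (ℕ.≤-trans (ℕ.≤-trans (ℕ.+-cancelˡ-< (M₁ + M₂) g j h) j≤3) 3≤g)

    go : K₁.Connected A ⊎ K₁.Connected (∁ A) → K₂.Connected B ⊎ K₂.Connected (∁ B) →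
      r₁ A + r₂ B < j ⊎ r₁ (∁ A) + r₂ (∁ B) < j
    go (inj₂ a) (inj₂ b) = inj₁ (ℕ.+-cancelˡ-< (M₁ + M₂) _ _ (≡.subst (_< (M₁ + M₂) + j)
      (solve 4 (λ x y m n → (x :+ n) :+ (m :+ y) := (m :+ n) :+ (x :+ y)) ≡.refl (r₁ A) (r₂ B) M₁ M₂)
      (bound (coupled-connectedʳ A b) (coupled-connectedˡ B a))))
    go (inj₁ a) (inj₁ b) = inj₂ (ℕ.+-cancelˡ-< (M₁ + M₂) _ _ (≡.subst (_< (M₁ + M₂) + j)
      (solve 4 (λ x y m n → (m :+ y) :+ (x :+ n) := (m :+ n) :+ (x :+ y)) ≡.refl (r₁ (∁ A)) (r₂ (∁ B)) M₁ M₂)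
      (bound (coupled-connectedˡ (∁ B) a) (coupled-connectedʳ (∁ A) b))))
    go (inj₂ a) (inj₁ b) = ⊥-elim (no-crossing (coupled A (∁ B)) (coupled-≥3 A (∁ B))
      (≡.subst (_< (M₁ + M₂) + j) (ℕ.+-comm (coupled A (∁ B)) (M₁ + M₂))
        (bound ≡.refl (≡.trans (coupled-connectedˡ B a) (≡.cong (M₁ +_) (C₂.rank-connected b))))))
    go (inj₁ a) (inj₂ b) = ⊥-elim (no-crossing (coupled (∁ A) B) (coupled-≥3 (∁ A) B)
      (bound (≡.trans (coupled-connectedˡ (∁ B) a) (≡.cong (M₁ +_) (C₂.rank-connected b))) ≡.refl))

  small-size : ∀ {j} A B → r₁ A + r₂ B < j → sizeFloor ∣ A ∣ + sizeFloor ∣ B ∣ < j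
  small-size A B h = ℕ.≤-trans
    (s≤s (ℕ.+-mono-≤ (rank-sizeFloor (4 + k₁) A) (rank-sizeFloor (4 + k₂) B))) h

  side-bound : ∀ {j s} → j ≤ 3 → (∀ a b → sizeFloor a + sizeFloor b < j → a + b ≤ s) →
    ∀ X → KSeparating j matroid X → ∣ X ∣ ≤ s ⊎ ∣ ∁ X ∣ ≤ s
  side-bound {j} {s} j≤3 floor X = ≡.subst (λ X → KSeparating j matroid X → ∣ X ∣ ≤ s ⊎ ∣ ∁ X ∣ ≤ s)
    (take++drop≡id m X) (split (take m X) (drop m X))
    where
    size : ∀ A B → r₁ A + r₂ B < j → ∣ A ++ B ∣ ≤ s
    size A B h = ℕ.≤-trans (ℕ.≤-reflexive (∣++∣ A B)) (floor ∣ A ∣ ∣ B ∣ (small-size A B h))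

    split : ∀ A B → KSeparating j matroid (A ++ B) → ∣ A ++ B ∣ ≤ s ⊎ ∣ ∁ (A ++ B) ∣ ≤ s
    split A B sep = Sum.map (size A B)
      (λ h → ≡.subst (λ X → ∣ X ∣ ≤ s) (≡.sym (∁-++ A B)) (size (∁ A) (∁ B) h))
      (small-side j≤3 A B sep)

  internally4Connected : InternallyFourConnected matroid
  internally4Connected = threeConnected , λ X (sep , h , h′) →
    min-3 h h′ (side-bound ℕ.≤-refl sizeFloor-2 X sep)
    where
    no-separation : ∀ {j s} → s < j → j ≤ 3 → (∀ a b → sizeFloor a + sizeFloor b < j → a + b ≤ s) →
      ∀ X → ¬ KSeparation j matroid X
    no-separation s<j j≤3 floor X (sep , h , h′) =
      Sum.[ (λ u → ℕ.<⇒≱ s<j (ℕ.≤-trans h u)) , (λ u → ℕ.<⇒≱ s<j (ℕ.≤-trans h′ u)) ]′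
        (side-bound j≤3 floor X sep)

    threeConnected : ThreeConnected matroid
    threeConnected X = no-separation (s≤s z≤n) (s≤s z≤n) sizeFloor-0 X ,
                       no-separation (s≤s (s≤s z≤n)) (s≤s (s≤s z≤n)) sizeFloor-1 X

    min-3 : ∀ {x y} → 3 ≤ x → 3 ≤ y → x ≤ 3 ⊎ y ≤ 3 → x ⊓ y ≡ 3
    min-3 3≤x 3≤y (inj₁ x≤3) = ≡.trans (ℕ.m≤n⇒m⊓n≡m (ℕ.≤-trans x≤3 3≤y)) (ℕ.≤-antisym x≤3 3≤x)
    min-3 3≤x 3≤y (inj₂ y≤3) = ≡.trans (ℕ.m≥n⇒m⊓n≡n (ℕ.≤-trans y≤3 3≤x)) (ℕ.≤-antisym y≤3 3≤y)

-- Minors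

∈-∪ˡ : ∀ {n} (X Y : Subset n) {x} → x ∈ X → x ∈ X ∪ Y
∈-∪ˡ X Y x∈X = x∈p∪q⁺ (inj₁ x∈X)

∈-∪ʳ : ∀ {n} (X Y : Subset n) {x} → x ∈ Y → x ∈ X ∪ Y
∈-∪ʳ X Y x∈Y = x∈p∪q⁺ {p = X} (inj₂ x∈Y)

∈-img : ∀ {m n} (f : Fin m → Fin n) {X i} → i ∈ X → f i ∈ img f X
∈-img f {X} {i} i∈X = ∈-tabulate
  (dec-true (any? (λ k → (k ∈? X) ×-dec (f k ≟ f i))) (i , i∈X , ≡.refl))

∈-img⁻ : ∀ {m n} (f : Fin m → Fin n) {X j} → j ∈ img f X → ∃[ i ] (i ∈ X × f i ≡ j)
∈-img⁻ f {X} {j} j∈ = does-true⇒ (any? (λ k → (k ∈? X) ×-dec (f k ≟ j))) (∈-tabulate⁻ j∈)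

img-⊥ : ∀ {m n} (f : Fin m → Fin n) → img f ⊥ ≡ ⊥
img-⊥ f = ⊆-antisym (λ x∈ → ⊥-elim (∉⊥ (proj₁ (proj₂ (∈-img⁻ f x∈))))) (λ x∈ → ⊥-elim (∉⊥ x∈))

img-⊞ : ∀ {m n} (f : Fin m → Fin n) X i → img f (X ⊞ i) ≡ img f X ⊞ f i
img-⊞ f X i = ⊆-antisym to from
  where
  to : img f (X ⊞ i) ⊆ img f X ⊞ f i
  to x∈ with ∈-img⁻ f x∈
  ... | k , k∈ , ≡.refl with ∈-⊞⁻ X i k∈
  ...   | inj₁ ≡.refl = ∈-⊞ (img f X) (f i)
  ...   | inj₂ k∈X  = ⊆-⊞ (img f X) (f i) (∈-img f k∈X)

  from : img f X ⊞ f i ⊆ img f (X ⊞ i)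
  from x∈ with ∈-⊞⁻ (img f X) (f i) x∈
  ... | inj₁ ≡.refl = ∈-img f (∈-⊞ X i)
  ... | inj₂ x∈′ with ∈-img⁻ f x∈′
  ...   | k , k∈X , ≡.refl = ∈-img f (⊆-⊞ X i k∈X)

∣img∪∣ : ∀ {m n} (f : Fin m → Fin n) → Injective _≡_ _≡_ f → ∀ C → (∀ i → f i ∉ C) → ∀ X →
  ∣ img f X ∪ C ∣ ≡ ∣ X ∣ + ∣ C ∣
∣img∪∣ {m} f f-inj C f∉C = subset-ind (λ X → ∣ img f X ∪ C ∣ ≡ ∣ X ∣ + ∣ C ∣)
  (≡.trans (≡.cong ∣_∣ (≡.trans (≡.cong (_∪ C) (img-⊥ f)) (∪-identityˡ C)))
    (≡.cong (_+ ∣ C ∣) (≡.sym (∣⊥∣≡0 m))))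
  grow
  where
  grow : ∀ X i → i ∉ X → ∣ img f X ∪ C ∣ ≡ ∣ X ∣ + ∣ C ∣ →
    ∣ img f (X ⊞ i) ∪ C ∣ ≡ ∣ X ⊞ i ∣ + ∣ C ∣
  grow X i i∉X ih = begin
    ∣ img f (X ⊞ i) ∪ C ∣   ≡⟨ ≡.cong (λ Y → ∣ Y ∪ C ∣) (img-⊞ f X i) ⟩
    ∣ (img f X ⊞ f i) ∪ C ∣  ≡⟨ ≡.cong ∣_∣ (⊞-∪ (img f X) C (f i)) ⟩
    ∣ (img f X ∪ C) ⊞ f i ∣ ≡⟨ ∣⊞∣ (img f X ∪ C) (f i) fresh ⟩
    suc ∣ img f X ∪ C ∣     ≡⟨ ≡.cong suc ih ⟩
    suc (∣ X ∣ + ∣ C ∣)     ≡⟨ ≡.cong (_+ ∣ C ∣) (≡.sym (∣⊞∣ X i i∉X)) ⟩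
    ∣ X ⊞ i ∣ + ∣ C ∣       ∎
    where
    open ≡.≡-Reasoning
    fresh : f i ∉ img f X ∪ C
    fresh fi∈ with x∈p∪q⁻ (img f X) C fi∈
    ... | inj₂ fi∈C = f∉C i fi∈C
    ... | inj₁ fi∈′ with ∈-img⁻ f fi∈′
    ...   | k , k∈X , eq = i∉X (≡.subst (_∈ X) (f-inj eq) k∈X)

∪-++ : ∀ {m n} (A B : Subset m) (C D : Subset n) → (A ++ C) ∪ (B ++ D) ≡ (A ∪ B) ++ (C ∪ D)
∪-++ A B C D = zipWith-++ _∨_ A C B D

++-cases : ∀ {m n} (P : Fin (m + n) → Set) → (∀ i → P (i ↑ˡ n)) → (∀ j → P (m ↑ʳ j)) → ∀ x → P x
++-cases {m} {n} P l r x = ≡.subst P (join-splitAt m n x) (go (splitAt m x))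
  where
  go : ∀ s → P (Fin.join m n s)
  go (inj₁ i) = l i
  go (inj₂ j) = r j

img-↑ˡ : ∀ {k m} n (f : Fin k → Fin m) X → img (λ i → f i ↑ˡ n) X ≡ img f X ++ ⊥ {n}
img-↑ˡ {k} {m} n f X = ⊆-antisym to (λ {x} → from x)
  where
  to : img (λ i → f i ↑ˡ n) X ⊆ img f X ++ ⊥ {n}
  to x∈ with ∈-img⁻ (λ i → f i ↑ˡ n) x∈
  ... | i , i∈X , ≡.refl = ∈-++ˡ ⊥ (∈-img f i∈X)

  from : ∀ x → x ∈ img f X ++ ⊥ {n} → x ∈ img (λ i → f i ↑ˡ n) X
  from = ++-cases _ left (λ j j∈ → ⊥-elim (∉⊥ (∈-++ʳ⁻ (img f X) j∈)))
    where
    left : ∀ j → j ↑ˡ n ∈ img f X ++ ⊥ {n} → j ↑ˡ n ∈ img (λ i → f i ↑ˡ n) X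
    left j j∈ with ∈-img⁻ f (∈-++ˡ⁻ (img f X) j∈)
    ... | i , i∈X , ≡.refl = ∈-img (λ i → f i ↑ˡ n) i∈X

img-↑ʳ : ∀ {k n} m (f : Fin k → Fin n) X → img (λ i → m ↑ʳ f i) X ≡ ⊥ {m} ++ img f X
img-↑ʳ {k} {n} m f X = ⊆-antisym to (λ {x} → from x)
  where
  to : img (λ i → m ↑ʳ f i) X ⊆ ⊥ {m} ++ img f X
  to x∈ with ∈-img⁻ (λ i → m ↑ʳ f i) x∈
  ... | i , i∈X , ≡.refl = ∈-++ʳ (⊥ {m}) (∈-img f i∈X)

  from : ∀ x → x ∈ ⊥ {m} ++ img f X → x ∈ img (λ i → m ↑ʳ f i) X
  from = ++-cases _ (λ j j∈ → ⊥-elim (∉⊥ (∈-++ˡ⁻ (⊥ {m}) j∈))) right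
    where
    right : ∀ j → m ↑ʳ j ∈ ⊥ {m} ++ img f X → m ↑ʳ j ∈ img (λ i → m ↑ʳ f i) X
    right j j∈ with ∈-img⁻ f (∈-++ʳ⁻ (⊥ {m}) j∈)
    ... | i , i∈X , ≡.refl = ∈-img (λ i → m ↑ʳ f i) i∈X

↑ˡ<↑ʳ : ∀ {m n} (i : Fin m) (j : Fin n) → i ↑ˡ n Fin.< m ↑ʳ j
↑ˡ<↑ʳ zero    j = s≤s z≤n
↑ˡ<↑ʳ (suc i) j = s≤s (↑ˡ<↑ʳ i j)

↑ʳ-mono-< : ∀ m {n} {i j : Fin n} → i Fin.< j → m ↑ʳ i Fin.< m ↑ʳ j
↑ʳ-mono-< zero    h = h
↑ʳ-mono-< (suc m) h = s≤s (↑ʳ-mono-< m h)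

-- Every edge uv of G is subdivided into u — w — w′ — v; G is recovered by contracting
-- the two outer edges. Two subdividing vertices are needed to accommodate loops.
module Subdivision (G : Graph) where
  open Components G

  extra : ℕ
  extra = V G + (E G + E G)

  K : Graph
  K = complete (4 + extra)

  module C = Components K

  original : Fin (V G) → Fin (4 + extra)
  original v = 4 ↑ʳ (v ↑ˡ (E G + E G))

  near far : Fin (E G) → Fin (4 + extra)
  near i = 4 ↑ʳ (V G ↑ʳ (i ↑ˡ E G))
  far i  = 4 ↑ʳ (V G ↑ʳ (E G ↑ʳ i))

  near-edge middle-edge far-edge : ∀ i → _
  near-edge i   = edge (4 + extra) (original (tail i)) (near i) (↑ʳ-mono-< 4 (↑ˡ<↑ʳ (tail i) _))
  middle-edge i = edge (4 + extra) (near i) (far i) (↑ʳ-mono-< 4 (↑ʳ-mono-< (V G) (↑ˡ<↑ʳ i i)))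
  far-edge i    = edge (4 + extra) (original (head i)) (far i) (↑ʳ-mono-< 4 (↑ˡ<↑ʳ (head i) _))

  nearᵉ middle farᵉ : Fin (E G) → Fin (E K)
  nearᵉ i  = proj₁ (near-edge i)
  middle i = proj₁ (middle-edge i)
  farᵉ i   = proj₁ (far-edge i)

  outer : Subset (E K)
  outer = img nearᵉ ⊤ ∪ img farᵉ ⊤

  subdivide : Subset (E G) → Subset (E K)
  subdivide X = img middle X ∪ outer

  original≢near : ∀ {u i} → original u ≢ near i
  original≢near {u} {i} eq = Fin.<⇒≢ (↑ʳ-mono-< 4 (↑ˡ<↑ʳ u (i ↑ˡ E G))) eq

  middle-injective : Injective _≡_ _≡_ middle
  middle-injective {i} {j} eq = ↑ˡ-injective (E G) i j (↑ʳ-injective (V G) _ _ (↑ʳ-injective 4 _ _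
    (proj₁ (,-injective (≡.trans (≡.sym (proj₂ (middle-edge i)))
      (≡.trans (≡.cong (ends K) eq) (proj₂ (middle-edge j))))))))

  -- Outer edges have an original vertex as their first end, middle edges a subdividing one.
  middle∉outer : ∀ i → middle i ∉ outer
  middle∉outer i m∈ with x∈p∪q⁻ (img nearᵉ ⊤) (img farᵉ ⊤) m∈
  ... | inj₁ m∈′ = let (j , _ , eq) = ∈-img⁻ nearᵉ m∈′ in
    original≢near (proj₁ (,-injective (≡.trans (≡.sym (proj₂ (near-edge j)))
      (≡.trans (≡.cong (ends K) eq) (proj₂ (middle-edge i))))))
  ... | inj₂ m∈′ = let (j , _ , eq) = ∈-img⁻ farᵉ m∈′ in
    original≢near (proj₁ (,-injective (≡.trans (≡.sym (proj₂ (far-edge j)))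
      (≡.trans (≡.cong (ends K) eq) (proj₂ (middle-edge i))))))

  conn-ends : ∀ {Y} j {u v} → ends K j ≡ (u , v) → j ∈ Y → Conn K Y u v
  conn-ends {Y} j eq j∈Y = ≡.subst (λ (a , b) → Conn K Y a b) eq (C.conn-edge j∈Y)

  module _ (X : Subset (E G)) where
    nearᵉ∈ : ∀ i → nearᵉ i ∈ subdivide X
    nearᵉ∈ i = ∈-∪ʳ (img middle X) outer (∈-∪ˡ (img nearᵉ ⊤) (img farᵉ ⊤) (∈-img nearᵉ ∈⊤))

    farᵉ∈ : ∀ i → farᵉ i ∈ subdivide X
    farᵉ∈ i = ∈-∪ʳ (img middle X) outer (∈-∪ʳ (img nearᵉ ⊤) (img farᵉ ⊤) (∈-img farᵉ ∈⊤))

    conn-near : ∀ i → Conn K (subdivide X) (original (tail i)) (near i)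
    conn-near i = conn-ends (nearᵉ i) (proj₂ (near-edge i)) (nearᵉ∈ i)

    conn-far : ∀ i → Conn K (subdivide X) (original (head i)) (far i)
    conn-far i = conn-ends (farᵉ i) (proj₂ (far-edge i)) (farᵉ∈ i)

    through : ∀ {i} → i ∈ X → Conn K (subdivide X) (original (tail i)) (original (head i))
    through {i} i∈X = C.conn-trans (conn-near i) (C.conn-trans
      (conn-ends (middle i) (proj₂ (middle-edge i)) (∈-∪ˡ (img middle X) outer (∈-img middle i∈X)))
      (C.conn-sym (conn-far i)))

    lift-conn : ∀ {u v} → Conn G X u v → Conn K (subdivide X) (original u) (original v)
    lift-conn here        = here
    lift-conn (fwd i∈X p) = C.conn-trans (lift-conn p) (through i∈X)
    lift-conn (bwd i∈X p) = C.conn-trans (lift-conn p) (C.conn-sym (through i∈X))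

    -- Undoes the subdivision on vertices: a subdividing vertex returns to the end it is attached
    -- to, and the terminals stay apart as isolated vertices. Walks of the subdivision become walks
    -- of `G` in `conn-same`.
    collapse : Fin (4 + extra) → Fin 4 ⊎ Fin (V G)
    collapse x = Sum.map₂ (λ y → Sum.[ id , (λ z → Sum.[ tail , head ]′ (splitAt (E G) z)) ]′
      (splitAt (V G) y)) (splitAt 4 x)

    collapse-terminal : ∀ s → collapse (s ↑ˡ extra) ≡ inj₁ s
    collapse-terminal s rewrite splitAt-↑ˡ 4 s extra = ≡.refl

    collapse-original : ∀ v → collapse (original v) ≡ inj₂ v
    collapse-original v rewrite splitAt-↑ˡ (V G) v (E G + E G) = ≡.refl

    collapse-near : ∀ i → collapse (near i) ≡ inj₂ (tail i)
    collapse-near i rewrite splitAt-↑ʳ (V G) (E G + E G) (i ↑ˡ E G) | splitAt-↑ˡ (E G) i (E G) = ≡.refl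

    collapse-far : ∀ i → collapse (far i) ≡ inj₂ (head i)
    collapse-far i rewrite splitAt-↑ʳ (V G) (E G + E G) (E G ↑ʳ i) | splitAt-↑ʳ (E G) (E G) i = ≡.refl

    data Same : Fin 4 ⊎ Fin (V G) → Fin 4 ⊎ Fin (V G) → Set where
      same-terminal : ∀ {s} → Same (inj₁ s) (inj₁ s)
      same-part     : ∀ {u v} → Conn G X u v → Same (inj₂ u) (inj₂ v)

    same-refl : ∀ x → Same x x
    same-refl (inj₁ s) = same-terminal
    same-refl (inj₂ v) = same-part here

    same-trans : ∀ {x y z} → Same x y → Same y z → Same x z
    same-trans same-terminal same-terminal = same-terminal
    same-trans (same-part p) (same-part q) = same-part (conn-trans p q)

    same-sym : ∀ {x y} → Same x y → Same y x
    same-sym same-terminal = same-terminal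
    same-sym (same-part p) = same-part (conn-sym p)

    same-ends : ∀ {j} → j ∈ subdivide X → Same (collapse (C.tail j)) (collapse (C.head j))
    same-ends {j} j∈ with x∈p∪q⁻ (img middle X) outer j∈
    ... | inj₁ m∈ with ∈-img⁻ middle m∈
    ...   | i , i∈X , ≡.refl rewrite proj₂ (middle-edge i) | collapse-near i | collapse-far i =
      same-part (conn-edge i∈X)
    same-ends {j} j∈ | inj₂ o∈ with x∈p∪q⁻ (img nearᵉ ⊤) (img farᵉ ⊤) o∈
    ... | inj₁ n∈ with ∈-img⁻ nearᵉ n∈
    ...   | i , _ , ≡.refl rewrite proj₂ (near-edge i) | collapse-near i | collapse-original (tail i) =
      same-part here
    same-ends {j} j∈ | inj₂ o∈ | inj₂ f∈ with ∈-img⁻ farᵉ f∈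
    ...   | i , _ , ≡.refl rewrite proj₂ (far-edge i) | collapse-far i | collapse-original (head i) =
      same-part here

    conn-same : ∀ {x y} → Conn K (subdivide X) x y → Same (collapse x) (collapse y)
    conn-same {x} here     = same-refl (collapse x)
    conn-same (fwd j∈ p)   = same-trans (conn-same p) (same-ends j∈)
    conn-same (bwd j∈ p)   = same-trans (conn-same p) (same-sym (same-ends j∈))

    -- The four terminals are isolated, and every other component contains an original vertex
    -- because the outer edges are always present.
    subdivide-components : ∀ {c} → NumComponents G X c → NumComponents K (subdivide X) (4 + c)
    subdivide-components {c} (R , cover , sep , ≡.refl) = S , cover′ , sep′ , size
      where
      S : Subset (4 + extra)
      S = ⊤ {4} ++ (R ++ ⊥ {E G + E G})

      size : ∣ S ∣ ≡ 4 + ∣ R ∣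
      size = ≡.cong (4 +_) (≡.trans (∣++∣ R ⊥)
        (≡.trans (≡.cong (∣ R ∣ +_) (∣⊥∣≡0 (E G + E G))) (ℕ.+-identityʳ ∣ R ∣)))

      Covered : Fin (4 + extra) → Set
      Covered x = ∃[ u ] (u ∈ S × Conn K (subdivide X) x u)

      cover-original : ∀ {x} v → Conn K (subdivide X) (original v) x → Covered x
      cover-original v p = let (u , u∈R , q) = cover v in
        original u , ∈-++ʳ (⊤ {4}) (∈-++ˡ ⊥ u∈R) , C.conn-trans (C.conn-sym p) (lift-conn q)

      cover′ : ∀ x → Covered x
      cover′ = ++-cases {4} Covered
        (λ s → s ↑ˡ extra , ∈-++ˡ {A = ⊤ {4}} (R ++ ⊥) ∈⊤ , here)
        (++-cases {V G} (Covered ∘ (4 ↑ʳ_)) (λ v → cover-original v here)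
          (++-cases {E G} (λ z → Covered (4 ↑ʳ (V G ↑ʳ z)))
            (λ i → cover-original (tail i) (conn-near i))
            (λ i → cover-original (head i) (conn-far i))))

      data InS : Fin (4 + extra) → Set where
        terminalˢ : ∀ s → InS (s ↑ˡ extra)
        originalˢ : ∀ {u} → u ∈ R → InS (original u)

      inS : ∀ x → x ∈ S → InS x
      inS = ++-cases {4} (λ x → x ∈ S → InS x) (λ s _ → terminalˢ s)
        (++-cases {V G} (λ y → 4 ↑ʳ y ∈ S → InS (4 ↑ʳ y))
          (λ v v∈ → originalˢ (∈-++ˡ⁻ R (∈-++ʳ⁻ (⊤ {4}) v∈)))
          (λ z z∈ → ⊥-elim (∉⊥ (∈-++ʳ⁻ R (∈-++ʳ⁻ (⊤ {4}) z∈)))))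

      sep′ : ∀ x y → x ∈ S → y ∈ S → Conn K (subdivide X) x y → x ≡ y
      sep′ x y x∈ y∈ p = equal (inS x x∈) (inS y y∈) (conn-same p)
        where
        equal : ∀ {x y} → InS x → InS y → Same (collapse x) (collapse y) → x ≡ y
        equal (terminalˢ s) (terminalˢ s′) q
          with same-terminal ← ≡.subst₂ Same (collapse-terminal s) (collapse-terminal s′) q = ≡.refl
        equal (terminalˢ s) (originalˢ {u} _) q
          with () ← ≡.subst₂ Same (collapse-terminal s) (collapse-original u) q
        equal (originalˢ {u} _) (terminalˢ s) q
          with () ← ≡.subst₂ Same (collapse-original u) (collapse-terminal s) q
        equal (originalˢ {u} u∈) (originalˢ {v} v∈) q
          with same-part r ← ≡.subst₂ Same (collapse-original u) (collapse-original v) q =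
          ≡.cong original (sep u v u∈ v∈ r)

    rank-subdivide : C.rank (subdivide X) ≡ rank X + (E G + E G)
    rank-subdivide = ℕ.+-cancelʳ-≡ (4 + c) _ _ (begin
      C.rank (subdivide X) + (4 + c)   ≡⟨ C.rank+components (subdivide-components comps) ⟩
      4 + (V G + (E G + E G))          ≡⟨ ≡.cong (λ v → 4 + (v + (E G + E G))) (≡.sym (rank+components comps)) ⟩
      4 + ((rank X + c) + (E G + E G)) ≡⟨ solve 3 (λ r c e → con 4 :+ ((r :+ c) :+ e) := (r :+ e) :+ (con 4 :+ c))
                                            ≡.refl (rank X) c (E G + E G) ⟩
      (rank X + (E G + E G)) + (4 + c) ∎)
      where
      open ≡.≡-Reasoning
      open +-*-Solver
      c = proj₁ (components X)
      comps = proj₂ (components X)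

  outer≡ : outer ≡ subdivide ⊥
  outer≡ = ≡.sym (≡.trans (≡.cong (_∪ outer) (img-⊥ middle)) (∪-identityˡ outer))

  rank-outer : C.rank outer ≡ E G + E G
  rank-outer = ≡.trans (≡.cong C.rank outer≡)
    (≡.trans (rank-subdivide ⊥) (≡.cong (_+ (E G + E G)) rank-⊥))

  -- Duality exchanges deletion and contraction: these edges, deleted from the complete graph to
  -- reach the subdivision, are contracted for the cographic minor, while `outer` is deleted there.
  unused : Subset (E K)
  unused = ∁ (subdivide ⊤)

  middle∉unused : ∀ i → middle i ∉ unused
  middle∉unused i m∈ = x∈∁p⇒x∉p m∈ (∈-∪ˡ (img middle ⊤) outer (∈-img middle ∈⊤))

  ∁-middle∪unused : ∀ X → ∁ (img middle X ∪ unused) ≡ subdivide (∁ X)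
  ∁-middle∪unused X = ⊆-antisym to from
    where
    to : ∁ (img middle X ∪ unused) ⊆ subdivide (∁ X)
    to {x} x∈ with x∈p∪q⁻ (img middle ⊤) outer (x∉∁p⇒x∈p λ u → x∈∁p⇒x∉p x∈ (q⊆p∪q (img middle X) unused u))
    ... | inj₂ o∈ = ∈-∪ʳ (img middle (∁ X)) outer o∈
    ... | inj₁ m∈ with ∈-img⁻ middle m∈
    ...   | i , _ , ≡.refl = ∈-∪ˡ (img middle (∁ X)) outer (∈-img middle
      (x∉p⇒x∈∁p λ i∈X → x∈∁p⇒x∉p x∈ (∈-∪ˡ (img middle X) unused (∈-img middle i∈X))))

    avoid : ∀ {x} → x ∉ img middle X → x ∈ subdivide ⊤ → x ∈ ∁ (img middle X ∪ unused)
    avoid x∉ x∈ = x∉p⇒x∈∁p λ x∈∪ → Sum.[ x∉ , (λ u → x∈∁p⇒x∉p u x∈) ]′ (x∈p∪q⁻ (img middle X) unused x∈∪)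

    from : subdivide (∁ X) ⊆ ∁ (img middle X ∪ unused)
    from {x} x∈ with x∈p∪q⁻ (img middle (∁ X)) outer x∈
    ... | inj₂ o∈ = avoid
      (λ m∈ → let (i , _ , eq) = ∈-img⁻ middle m∈ in middle∉outer i (≡.subst (_∈ outer) (≡.sym eq) o∈))
      (∈-∪ʳ (img middle ⊤) outer o∈)
    ... | inj₁ m∈ with ∈-img⁻ middle m∈
    ...   | i , i∈∁X , ≡.refl = avoid
      (λ m∈′ → let (j , j∈X , eq) = ∈-img⁻ middle m∈′ in
        x∈∁p⇒x∉p i∈∁X (≡.subst (_∈ X) (middle-injective eq) j∈X))
      (∈-∪ˡ (img middle ⊤) outer (∈-img middle ∈⊤))

-- The graphic and the cographic minor

module Minors (G₁ G₂ : Graph) where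
  private
    module S₁ = Subdivision G₁
    module S₂ = Subdivision G₂
    module C₁ = Components G₁
    module C₂ = Components G₂
    module M = Internally4 S₁.extra S₂.extra
    m = E S₁.K
    k = E S₂.K

  M₁ M₂ : ℕ
  M₁ = 3 + S₁.extra
  M₂ = 3 + S₂.extra

  -- The complement of the empty set in the second complete graph joins all terminals, so τ
  -- vanishes.
  rank-restriction : ∀ A → M.rank (A ++ ⊥) ≡ Components.rank S₁.K A
  rank-restriction A = ℕ.+-cancelʳ-≡ M.offset _ _ (begin
    M.rank (A ++ ⊥) + M.offset          ≡⟨ M.rank+offset A ⊥ ⟩
    ∣ ⊥ {k} ∣ + M.coupled A (∁ ⊥)       ≡⟨ ≡.cong₂ _+_ (∣⊥∣≡0 k) (≡.cong (M.coupled A) ∁⊥≡⊤) ⟩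
    M.coupled A ⊤                       ≡⟨ M.coupled-connectedʳ A (CompleteTerminals.connected-⊤ S₂.extra) ⟩
    Components.rank S₁.K A + M₂         ≡⟨ ≡.cong (Components.rank S₁.K A +_) (≡.sym M.offset-value) ⟩
    Components.rank S₁.K A + M.offset   ∎)
    where open ≡.≡-Reasoning

  -- The full edge set of the first complete graph joins all its terminals, so τ vanishes again and
  -- a dual rank remains, up to a constant.
  rank-contraction : ∀ B → M.rank (⊤ ++ B) + M.offset ≡ ∣ B ∣ + (M₁ + Components.rank S₂.K (∁ B))
  rank-contraction B = ≡.trans (M.rank+offset ⊤ B) (≡.cong (∣ B ∣ +_)
    (M.coupled-connectedˡ (∁ B) (CompleteTerminals.connected-⊤ S₁.extra)))

  graphic-minor : IsMinorOf C₁.rank M.matroid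
  graphic-minor = S₁.outer ++ ⊥ , f , S₁.middle-injective ∘ ↑ˡ-injective k _ _ ,
    (λ i i∈ → S₁.middle∉outer i (∈-++ˡ⁻ S₁.outer i∈)) , ranks
    where
    f : Fin (E G₁) → Fin (m + k)
    f i = S₁.middle i ↑ˡ k

    ranks : ∀ X → C₁.rank X + M.rank (S₁.outer ++ ⊥) ≡ M.rank (img f X ∪ (S₁.outer ++ ⊥))
    ranks X = begin
      C₁.rank X + M.rank (S₁.outer ++ ⊥)
        ≡⟨ ≡.cong (C₁.rank X +_) (≡.trans (rank-restriction S₁.outer) S₁.rank-outer) ⟩
      C₁.rank X + (E G₁ + E G₁)
        ≡⟨ ≡.sym (S₁.rank-subdivide X) ⟩
      Components.rank S₁.K (S₁.subdivide X)
        ≡⟨ ≡.sym (rank-restriction (S₁.subdivide X)) ⟩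
      M.rank (S₁.subdivide X ++ ⊥)
        ≡⟨ ≡.cong M.rank (≡.sym union) ⟩
      M.rank (img f X ∪ (S₁.outer ++ ⊥)) ∎
      where
      open ≡.≡-Reasoning
      union : img f X ∪ (S₁.outer ++ ⊥) ≡ S₁.subdivide X ++ ⊥ {k}
      union = ≡.trans (≡.cong (_∪ (S₁.outer ++ ⊥)) (img-↑ˡ k S₁.middle X))
        (≡.trans (∪-++ (img S₁.middle X) S₁.outer ⊥ ⊥)
          (≡.cong (S₁.subdivide X ++_) (∪-identityˡ ⊥)))

  cographic-minor : IsMinorOf (dualRank C₂.rank) M.matroid
  cographic-minor = C , f , S₂.middle-injective ∘ ↑ʳ-injective m _ _ ,
    (λ i i∈ → S₂.middle∉unused i (∈-++ʳ⁻ (⊤ {m}) i∈)) , ranks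
    where
    C : Subset (m + k)
    C = ⊤ ++ S₂.unused

    f : Fin (E G₂) → Fin (m + k)
    f i = m ↑ʳ S₂.middle i

    union : ∀ X → img f X ∪ C ≡ ⊤ ++ (img S₂.middle X ∪ S₂.unused)
    union X = ≡.trans (≡.cong (_∪ C) (img-↑ʳ m S₂.middle X))
      (≡.trans (∪-++ (⊥ {m}) ⊤ (img S₂.middle X) S₂.unused)
        (≡.cong (_++ (img S₂.middle X ∪ S₂.unused)) (∪-identityˡ (⊤ {m}))))

    loops : ℕ
    loops = E G₂ + E G₂

    c : ℕ
    c = ∣ S₂.unused ∣

    rank-union : ∀ X → M.rank (img f X ∪ C) + M.offset ≡
      (∣ X ∣ + c) + (M₁ + (C₂.rank (∁ X) + loops))
    rank-union X = begin
      M.rank (img f X ∪ C) + M.offset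
        ≡⟨ ≡.cong (λ Y → M.rank Y + M.offset) (union X) ⟩
      M.rank (⊤ ++ (img S₂.middle X ∪ S₂.unused)) + M.offset
        ≡⟨ rank-contraction (img S₂.middle X ∪ S₂.unused) ⟩
      ∣ img S₂.middle X ∪ S₂.unused ∣ + (M₁ + Components.rank S₂.K (∁ (img S₂.middle X ∪ S₂.unused)))
        ≡⟨ ≡.cong₂ (λ s r → s + (M₁ + r))
             (∣img∪∣ S₂.middle S₂.middle-injective S₂.unused S₂.middle∉unused X)
             (≡.trans (≡.cong (Components.rank S₂.K) (S₂.∁-middle∪unused X)) (S₂.rank-subdivide (∁ X))) ⟩
      (∣ X ∣ + c) + (M₁ + (C₂.rank (∁ X) + loops)) ∎
      where open ≡.≡-Reasoning

    rank-C : M.rank C + M.offset ≡ c + (M₁ + (C₂.rank ⊤ + loops))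
    rank-C = ≡.trans (rank-contraction S₂.unused) (≡.cong (λ r → c + (M₁ + r))
      (≡.trans (≡.cong (Components.rank S₂.K) (∁-involutive (S₂.subdivide ⊤))) (S₂.rank-subdivide ⊤)))

    -- The rank formula of the dual in additive form. The rank of the outer edges, `loops`, occurs
    -- on both sides and cancels.
    shift : ∀ X → C₂.rank ⊤ + M.rank (img f X ∪ C) ≡ (∣ X ∣ + C₂.rank (∁ X)) + M.rank C
    shift X = ℕ.+-cancelʳ-≡ M.offset _ _ (begin
      C₂.rank ⊤ + M.rank (img f X ∪ C) + M.offset
        ≡⟨ ℕ.+-assoc (C₂.rank ⊤) _ _ ⟩
      C₂.rank ⊤ + (M.rank (img f X ∪ C) + M.offset)
        ≡⟨ ≡.cong (C₂.rank ⊤ +_) (rank-union X) ⟩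
      C₂.rank ⊤ + ((∣ X ∣ + c) + (M₁ + (C₂.rank (∁ X) + loops)))
        ≡⟨ solve 6 (λ t x c m r l → t :+ ((x :+ c) :+ (m :+ (r :+ l))) :=
             (x :+ r) :+ (c :+ (m :+ (t :+ l)))) ≡.refl (C₂.rank ⊤) (∣ X ∣) c M₁ (C₂.rank (∁ X)) loops ⟩
      (∣ X ∣ + C₂.rank (∁ X)) + (c + (M₁ + (C₂.rank ⊤ + loops)))
        ≡⟨ ≡.cong ((∣ X ∣ + C₂.rank (∁ X)) +_) (≡.sym rank-C) ⟩
      (∣ X ∣ + C₂.rank (∁ X)) + (M.rank C + M.offset)
        ≡⟨ ≡.sym (ℕ.+-assoc (∣ X ∣ + C₂.rank (∁ X)) _ _) ⟩
      (∣ X ∣ + C₂.rank (∁ X)) + M.rank C + M.offset ∎)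
      where
      open ≡.≡-Reasoning
      open +-*-Solver

    -- Monotonicity of the rank of M shows that the subtraction in dualRank is not truncated.
    ranks : ∀ X → dualRank C₂.rank X + M.rank C ≡ M.rank (img f X ∪ C)
    ranks X = begin
      (∣ X ∣ + C₂.rank (∁ X) ∸ C₂.rank ⊤) + M.rank C
        ≡⟨ ≡.sym (ℕ.+-∸-comm (M.rank C) not-truncated) ⟩
      (∣ X ∣ + C₂.rank (∁ X)) + M.rank C ∸ C₂.rank ⊤
        ≡⟨ ≡.cong (_∸ C₂.rank ⊤) (≡.sym (shift X)) ⟩
      C₂.rank ⊤ + M.rank (img f X ∪ C) ∸ C₂.rank ⊤
        ≡⟨ ℕ.m+n∸m≡n (C₂.rank ⊤) _ ⟩
      M.rank (img f X ∪ C) ∎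
      where
      open ≡.≡-Reasoning
      not-truncated : C₂.rank ⊤ ≤ ∣ X ∣ + C₂.rank (∁ X)
      not-truncated = ℕ.+-cancelʳ-≤ (M.rank C) _ _ (ℕ.≤-trans
        (ℕ.+-monoʳ-≤ (C₂.rank ⊤) (Matroid.r-mono M.matroid C (img f X ∪ C) (q⊆p∪q (img f X) C)))
        (ℕ.≤-reflexive (shift X)))

theorem1p5 : (G₁ G₂ : Graph) →
    ∃ω λ (M : Matroid) →
    (InternallyFourConnected M ×
    (Σ (Subset (E G₁) → ℕ) λ r₁ → IsCycleMatroidRank G₁ r₁ × IsMinorOf r₁ M) ×
    (Σ (Subset (E G₂) → ℕ) λ r₂ → IsCycleMatroidRank G₂ r₂ × IsMinorOf (dualRank r₂) M))
    ∧ω NearRegular M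
theorem1p5 G₁ G₂ = M.matroid ,
  ((M.internally4Connected ,
    (Components.rank G₁ , Components.isCycleMatroidRank G₁ , Minors.graphic-minor G₁ G₂) ,
    (Components.rank G₂ , Components.isCycleMatroidRank G₂ , Minors.cographic-minor G₁ G₂)) ,
   M.nearRegular)
  where
  module M = Internally4 (Subdivision.extra G₁) (Subdivision.extra G₂)
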